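{- Let $k\ge 2$ be an integer. Then $g_k(n)=(k+1)(n-k-1)$ for every integer $n\ge \lceil (5k+1)/2\rceil$. Moreover, this threshold is sharp: for $n=\lceil (5k+1)/2\rceil-1$ there exists an $n$-vertex graph with $(k+1)(n-k-1)+1$ edges containing no cycle $C$ with a vertex of $C$ incident with at least $k$ chords of $C$.
   Context: All graphs are finite and simple. A chord of a cycle $C$ in a graph $G$ is an edge of $G$ joining two vertices of $C$ that are not consecutive on $C$. For integers $k\ge1$ and $n\ge k+2$, $g_k(n)$ denotes the maximum number of edges in an $n$-vertex graph containing no cycle $C$ with a vertex (of $C$) incident with at least $k$ chords of $C$. -}

module Defs where

open import Data.Fin using (Fin; toℕ; _<_; _<?_; _≟_)
open import Data.List using (length; filter; allFin; cartesianProduct)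
open import Data.Nat using (ℕ; suc; _+_; _≤_)
open import Data.Nat.DivMod using (_mod_)
open import Data.Product using (_×_; ∃-syntax; proj₁; proj₂)
open import Data.Sum using (_⊎_)
open import Function.Definitions using (Injective)
open import Level using (0ℓ)
open import Relation.Binary using (Rel; Decidable; Symmetric)
open import Relation.Binary.PropositionalEquality using (_≡_)
open import Relation.Nullary using (¬_)
open import Relation.Nullary.Decidable using (_×-dec_; _⊎-dec_; ¬?)
import Relation.Unary as U

-- Finite simple graphs with vertex set Fin n.
record Graph (n : ℕ) : Set₁ where
  field
    Adj    : Rel (Fin n) 0ℓ
    adj?   : Decidable Adj
    symm   : Symmetric Adj
    irrefl : ∀ {v} → ¬ Adj v v

-- Each edge {u , v} is counted once, as the pair with u < v.
edgeCount : ∀ {n} → Graph n → ℕ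
edgeCount {n} G = length (filter edge? (cartesianProduct (allFin n) (allFin n)))
  where
  open Graph G
  Edge : Fin n × Fin n → Set
  Edge p = proj₁ p < proj₂ p × Adj (proj₁ p) (proj₂ p)
  edge? : U.Decidable Edge
  edge? p = (proj₁ p <? proj₂ p) ×-dec adj? (proj₁ p) (proj₂ p)

-- Cyclic successor of a position: the last position is followed by the first.
next : ∀ {m} → Fin (suc m) → Fin (suc m)
next {m} i = suc (toℕ i) mod suc m

Consecutive : ∀ {m} → Rel (Fin (suc m)) 0ℓ
Consecutive i j = j ≡ next i ⊎ i ≡ next j

consecutive? : ∀ {m} → Decidable (Consecutive {m})
consecutive? i j = (j ≟ next i) ⊎-dec (i ≟ next j)

-- A cycle of length 3 + m, listed in cyclic order from some starting vertex.
record Cycle {n : ℕ} (G : Graph n) : Set where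
  open Graph G
  field
    m         : ℕ
    vertex    : Fin (3 + m) → Fin n
    injective : Injective _≡_ _≡_ vertex
    adjacent  : ∀ i → Adj (vertex i) (vertex (next i))

module _ {n : ℕ} {G : Graph n} (C : Cycle G) where
  open Graph G
  open Cycle C

  -- Vertices of C are referred to by their positions on C.
  Chord : Rel (Fin (3 + m)) 0ℓ
  Chord i j = Adj (vertex i) (vertex j) × ¬ Consecutive i j

  chord? : Decidable Chord
  chord? i j = adj? (vertex i) (vertex j) ×-dec ¬? (consecutive? i j)

  -- As vertex is injective, chords of C incident with vertex i correspond
  -- one-to-one to the positions j of their other ends.
  chordsAt : Fin (3 + m) → ℕ
  chordsAt i = length (filter (chord? i) (allFin (3 + m)))

HasCycleWithChords : ∀ {n} → ℕ → Graph n → Set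
HasCycleWithChords k G = ∃[ C ] ∃[ i ] k ≤ chordsAt {G = G} C i

-- g[ k , n ]≡ e says that g_k(n) = e, i.e. e is the maximum of the edge counts
-- of the n-vertex graphs G with ¬ HasCycleWithChords k G.
g[_,_]≡_ : ℕ → ℕ → ℕ → Set₁
g[ k , n ]≡ e =
  (∃[ G ] ¬ HasCycleWithChords k G × edgeCount {n} G ≡ e) ×
  (∀ (G : Graph n) → ¬ HasCycleWithChords k G → edgeCount G ≤ e)

{-# OPTIONS --safe #-}
-- Put K = k + 1 and N = ⌈(5k + 1)/2⌉.  A cycle as in the statement exists as soon as some
-- vertex v has more than K neighbours on a path avoiding v, so otherwise every vertex of a
-- cycle has at most K neighbours on it, and an end of a longest path has degree at most K.
-- Deleting such ends reduces the upper bound to n = N.  For n ≤ N one shows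
-- 6e ≤ κ + n² + n by induction, κ being (for k ≠ 3) the constant that makes the right-hand
-- side 6K(N − K) + 5 at n = N.  A vertex of degree at most n/3 can be deleted, so let all
-- degrees exceed n/3, and let C be a longest cycle, with c vertices, and R its complement.
--
-- * If R spans an edge, consider a longest path in R.  If its ends u, v are adjacent to distinct
--   vertices of C, a count of the gaps between their neighbours on C shows that u and v can be
--   deleted.  If this never happens, rotations of paths that all leave R through the same vertex
--   of C (or not at all) give a set X inside a block of j ≤ (n + 1)/2 vertices that contains all
--   neighbours of X; at most |X|j/2 edges meet X, and X can be deleted.
-- * If R is independent, let w in R have the largest degree D.  Neighbours of w are not
--   consecutive on C, and a vertex b of C between two neighbours of w can be exchanged for w,
--   so that b, like w, has at most c/2 neighbours on C.  There are at least 3D − c such b, and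
--   all other vertices of C have at most K neighbours on C.
--
-- The examples are the complete bipartite graph with parts of size k + 1 and n − k − 1, and, at
-- n = N − 1, the one with parts of size k and n − k together with a maximum matching on the former.
module Submission where

open import Defs
open import Data.Empty using (⊥; ⊥-elim)
open import Data.Fin using (Fin; toℕ; fromℕ; fromℕ<; inject₁; _↑ˡ_; _↑ʳ_)
import Data.Fin as Fin
import Data.Fin.Properties as Fin
open import Data.List
  using (List; []; _∷_; _++_; [_]; _∷ʳ_; length; map; reverse; filter; lookup; tabulate; allFin; upTo;
         cartesianProduct; initLast; _∷ʳ′_)
import Data.List.Membership.DecPropositional as DecMembership
open import Data.List.Membership.Propositional using (_∈_; _∉_)
open import Data.List.Membership.Propositional.Properties
  using (∈-∃++; ∈-++⁺ˡ; ∈-++⁺ʳ; ∈-++⁻; ∈-allFin; ∈-lookup; ∈-map⁺; ∈-map⁻; ∈-filter⁻; ∈-upTo⁺)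
open import Data.List.Properties
  using (length-++; ++-assoc; ++-identityʳ; map-++; unfold-reverse; reverse-++; ∷ʳ-injective; ∷-injective)
import Data.List.Properties as List
open import Data.List.Relation.Binary.Permutation.Propositional
  using (_↭_; ↭-refl; ↭-sym; ↭-trans; ↭-prep; ↭-reflexive; ↭⇒↭ₛ; module PermutationReasoning)
open import Data.List.Relation.Binary.Permutation.Propositional.Properties
  using (↭-length; ↭-reverse; ∈-resp-↭; shift; shifts; ++-comm; ++⁺ˡ; ++⁺ʳ; map⁺)
import Data.List.Relation.Binary.Permutation.Setoid.Properties as SetoidPermutation
open import Data.List.Relation.Unary.All as All using (All; []; _∷_)
open import Data.List.Relation.Unary.AllPairs using ([]; _∷_)
open import Data.List.Relation.Unary.Any using (here; there)
open import Data.List.Relation.Unary.Linked as Linked using (Linked; []; [-]; _∷_)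
open import Data.List.Relation.Unary.Unique.Propositional using (Unique)
import Data.List.Relation.Unary.Unique.Propositional.Properties as Unique
open import Data.Nat
  using (ℕ; zero; suc; _+_; _*_; _∸_; _≤_; _<_; _≤?_; _<?_; z≤n; s≤s; ⌈_/2⌉; ⌊_/2⌋)
open import Data.Nat.DivMod using (_%_; n%n≡0; m<n⇒m%n≡m)
open import Data.Nat.ListAction using (sum)
open import Data.Nat.ListAction.Properties using (sum-++; sum-↭)
open import Data.Nat.Properties hiding (_≟_; _≤?_; _<?_)
open import Data.Nat.Tactic.RingSolver using (solve-∀)
open import Data.Product using (_×_; _,_; ∃-syntax; proj₁; proj₂)
open import Data.Sum using (_⊎_; inj₁; inj₂)
open import Function using (_∘_)
open import Relation.Binary.Definitions using (tri<; tri≈; tri>)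
open import Relation.Binary.PropositionalEquality
  using (_≡_; _≢_; refl; sym; cong; cong₂; subst; subst₂; setoid; module ≡-Reasoning)
import Relation.Binary.PropositionalEquality as ≡
open import Relation.Nullary using (¬_; Dec; yes; no; contradiction)
open import Relation.Nullary.Decidable using (_×-dec_; _⊎-dec_; ¬?)
import Relation.Unary as U

-- The linear bound `K(n - K)` already fails at `n = N - 1`, so it cannot be carried through an
-- induction below `N`. The quadratic `κ + n² + n` for `6e` takes its place because its differences
-- are exactly what the three deletions may consume: a vertex of degree `n/3`, the two ends of a
-- path, a set `X` produced by rotations. The two bounds have to meet at `N`, up to the 5 that
-- rounding absorbs: `6e ≤ 6K(N - K) + 5` forces `e ≤ K(N - K)`. The threshold is felt through
-- `5K - 2N`, which is 3 or 4; in the critical estimate the square of this number must fit into a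
-- constant slack. Longest paths and cycles are maximal among all lists with some property and are
-- never searched for. They are available only under double negation, which is enough because each
-- use refutes a strict inequality between natural numbers.

-- Certificates for inequalities, maxima, and sums over duplicate-free lists

-- The form of nearly all estimates below: known inequalities are added up to `l ≤ r`, and the ring
-- solver checks one polynomial identity, in which `s` is the surplus.
≤-from : ∀ s {a b l r} → l ≤ r → a + r + s ≡ b + l → a ≤ b
≤-from s {a} {b} {l} {r} l≤r eq = +-cancelʳ-≤ r a b (begin
  a + r      ≤⟨ m≤m+n (a + r) s ⟩
  a + r + s  ≡⟨ eq ⟩
  b + l      ≤⟨ +-monoʳ-≤ b l≤r ⟩
  b + r      ∎)
  where open ≤-Reasoning

-- Membership in `P` cannot be tested, so a maximum is not computed but handed to a continuation
-- into `⊥`. An element that is not maximal is replaced by a larger one; the difference to `b` is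
-- the fuel of this climb.
maximal : ∀ {A : Set} (P : A → Set) (f : A → ℕ) (b : ℕ) → (∀ a → P a → f a ≤ b) →
          ∀ a → P a → (∀ m → P m → (∀ x → P x → f x ≤ f m) → ⊥) → ⊥
maximal P f b f≤b a pa k = climb b a pa (m≤n+m b (f a))
  where
  climb : ∀ d a → P a → b ≤ f a + d → ⊥
  climb d a pa b≤ = k a pa λ x px → ≮⇒≥ λ fa<fx → up d x px fa<fx b≤
    where
    up : ∀ d x → P x → f a < f x → b ≤ f a + d → ⊥
    up zero x px fa<fx b≤ = n≮n b (begin-strict
      b ≤⟨ b≤ ⟩ f a + 0 ≡⟨ +-identityʳ (f a) ⟩ f a <⟨ fa<fx ⟩ f x ≤⟨ f≤b x px ⟩ b ∎)
      where open ≤-Reasoning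
    up (suc d) x px fa<fx b≤ = climb d x px (begin
      b ≤⟨ b≤ ⟩ f a + suc d ≡⟨ +-suc (f a) d ⟩ suc (f a) + d ≤⟨ +-monoˡ-≤ d fa<fx ⟩ f x + d ∎)
      where open ≤-Reasoning

module _ {A : Set} where

  Unique-↭ : {xs ys : List A} → xs ↭ ys → Unique xs → Unique ys
  Unique-↭ p = SetoidPermutation.Unique-resp-↭ (setoid A) (↭⇒↭ₛ p)

  Unique-++ˡ : (xs {ys} : List A) → Unique (xs ++ ys) → Unique xs
  Unique-++ˡ [] u = []
  Unique-++ˡ (x ∷ xs) (x∉ ∷ u) = All.tabulate (λ m → All.lookup x∉ (∈-++⁺ˡ m)) ∷ Unique-++ˡ xs u

  Unique-++ʳ : (xs {ys} : List A) → Unique (xs ++ ys) → Unique ys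
  Unique-++ʳ [] u = u
  Unique-++ʳ (x ∷ xs) (_ ∷ u) = Unique-++ʳ xs u

  Unique-disjoint : (xs {ys} : List A) → Unique (xs ++ ys) → ∀ {v} → v ∈ xs → v ∉ ys
  Unique-disjoint (x ∷ xs) (x∉ ∷ u) (here refl) m = All.lookup x∉ (∈-++⁺ʳ xs m) refl
  Unique-disjoint (x ∷ xs) (x∉ ∷ u) (there i) m = Unique-disjoint xs u i m

  Unique-head : {x : A} {xs : List A} → Unique (x ∷ xs) → x ∉ xs
  Unique-head (x∉ ∷ _) m = All.lookup x∉ m refl

  ∉⇒Unique : {x : A} {xs : List A} → x ∉ xs → Unique xs → Unique (x ∷ xs)
  ∉⇒Unique x∉ u = All.tabulate (λ m → λ { refl → x∉ m }) ∷ u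

  -- Sets are duplicate-free lists up to `↭`, and this is their difference. Counting in `S` by parts
  -- always goes through such a permutation.
  complement : (xs : List A) {S : List A} → Unique xs → (∀ {v} → v ∈ xs → v ∈ S) →
               ∃[ R ] S ↭ xs ++ R
  complement [] {S} _ _ = S , ↭-refl
  complement (x ∷ xs) u xs⊆S with ∈-∃++ (xs⊆S (here refl))
  ... | ys , zs , refl with complement xs {ys ++ zs} (tl u) sub
    where
    tl : Unique (x ∷ xs) → Unique xs
    tl (_ ∷ u) = u
    sub : ∀ {v} → v ∈ xs → v ∈ ys ++ zs
    sub m with ∈-resp-↭ (shift x ys zs) (xs⊆S (there m))
    ... | here refl = contradiction m (Unique-head u)
    ... | there m′ = m′
  ... | R , p = R , ↭-trans (shift x ys zs) (↭-prep x p)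

  ⊆⇒length≤ : ∀ {xs S : List A} → Unique xs → (∀ {v} → v ∈ xs → v ∈ S) → length xs ≤ length S
  ⊆⇒length≤ {xs} u sub with complement xs u sub
  ... | R , p = ≤-trans (m≤m+n (length xs) (length R))
    (≤-reflexive (≡.trans (sym (length-++ xs)) (sym (↭-length p))))

  module _ (f : A → ℕ) where

    ∑ : List A → ℕ
    ∑ xs = sum (map f xs)

    ∑-++ : ∀ xs ys → ∑ (xs ++ ys) ≡ ∑ xs + ∑ ys
    ∑-++ xs ys = ≡.trans (cong sum (map-++ f xs ys)) (sum-++ (map f xs) (map f ys))

    ∑-↭ : ∀ {xs ys} → xs ↭ ys → ∑ xs ≡ ∑ ys
    ∑-↭ p = sum-↭ (map⁺ f p)

    ∑-≤* : ∀ {d} xs → (∀ {x} → x ∈ xs → f x ≤ d) → ∑ xs ≤ length xs * d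
    ∑-≤* [] _ = z≤n
    ∑-≤* (x ∷ xs) h = +-mono-≤ (h (here refl)) (∑-≤* xs (λ m → h (there m)))

    ∑-zero : ∀ xs → (∀ {x} → x ∈ xs → f x ≡ 0) → ∑ xs ≡ 0
    ∑-zero [] _ = refl
    ∑-zero (x ∷ xs) h = cong₂ _+_ (h (here refl)) (∑-zero xs (λ m → h (there m)))

  ∑-cong : ∀ {f g : A → ℕ} xs → (∀ {x} → x ∈ xs → f x ≡ g x) → ∑ f xs ≡ ∑ g xs
  ∑-cong [] h = refl
  ∑-cong (x ∷ xs) h = cong₂ _+_ (h (here refl)) (∑-cong xs (λ m → h (there m)))

  ∑-mono : ∀ {f g : A → ℕ} xs → (∀ {x} → x ∈ xs → f x ≤ g x) → ∑ f xs ≤ ∑ g xs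
  ∑-mono [] h = z≤n
  ∑-mono (x ∷ xs) h = +-mono-≤ (h (here refl)) (∑-mono xs (λ m → h (there m)))

  ∑-+ : ∀ (f g : A → ℕ) xs → ∑ (λ x → f x + g x) xs ≡ ∑ f xs + ∑ g xs
  ∑-+ f g [] = refl
  ∑-+ f g (x ∷ xs) rewrite ∑-+ f g xs = interchange (f x) (g x) (∑ f xs) (∑ g xs)
    where
    interchange : ∀ a b c d → a + b + (c + d) ≡ a + c + (b + d)
    interchange = solve-∀

∑-comm : ∀ {A B : Set} (f : A → B → ℕ) xs ys →
         ∑ (λ x → ∑ (f x) ys) xs ≡ ∑ (λ y → ∑ (λ x → f x y) xs) ys
∑-comm f [] ys = sym (∑-zero _ ys (λ _ → refl))
∑-comm f (x ∷ xs) ys =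
  ≡.trans (cong (∑ (f x) ys +_) (∑-comm f xs ys)) (sym (∑-+ (f x) (λ y → ∑ (λ x → f x y) xs) ys))

𝟙 : ∀ {P : Set} → Dec P → ℕ
𝟙 (yes _) = 1
𝟙 (no _) = 0

𝟙≤1 : ∀ {P : Set} (d : Dec P) → 𝟙 d ≤ 1
𝟙≤1 (yes _) = s≤s z≤n
𝟙≤1 (no _) = z≤n

𝟙-yes : ∀ {P : Set} (d : Dec P) → P → 𝟙 d ≡ 1
𝟙-yes (yes _) _ = refl
𝟙-yes (no ¬p) p = contradiction p ¬p

𝟙-no : ∀ {P : Set} (d : Dec P) → ¬ P → 𝟙 d ≡ 0
𝟙-no (yes p) ¬p = contradiction p ¬p
𝟙-no (no _) _ = refl

𝟙-mono : ∀ {P Q : Set} (d : Dec P) (e : Dec Q) → (P → Q) → 𝟙 d ≤ 𝟙 e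
𝟙-mono (no _) e f = z≤n
𝟙-mono (yes p) e f = ≤-reflexive (sym (𝟙-yes e (f p)))

-- Degrees and edge counts on lists of vertices

module Degrees {n : ℕ} (G : Graph n) where
  open Graph G

  deg : Fin n → List (Fin n) → ℕ
  deg v = ∑ (λ x → 𝟙 (adj? v x))

  cross : List (Fin n) → List (Fin n) → ℕ
  cross X Y = ∑ (λ x → deg x Y) X

  -- Twice the number of edges induced by a list of distinct vertices.
  e₂ : List (Fin n) → ℕ
  e₂ S = cross S S

  adj-sym : ∀ u v → 𝟙 (adj? u v) ≡ 𝟙 (adj? v u)
  adj-sym u v with adj? u v | adj? v u
  ... | yes _ | yes _ = refl
  ... | no _  | no _  = refl
  ... | yes p | no ¬q = contradiction (symm p) ¬q
  ... | no ¬p | yes q = contradiction (symm q) ¬p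

  Adj⇒≢ : ∀ {u v} → Adj u v → u ≢ v
  Adj⇒≢ p refl = irrefl p

  deg-++ : ∀ v xs ys → deg v (xs ++ ys) ≡ deg v xs + deg v ys
  deg-++ v = ∑-++ _

  deg-↭ : ∀ v {xs ys} → xs ↭ ys → deg v xs ≡ deg v ys
  deg-↭ v = ∑-↭ _

  deg≤length : ∀ v xs → deg v xs ≤ length xs
  deg≤length v xs = ≤-trans (∑-≤* _ xs (λ {x} _ → 𝟙≤1 (adj? v x))) (≤-reflexive (*-identityʳ _))

  deg-zero : ∀ v xs → (∀ {x} → x ∈ xs → ¬ Adj v x) → deg v xs ≡ 0
  deg-zero v xs h = ∑-zero _ xs (λ {x} m → 𝟙-no (adj? v x) (h m))

  deg-self : ∀ v xs → deg v (v ∷ xs) ≡ deg v xs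
  deg-self v xs = cong (_+ deg v xs) (𝟙-no (adj? v v) irrefl)

  -- Only the neighbours of `v` in `xs` have to lie in `ys`, which is just what is known about an
  -- end of a longest path.
  deg-⊆ : ∀ v {xs ys} → Unique xs → (∀ {x} → x ∈ xs → Adj v x → x ∈ ys) → deg v xs ≤ deg v ys
  deg-⊆ v {[]} _ _ = z≤n
  deg-⊆ v {x ∷ xs} (x∉ ∷ u) h with adj? v x in eq
  ... | no _ = deg-⊆ v u (λ m → h (there m))
  ... | yes a with ∈-∃++ (h (here refl) a)
  ...   | ps , qs , refl = begin
    suc (deg v xs)             ≤⟨ s≤s (deg-⊆ v {xs} {ps ++ qs} u sub) ⟩
    1 + deg v (ps ++ qs)       ≡⟨ cong (_+ deg v (ps ++ qs)) (sym (𝟙-yes (adj? v x) a)) ⟩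
    deg v (x ∷ ps ++ qs)       ≡⟨ deg-↭ v (↭-sym (shift x ps qs)) ⟩
    deg v (ps ++ x ∷ qs)       ∎
    where
    open ≤-Reasoning
    sub : ∀ {y} → y ∈ xs → Adj v y → y ∈ ps ++ qs
    sub m b with ∈-resp-↭ (shift x ps qs) (h (there m) b)
    ... | here refl = contradiction refl (All.lookup x∉ m)
    ... | there m′ = m′

  cross-↭ˡ : ∀ {X X′} Y → X ↭ X′ → cross X Y ≡ cross X′ Y
  cross-↭ˡ Y = ∑-↭ _

  cross-↭ʳ : ∀ X {Y Y′} → Y ↭ Y′ → cross X Y ≡ cross X Y′
  cross-↭ʳ X p = ∑-cong X (λ {x} _ → deg-↭ x p)

  cross-++ˡ : ∀ X X′ Y → cross (X ++ X′) Y ≡ cross X Y + cross X′ Y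
  cross-++ˡ X X′ Y = ∑-++ _ X X′

  cross-++ʳ : ∀ X Y Y′ → cross X (Y ++ Y′) ≡ cross X Y + cross X Y′
  cross-++ʳ X Y Y′ = ≡.trans (∑-cong X (λ {x} _ → deg-++ x Y Y′)) (∑-+ _ _ X)

  cross-comm : ∀ X Y → cross X Y ≡ cross Y X
  cross-comm X Y = ≡.trans (∑-comm _ X Y) (∑-cong Y (λ {y} _ → ∑-cong X (λ {x} _ → adj-sym x y)))

  cross-≤* : ∀ {d} X Y → (∀ {x} → x ∈ X → deg x Y ≤ d) → cross X Y ≤ length X * d
  cross-≤* X Y = ∑-≤* _ X

  cross-zero : ∀ X Y → (∀ {x y} → x ∈ X → y ∈ Y → ¬ Adj x y) → cross X Y ≡ 0
  cross-zero X Y h = ∑-zero _ X (λ {x} m → deg-zero x Y (h m))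

  e₂-↭ : ∀ {S S′} → S ↭ S′ → e₂ S ≡ e₂ S′
  e₂-↭ {S} {S′} p = ≡.trans (cross-↭ˡ S p) (cross-↭ʳ S′ p)

  e₂-++ : ∀ X Y → e₂ (X ++ Y) ≡ e₂ X + 2 * cross X Y + e₂ Y
  e₂-++ X Y
    rewrite cross-++ˡ X Y (X ++ Y) | cross-++ʳ X X Y | cross-++ʳ Y X Y | cross-comm Y X
    = rearrange (e₂ X) (cross X Y) (e₂ Y)
    where
    rearrange : ∀ a b c → a + b + (b + c) ≡ a + 2 * b + c
    rearrange = solve-∀

  e₂-∷ : ∀ v S → e₂ (v ∷ S) ≡ 2 * deg v (v ∷ S) + e₂ S
  e₂-∷ v S rewrite e₂-++ [ v ] S | deg-self v S | deg-self v [] = rearrange (deg v S) (e₂ S)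
    where
    rearrange : ∀ a b → 0 + 2 * (a + 0) + b ≡ 2 * a + b
    rearrange = solve-∀

-- Paths and longest cycles

module _ {A : Set} {_~_ : A → A → Set} where

  Linked-join : ∀ xs {x ys} → Linked _~_ (xs ++ [ x ]) → Linked _~_ (x ∷ ys) → Linked _~_ (xs ++ x ∷ ys)
  Linked-join [] _ l = l
  Linked-join (_ ∷ []) (r ∷ _) l = r ∷ l
  Linked-join (_ ∷ y ∷ xs) (r ∷ k) l = r ∷ Linked-join (y ∷ xs) k l

  Linked-++ˡ : ∀ xs {ys} → Linked _~_ (xs ++ ys) → Linked _~_ xs
  Linked-++ˡ [] _ = []
  Linked-++ˡ (_ ∷ []) _ = [-]
  Linked-++ˡ (_ ∷ y ∷ xs) (r ∷ l) = r ∷ Linked-++ˡ (y ∷ xs) l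

  Linked-++ʳ : ∀ xs {ys} → Linked _~_ (xs ++ ys) → Linked _~_ ys
  Linked-++ʳ [] l = l
  Linked-++ʳ (_ ∷ xs) l = Linked-++ʳ xs (Linked.tail l)

  Linked-upto : ∀ xs {x ys} → Linked _~_ (xs ++ x ∷ ys) → Linked _~_ (xs ++ [ x ])
  Linked-upto xs {x} {ys} l = Linked-++ˡ (xs ++ [ x ]) (subst (Linked _~_) (sym (++-assoc xs [ x ] ys)) l)

  Linked-∷ʳ-last : ∀ xs {x y} → Linked _~_ (xs ++ x ∷ [ y ]) → x ~ y
  Linked-∷ʳ-last xs l with Linked-++ʳ xs l
  ... | r ∷ _ = r

  Linked-reverse : (∀ {x y} → x ~ y → y ~ x) → ∀ {xs} → Linked _~_ xs → Linked _~_ (reverse xs)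
  Linked-reverse s [] = []
  Linked-reverse s [-] = [-]
  Linked-reverse s {x ∷ y ∷ xs} (r ∷ l)
    rewrite unfold-reverse x (y ∷ xs) | unfold-reverse y xs | ++-assoc (reverse xs) [ y ] [ x ]
    = Linked-join (reverse xs) (subst (Linked _~_) (unfold-reverse y xs) (Linked-reverse s l)) (s r ∷ [-])

module Cycles {n : ℕ} (G : Graph n) where
  open Graph G
  open Degrees G public

  -- The closed walk x, ys, x.
  record Cyc (x : Fin n) (ys : List (Fin n)) : Set where
    constructor cyc
    field
      closed : Linked Adj (x ∷ ys ++ [ x ])
      unique : Unique (x ∷ ys)
      long   : 2 ≤ length ys

  rotate-↭ : ∀ (x : Fin n) ys z zs → x ∷ ys ++ z ∷ zs ↭ z ∷ zs ++ x ∷ ys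
  rotate-↭ x ys z zs = ++-comm (x ∷ ys) (z ∷ zs)

  rotate : ∀ {x} ys {z zs} → Cyc x (ys ++ z ∷ zs) → Cyc z (zs ++ x ∷ ys)
  rotate {x} ys {z} {zs} (cyc l u g) = cyc
    (subst (Linked Adj) (cong (z ∷_) (sym (++-assoc zs (x ∷ ys) [ z ])))
      (Linked-join (z ∷ zs)
        (Linked-++ʳ (x ∷ ys) (subst (Linked Adj) (cong (x ∷_) (++-assoc ys (z ∷ zs) [ x ])) l))
        (Linked-upto (x ∷ ys) (subst (Linked Adj) (cong (x ∷_) (++-assoc ys (z ∷ zs) [ x ])) l))))
    (Unique-↭ (rotate-↭ x ys z zs) u)
    (subst (2 ≤_) (suc-injective (↭-length (rotate-↭ x ys z zs))) g)

  rotateTo : ∀ {x ys v} → Cyc x ys → v ∈ x ∷ ys → ∃[ zs ] Cyc v zs × x ∷ ys ↭ v ∷ zs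
  rotateTo {ys = ys} c (here refl) = ys , c , ↭-refl
  rotateTo {x} {v = v} c (there m) with ∈-∃++ m
  ... | ps , qs , refl = qs ++ x ∷ ps , rotate ps c , rotate-↭ x ps v qs

  -- The cycle is rotated so that it starts at `p`. If `post` is empty, `q` is the closing
  -- repetition of `x`; the condition `p ≢ q` excludes the segment that is the whole closed walk.
  arc : ∀ {x ys} → Cyc x ys → ∀ pre {p} mid {q} post → x ∷ ys ++ [ x ] ≡ pre ++ p ∷ mid ++ q ∷ post →
        p ≢ q → ∃[ rest ] Cyc p (mid ++ q ∷ rest) × x ∷ ys ↭ p ∷ mid ++ q ∷ rest
  arc {x} {ys} c pre {p} mid {q} post eq p≢q with initLast post
  arc {x} {ys} c pre {p} mid {q} .[] eq p≢q | [] with ∷ʳ-injective (x ∷ ys) (pre ++ p ∷ mid)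
      (≡.trans eq (sym (++-assoc pre (p ∷ mid) [ q ])))
  arc c [] mid .[] eq p≢q | [] | refl , refl = contradiction refl p≢q
  arc {x} c (_ ∷ pre) {p} mid .[] eq p≢q | [] | refl , refl = pre , rotate pre c , rotate-↭ x pre p mid
  arc {x} {ys} c pre {p} mid {q} .(post ++ [ z ]) eq p≢q | post ∷ʳ′ z
    with ∷ʳ-injective (x ∷ ys) (pre ++ p ∷ mid ++ q ∷ post) (≡.trans eq reassoc)
    where
    reassoc : pre ++ p ∷ mid ++ q ∷ post ++ [ z ] ≡ (pre ++ p ∷ mid ++ q ∷ post) ++ [ z ]
    reassoc = sym (≡.trans (++-assoc pre (p ∷ mid ++ q ∷ post) [ z ])
                           (cong (λ t → pre ++ p ∷ t) (++-assoc mid (q ∷ post) [ z ])))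
  arc c [] mid _ eq p≢q | post ∷ʳ′ z | refl , refl = post , c , ↭-refl
  arc {x} c (_ ∷ pre) {p} mid {q} _ eq p≢q | post ∷ʳ′ z | refl , refl =
    post ++ x ∷ pre ,
    subst (Cyc p) (++-assoc mid (q ∷ post) (x ∷ pre)) (rotate pre c) ,
    subst (λ t → x ∷ pre ++ p ∷ mid ++ q ∷ post ↭ p ∷ t) (++-assoc mid (q ∷ post) (x ∷ pre))
      (rotate-↭ x pre p (mid ++ q ∷ post))

  -- Relative to a set `S`, because the induction deletes vertices from `S` and leaves the graph as
  -- it is.
  record Longest (S : List (Fin n)) (x : Fin n) (ys R : List (Fin n)) : Set where
    constructor longest
    field
      cycle   : Cyc x ys
      split   : S ↭ (x ∷ ys) ++ R
      maximum : ∀ {x′ ys′} → Cyc x′ ys′ → (∀ {v} → v ∈ x′ ∷ ys′ → v ∈ S) → length ys′ ≤ length ys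

  module _ {S : List (Fin n)} where

    Longest-↭ : ∀ {x ys R p zs} → Longest S x ys R → Cyc p zs → x ∷ ys ↭ p ∷ zs → Longest S p zs R
    Longest-↭ {R = R} (longest c s m) c′ p = longest c′ (↭-trans s (++⁺ʳ R p))
      (λ d sub → ≤-trans (m d sub) (≤-reflexive (suc-injective (↭-length p))))

    onCycle⇒∈ : ∀ {x ys R v} → Longest S x ys R → v ∈ x ∷ ys → v ∈ S
    onCycle⇒∈ L m = ∈-resp-↭ (↭-sym (Longest.split L)) (∈-++⁺ˡ m)

    offCycle⇒∈ : ∀ {x ys R v} → Longest S x ys R → v ∈ R → v ∈ S
    offCycle⇒∈ {x} {ys} L m = ∈-resp-↭ (↭-sym (Longest.split L)) (∈-++⁺ʳ (x ∷ ys) m)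

    module _ (uS : Unique S) where

      splitUnique : ∀ {x ys R} → Longest S x ys R → Unique ((x ∷ ys) ++ R)
      splitUnique L = Unique-↭ (Longest.split L) uS

      offUnique : ∀ {x ys R} → Longest S x ys R → Unique R
      offUnique {x} {ys} L = Unique-++ʳ (x ∷ ys) (splitUnique L)

      -- The detour `P` through `R` takes the place of the arc `mid`. With `p`, `q` and a nonempty
      -- `P` there are three vertices even if `rest` is empty.
      replace : ∀ {p mid q rest R} → Longest S p (mid ++ q ∷ rest) R →
                ∀ P → 1 ≤ length P → Linked Adj (p ∷ P ++ [ q ]) → Unique P → (∀ {v} → v ∈ P → v ∈ R) →
                Cyc p (P ++ q ∷ rest)
      replace {p} {mid} {q} {rest} {R} L P 1≤P l uP P⊆R = cyc
        (subst (Linked Adj) (cong (p ∷_) (sym (++-assoc P (q ∷ rest) [ p ])))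
          (Linked-join (p ∷ P) l
            (Linked-++ʳ (p ∷ mid)
              (subst (Linked Adj) (cong (p ∷_) (++-assoc mid (q ∷ rest) [ p ])) (Cyc.closed (Longest.cycle L))))))
        (Unique-↭ (shift p P (q ∷ rest)) (Unique.++⁺ uP outer disj))
        (begin
          2                               ≤⟨ +-mono-≤ 1≤P (s≤s z≤n) ⟩
          length P + length (q ∷ rest)    ≡⟨ length-++ P ⟨
          length (P ++ q ∷ rest)          ∎)
        where
        open ≤-Reasoning
        outer : Unique (p ∷ q ∷ rest)
        outer = Unique-++ʳ mid (Unique-↭ (↭-sym (shift p mid (q ∷ rest))) (Cyc.unique (Longest.cycle L)))
        onto : ∀ {v} → v ∈ p ∷ q ∷ rest → v ∈ p ∷ mid ++ q ∷ rest
        onto (here refl) = here refl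
        onto (there m) = there (∈-++⁺ʳ mid m)
        disj : ∀ {v} → ¬ (v ∈ P × v ∈ p ∷ q ∷ rest)
        disj (a , b) = Unique-disjoint (p ∷ mid ++ q ∷ rest) (splitUnique L) (onto b) (P⊆R a)

      insert : ∀ {p mid q rest R} → Longest S p (mid ++ q ∷ rest) R →
               ∀ P → 1 ≤ length P → Linked Adj (p ∷ P ++ [ q ]) → Unique P → (∀ {v} → v ∈ P → v ∈ R) →
               length P ≤ length mid
      insert {p} {mid} {q} {rest} {R} L P 1≤P l uP P⊆R = +-cancelʳ-≤ (length (q ∷ rest)) _ _ (begin
        length P + length (q ∷ rest)    ≡⟨ length-++ P ⟨
        length (P ++ q ∷ rest)          ≤⟨ Longest.maximum L (replace L P 1≤P l uP P⊆R) sub ⟩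
        length (mid ++ q ∷ rest)        ≡⟨ length-++ mid ⟩
        length mid + length (q ∷ rest)  ∎)
        where
        open ≤-Reasoning
        sub : ∀ {v} → v ∈ p ∷ P ++ q ∷ rest → v ∈ S
        sub (here refl) = onCycle⇒∈ L (here refl)
        sub (there m) with ∈-++⁻ P m
        ... | inj₁ a = offCycle⇒∈ L (P⊆R a)
        ... | inj₂ b = onCycle⇒∈ L (there (∈-++⁺ʳ mid b))

      -- A detour longer than the arc that it bypasses would lengthen the longest cycle. Every
      -- restriction on how `R` is attached to the cycle comes from here.
      gap : ∀ {x ys R} → Longest S x ys R →
            ∀ P → 1 ≤ length P → Unique P → (∀ {v} → v ∈ P → v ∈ R) →
            ∀ pre {p} mid {q} post → x ∷ ys ++ [ x ] ≡ pre ++ p ∷ mid ++ q ∷ post → p ≢ q →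
            Linked Adj (p ∷ P ++ [ q ]) → length P ≤ length mid
      gap L P 1≤P uP P⊆R pre {p} mid post eq p≢q l with arc (Longest.cycle L) pre mid post eq p≢q
      ... | rest , c , perm = insert {mid = mid} (Longest-↭ L c perm) P 1≤P l uP P⊆R

      -- A detour of the same length gives another longest cycle, and now `mid` lies off it. Facts
      -- about vertices off a longest cycle thus become available for vertices of `mid`.
      swapArc : ∀ {p mid q rest R} → Longest S p (mid ++ q ∷ rest) R →
                ∀ P → length P ≡ length mid → 1 ≤ length P → Linked Adj (p ∷ P ++ [ q ]) → Unique P →
                (∀ {v} → v ∈ P → v ∈ R) → ∃[ R₁ ] Longest S p (P ++ q ∷ rest) (mid ++ R₁)
      swapArc {p} {mid} {q} {rest} {R} L P len 1≤P l uP P⊆R with complement P uP P⊆R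
      ... | R₁ , R↭ = R₁ , longest (replace {mid = mid} L P 1≤P l uP P⊆R)
        (begin
          S                                        ↭⟨ Longest.split L ⟩
          p ∷ (mid ++ q ∷ rest) ++ R               ↭⟨ ++⁺ˡ (p ∷ mid ++ q ∷ rest) R↭ ⟩
          p ∷ (mid ++ q ∷ rest) ++ P ++ R₁         ≡⟨ cong (p ∷_) (++-assoc mid (q ∷ rest) (P ++ R₁)) ⟩
          p ∷ mid ++ q ∷ rest ++ P ++ R₁           ↭⟨ ↭-prep p (++⁺ˡ mid (shifts (q ∷ rest) P)) ⟩
          p ∷ mid ++ P ++ q ∷ rest ++ R₁           ↭⟨ ↭-prep p (shifts mid P) ⟩
          p ∷ P ++ mid ++ q ∷ rest ++ R₁           ↭⟨ ↭-prep p (++⁺ˡ P (shifts mid (q ∷ rest))) ⟩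
          p ∷ P ++ q ∷ rest ++ mid ++ R₁           ≡⟨ cong (p ∷_) (++-assoc P (q ∷ rest) (mid ++ R₁)) ⟨
          p ∷ (P ++ q ∷ rest) ++ mid ++ R₁         ∎)
        (λ c sub → ≤-trans (Longest.maximum L c sub) (≤-reflexive lengths))
        where
        open PermutationReasoning
        lengths : length (mid ++ q ∷ rest) ≡ length (P ++ q ∷ rest)
        lengths = ≡.trans (length-++ mid) (≡.trans (cong (_+ length (q ∷ rest)) (sym len)) (sym (length-++ P)))

-- Longest cycles with an independent complement

module _ {A : Set} (M : A → Set) (M? : ∀ x → Dec (M x)) where

  count : List A → ℕ
  count = ∑ (λ x → 𝟙 (M? x))

  NoTwoConsecutive : List A → Set
  NoTwoConsecutive xs = ∀ pre p q post → xs ≡ pre ++ p ∷ q ∷ post → M p → M q → ⊥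

  -- The list is a cycle cut open at a marked vertex, which is repeated as `e`. So the last entry
  -- cannot be marked either, and each marked entry is paired with the unmarked one after it.
  spread : ∀ zs {e} → M e → NoTwoConsecutive (zs ++ [ e ]) → 2 * count zs ≤ length zs
  spread [] me h = z≤n
  spread (z ∷ zs) me h with M? z
  ... | no _ = m≤n⇒m≤1+n (spread zs me (λ pre p q post eq → h (z ∷ pre) p q post (cong (z ∷_) eq)))
  spread (z ∷ []) me h | yes mz = ⊥-elim (h [] z _ [] refl mz me)
  spread (z ∷ z′ ∷ zs) me h | yes mz with M? z′
  ... | yes mz′ = ⊥-elim (h [] z z′ _ refl mz mz′)
  ... | no _ = ≤-trans (≤-reflexive (*-suc 2 (count zs)))
    (s≤s (s≤s (spread zs me (λ pre p q post eq → h (z ∷ z′ ∷ pre) p q post (cong (λ t → z ∷ z′ ∷ t) eq)))))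

  -- A marked vertex starts a gap; gaps of length two have a cheap second vertex, and in
  -- longer gaps the bound K on φ suffices because h ≤ 2K.
  weigh : (φ : A → ℕ) (K h : ℕ) → h ≤ 2 * K → ∀ zs {e} → M e →
          NoTwoConsecutive (zs ++ [ e ]) →
          (∀ {z} → z ∈ zs → φ z ≤ K) →
          (∀ pre p b q post → zs ++ [ e ] ≡ pre ++ p ∷ b ∷ q ∷ post → M p → M q → 2 * φ b ≤ h) →
          2 * ∑ φ zs + 6 * (K * count zs) + h * length zs ≤ 4 * (K * length zs) + 3 * (h * count zs)
  weigh φ K h h≤2K zs me no2 le mid = free zs me (no2 , le , mid)
    where
    step₁ : ∀ K h f s n c → f ≤ K → h ≤ 2 * K →
            2 * s + 6 * (K * c) + h * n ≤ 4 * (K * n) + 3 * (h * c) →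
            2 * (f + s) + 6 * (K * c) + h * suc n ≤ 4 * (K * suc n) + 3 * (h * c)
    step₁ K h f s n c f≤K h≤2K ih =
      ≤-from 0 (+-mono-≤ (+-mono-≤ (*-monoʳ-≤ 2 f≤K) h≤2K) ih) (eq K h f s n c)
      where
      eq : ∀ K h f s n c → 2 * (f + s) + 6 * (K * c) + h * suc n
             + (2 * K + 2 * K + (4 * (K * n) + 3 * (h * c))) + 0
           ≡ 4 * (K * suc n) + 3 * (h * c) + (2 * f + h + (2 * s + 6 * (K * c) + h * n))
      eq = solve-∀
    step₂ : ∀ K h f g s n c → f ≤ K → 2 * g ≤ h →
            2 * s + 6 * (K * c) + h * n ≤ 4 * (K * n) + 3 * (h * c) →
            2 * (f + (g + s)) + 6 * (K * suc c) + h * suc (suc n) ≤ 4 * (K * suc (suc n)) + 3 * (h * suc c)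
    step₂ K h f g s n c f≤K g≤h ih =
      ≤-from 0 (+-mono-≤ (+-mono-≤ (*-monoʳ-≤ 2 f≤K) g≤h) ih) (eq K h f g s n c)
      where
      eq : ∀ K h f g s n c → 2 * (f + (g + s)) + 6 * (K * suc c) + h * suc (suc n)
             + (2 * K + h + (4 * (K * n) + 3 * (h * c))) + 0
           ≡ 4 * (K * suc (suc n)) + 3 * (h * suc c) + (2 * f + 2 * g + (2 * s + 6 * (K * c) + h * n))
      eq = solve-∀
    step₃ : ∀ K h f g k s n c → f ≤ K → g ≤ K → k ≤ K →
            2 * s + 6 * (K * c) + h * n ≤ 4 * (K * n) + 3 * (h * c) →
            2 * (f + (g + (k + s))) + 6 * (K * suc c) + h * suc (suc (suc n))
              ≤ 4 * (K * suc (suc (suc n))) + 3 * (h * suc c)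
    step₃ K h f g k s n c f≤K g≤K k≤K ih =
      ≤-from 0 (+-mono-≤ (*-monoʳ-≤ 2 (+-mono-≤ (+-mono-≤ f≤K g≤K) k≤K)) ih) (eq K h f g k s n c)
      where
      eq : ∀ K h f g k s n c → 2 * (f + (g + (k + s))) + 6 * (K * suc c) + h * suc (suc (suc n))
             + (2 * (K + K + K) + (4 * (K * n) + 3 * (h * c))) + 0
           ≡ 4 * (K * suc (suc (suc n))) + 3 * (h * suc c)
             + (2 * (f + g + k) + (2 * s + 6 * (K * c) + h * n))
      eq = solve-∀
    Hyps : List A → A → Set
    Hyps zs e = NoTwoConsecutive (zs ++ [ e ]) × (∀ {z} → z ∈ zs → φ z ≤ K) ×
      (∀ pre p b q post → zs ++ [ e ] ≡ pre ++ p ∷ b ∷ q ∷ post → M p → M q → 2 * φ b ≤ h)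
    dropHyps : ∀ {z zs e} → Hyps (z ∷ zs) e → Hyps zs e
    dropHyps {z} (no2 , le , mid) =
      (λ pre p q post eq → no2 (z ∷ pre) p q post (cong (z ∷_) eq)) ,
      (λ m → le (there m)) ,
      (λ pre p b q post eq → mid (z ∷ pre) p b q post (cong (z ∷_) eq))
    -- The scan has three states: nothing is pending (`free`), a marked vertex has just been passed
    -- (`marked`), or a marked and then an unmarked one (`unmarked`). Their values `f` and `g` are
    -- held back until it is known whether the gap has length two.
    free : ∀ zs {e} → M e → Hyps zs e →
      2 * ∑ φ zs + 6 * (K * count zs) + h * length zs ≤ 4 * (K * length zs) + 3 * (h * count zs)
    marked : ∀ zs {e} → M e → Hyps zs e → ∀ f → f ≤ K →
      (∀ q post → zs ++ [ e ] ≡ q ∷ post → ¬ M q) →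
      (∀ b q post → zs ++ [ e ] ≡ b ∷ q ∷ post → M q → 2 * φ b ≤ h) →
      2 * (f + ∑ φ zs) + 6 * (K * suc (count zs)) + h * suc (length zs)
        ≤ 4 * (K * suc (length zs)) + 3 * (h * suc (count zs))
    unmarked : ∀ zs {e} → M e → Hyps zs e → ∀ f g → f ≤ K → g ≤ K →
      (∀ q post → zs ++ [ e ] ≡ q ∷ post → M q → 2 * g ≤ h) →
      2 * (f + (g + ∑ φ zs)) + 6 * (K * suc (count zs)) + h * suc (suc (length zs))
        ≤ 4 * (K * suc (suc (length zs))) + 3 * (h * suc (count zs))
    free [] me H rewrite *-zeroʳ K | *-zeroʳ h = z≤n
    free (a ∷ zs) me H@(no2 , le , mid) with M? a
    ... | no _ = step₁ K h (φ a) (∑ φ zs) (length zs) (count zs) (le (here refl)) h≤2K (free zs me (dropHyps H))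
    ... | yes ma = marked zs me (dropHyps H) (φ a) (le (here refl))
      (λ q post eq → no2 [] a q post (cong (a ∷_) eq) ma)
      (λ b q post eq → mid [] a b q post (cong (a ∷_) eq) ma)
    marked [] {e} me H f f≤K next _ = ⊥-elim (next e [] refl me)
    marked (b ∷ zs) me H@(_ , le , _) f f≤K next short with M? b
    ... | yes mb = ⊥-elim (next b _ refl mb)
    ... | no _ = unmarked zs me (dropHyps H) f (φ b) f≤K (le (here refl))
      (λ q post eq → short b q post (cong (b ∷_) eq))
    unmarked [] {e} me H f g f≤K g≤K short = step₂ K h f g 0 0 0 f≤K (short e [] refl me) (free [] me H)
    unmarked (c ∷ zs) {e} me H@(no2 , le , mid) f g f≤K g≤K short with M? c
    ... | yes mc = step₂ K h f g (φ c + ∑ φ zs) (suc (length zs)) (suc (count zs)) f≤K (short c _ refl mc)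
      (marked zs me (dropHyps H) (φ c) (le (here refl))
        (λ q post eq → no2 [] c q post (cong (c ∷_) eq) mc)
        (λ b q post eq → mid [] c b q post (cong (c ∷_) eq) mc))
    ... | no _ = step₃ K h f g (φ c) (∑ φ zs) (length zs) (count zs) f≤K g≤K (le (here refl))
      (free zs me (dropHyps H))

module Sparse {n : ℕ} (G : Graph n) (K : ℕ)
              (sparse : ∀ v zs → Linked (Graph.Adj G) zs → Unique (v ∷ zs) → Degrees.deg G v zs ≤ K) where
  open Graph G
  open Cycles G public

  module OnSet {S : List (Fin n)} (uS : Unique S) where

    deg-onCycle : ∀ {x ys v} → Cyc x ys → v ∈ x ∷ ys → deg v (x ∷ ys) ≤ K
    deg-onCycle {x} {ys} {v} c m with rotateTo c m
    ... | zs , d , p = begin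
      deg v (x ∷ ys)  ≡⟨ deg-↭ v p ⟩
      deg v (v ∷ zs)  ≡⟨ deg-self v zs ⟩
      deg v zs        ≤⟨ sparse v zs (Linked-++ˡ zs (Linked.tail (Cyc.closed d))) (Cyc.unique d) ⟩
      K               ∎
      where open ≤-Reasoning

    consecutive⇒≢ : ∀ {x ys} → Cyc x ys → ∀ pre {p q} post → x ∷ ys ++ [ x ] ≡ pre ++ p ∷ q ∷ post → p ≢ q
    consecutive⇒≢ c pre post eq with Linked-++ʳ pre (subst (Linked Adj) eq (Cyc.closed c))
    ... | r ∷ _ = Adj⇒≢ r

    alternate⇒≢ : ∀ {x ys} → Cyc x ys → ∀ pre {p b q} post →
                  x ∷ ys ++ [ x ] ≡ pre ++ p ∷ b ∷ q ∷ post → p ≢ q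
    alternate⇒≢ {x} {ys} c pre {p} {b} post eq refl with initLast post
    ... | post′ ∷ʳ′ z = Unique-head
        (Unique-++ʳ pre (subst Unique (proj₁ (∷ʳ-injective (x ∷ ys) (pre ++ p ∷ b ∷ p ∷ post′)
          (≡.trans eq (sym (++-assoc pre (p ∷ b ∷ p ∷ post′) [ z ]))))) (Cyc.unique c)))
        (there (here refl))
    ... | [] with ∷ʳ-injective (x ∷ ys) (pre ++ p ∷ b ∷ []) (≡.trans eq (sym (++-assoc pre (p ∷ b ∷ []) [ p ])))
    alternate⇒≢ c [] {p} {b} .[] eq refl | [] | refl , _ with Cyc.long c
    ... | s≤s ()
    alternate⇒≢ c (_ ∷ pre) {p} {b} .[] eq refl | [] | refl , refl =
      Unique-head (Cyc.unique c) (∈-++⁺ʳ pre (here refl))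

    -- Otherwise `w` could be inserted between the two: for an empty arc `gap` says `1 ≤ 0`.
    noTwo : ∀ {x ys R w} → Longest S x ys R → w ∈ R → NoTwoConsecutive (Adj w) (adj? w) (x ∷ ys ++ [ x ])
    noTwo {w = w} L w∈R pre p q post eq wp wq with
      gap uS L [ w ] (s≤s z≤n) ([] ∷ []) (λ { (here refl) → w∈R }) pre [] post eq
        (consecutive⇒≢ (Longest.cycle L) pre post eq) (symm wp ∷ wq ∷ [-])
    ... | ()

    neighbour : ∀ v xs → deg v xs ≢ 0 → ∃[ y ] y ∈ xs × Adj v y
    neighbour v [] h = contradiction refl h
    neighbour v (x ∷ xs) h with adj? v x
    ... | yes a = x , here refl , a
    ... | no _ with neighbour v xs h
    ...   | y , m , a = y , there m , a

    deg-offCycle : ∀ {x ys R w} → Longest S x ys R → w ∈ R → 2 * deg w (x ∷ ys) ≤ length (x ∷ ys)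
    deg-offCycle {x} {ys} {R} {w} L w∈R with deg w (x ∷ ys) Data.Nat.≟ 0
    ... | yes z rewrite z = z≤n
    ... | no nz with neighbour w (x ∷ ys) nz
    ...   | y , m , wy with rotateTo (Longest.cycle L) m
    ...     | zs , c , p rewrite deg-↭ w p | ↭-length p =
      spread (Adj w) (adj? w) (y ∷ zs) wy (noTwo (Longest-↭ L c p) w∈R)

    -- b may be exchanged for w, so b is off some longest cycle as well.
    deg-between : ∀ {x ys R w} → Longest S x ys R → w ∈ R → ∀ pre p b q post →
                  x ∷ ys ++ [ x ] ≡ pre ++ p ∷ b ∷ q ∷ post → Adj w p → Adj w q →
                  2 * deg b (x ∷ ys) ≤ length (x ∷ ys)
    deg-between {x} {ys} {R} {w} L w∈R pre p b q post eq wp wq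
      with arc (Longest.cycle L) pre (b ∷ []) post eq (alternate⇒≢ (Longest.cycle L) pre post eq)
    ... | rest , c , perm with swapArc uS {mid = [ b ]} (Longest-↭ L c perm) [ w ] refl (s≤s z≤n)
                                 (symm wp ∷ wq ∷ [-]) ([] ∷ []) (λ { (here refl) → w∈R })
    ...   | _ , swapped = begin
      2 * deg b (x ∷ ys)                ≡⟨ cong (2 *_) (deg-↭ b (↭-trans perm (shift b [ p ] (q ∷ rest)))) ⟩
      2 * deg b (b ∷ p ∷ q ∷ rest)      ≡⟨ cong (2 *_) (deg-self b (p ∷ q ∷ rest)) ⟩
      2 * deg b (p ∷ q ∷ rest)          ≤⟨ *-monoʳ-≤ 2 (m≤n+m _ (𝟙 (adj? b w))) ⟩
      2 * deg b (w ∷ p ∷ q ∷ rest)      ≡⟨ cong (2 *_) (deg-↭ b (↭-sym (shift w [ p ] (q ∷ rest)))) ⟩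
      2 * deg b (p ∷ w ∷ q ∷ rest)      ≤⟨ deg-offCycle swapped (here refl) ⟩
      length (p ∷ w ∷ q ∷ rest)         ≡⟨ ↭-length perm ⟨
      length (x ∷ ys)                   ∎
      where open ≤-Reasoning

    e₂-cycle≤ : ∀ {x ys} → Cyc x ys → e₂ (x ∷ ys) ≤ length (x ∷ ys) * K
    e₂-cycle≤ {x} {ys} c = cross-≤* (x ∷ ys) (x ∷ ys) (deg-onCycle c)

    -- This is `2 e₂ ≤ 2cK - (3D - c)(2K - c)` without subtraction. Of the `D` gaps at least
    -- `3D - c` have length two, and the inner vertex of such a gap has degree at most `c/2` on the
    -- cycle instead of `K`.
    e₂-cycle : ∀ {x ys R w} → Longest S x ys R → w ∈ R → 0 < deg w (x ∷ ys) →
               let c = length (x ∷ ys) ; D = deg w (x ∷ ys) in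
               c ≤ 2 * K → 2 * e₂ (x ∷ ys) + 6 * (K * D) + c * c ≤ 4 * (K * c) + 3 * (c * D)
    e₂-cycle {x} {ys} {R} {w} L w∈R pos c≤2K with neighbour w (x ∷ ys) (λ e → <-irrefl (sym e) pos)
    ... | y , m , wy with rotateTo (Longest.cycle L) m
    ...   | zs , c , p = transport (e₂-↭ p) (deg-↭ w p) (↭-length p)
      (weigh (Adj w) (adj? w) (λ v → deg v (y ∷ zs)) K (length (y ∷ zs))
        (subst (_≤ 2 * K) (↭-length p) c≤2K) (y ∷ zs) wy
        (noTwo L′ w∈R) (deg-onCycle c)
        (λ pre p b q post eq → deg-between L′ w∈R pre p b q post eq))
      where
      L′ = Longest-↭ L c p
      transport : ∀ {e e′ d d′ c c′} → e ≡ e′ → d ≡ d′ → c ≡ c′ →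
                  2 * e′ + 6 * (K * d′) + c′ * c′ ≤ 4 * (K * c′) + 3 * (c′ * d′) →
                  2 * e + 6 * (K * d) + c * c ≤ 4 * (K * c) + 3 * (c * d)
      transport refl refl refl h = h

    dominating : ∀ {x ys R} → Longest S x ys R → (∀ {u v} → u ∈ R → v ∈ R → ¬ Adj u v) →
                 ∀ {w} → w ∈ R → (∀ {u} → u ∈ R → deg u (x ∷ ys) ≤ deg w (x ∷ ys)) →
                 e₂ S ≤ e₂ (x ∷ ys) + 2 * (length R * deg w (x ∷ ys))
    dominating {x} {ys} {R} L indep {w} w∈R max = begin
      e₂ S                                     ≡⟨ e₂-↭ (Longest.split L) ⟩
      e₂ (C ++ R)                              ≡⟨ e₂-++ C R ⟩
      e₂ C + 2 * cross C R + e₂ R              ≡⟨ cong₂ (λ a b → e₂ C + 2 * a + b) (cross-comm C R) (cross-zero R R indep) ⟩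
      e₂ C + 2 * cross R C + 0                 ≡⟨ +-identityʳ _ ⟩
      e₂ C + 2 * cross R C                     ≤⟨ +-monoʳ-≤ (e₂ C) (*-monoʳ-≤ 2 (cross-≤* R C max)) ⟩
      e₂ C + 2 * (length R * deg w C)          ∎
      where
      open ≤-Reasoning
      C = x ∷ ys

-- Paths off a longest cycle with both ends attached to it

module Separation {X : Set} (ℓ : ℕ) (2≤ℓ : 2 ≤ ℓ) where

  -- `A` and `B` stand for adjacency to the two ends of a path with `ℓ` vertices off the cycle, `k`
  -- for the number of vertices strictly between `x` and `y` on the cycle. A change of type needs
  -- room for the whole path, a repetition only for one end.
  record Separated (A B : X → Set) (x y : X) (k : ℕ) : Set where
    constructor separated
    field
      ab : A x → B y → ℓ ≤ k
      ba : B x → A y → ℓ ≤ k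
      aa : A x → A y → 1 ≤ k
      bb : B x → B y → 1 ≤ k

  module _ {A B : X → Set} (A? : ∀ x → Dec (A x)) (B? : ∀ x → Dec (B x)) where

    weight : X → ℕ
    weight x = 𝟙 (A? x) + 𝟙 (B? x)

    -- A gap pays 4 per edge, and each of its ends claims 3 per unit of weight. Since weights are at
    -- most 2, a mixed gap has `4ℓ - 8` to spare.
    close-mixed : ∀ x y k → ℓ ≤ k → 3 * weight x + 3 * weight y + 4 * ℓ ≤ 4 * suc k + 8
    close-mixed x y k ℓ≤k = begin
      3 * weight x + 3 * weight y + 4 * ℓ
        ≤⟨ +-mono-≤ (+-mono-≤ (*-monoʳ-≤ 3 (≤2 x)) (*-monoʳ-≤ 3 (≤2 y))) (*-monoʳ-≤ 4 ℓ≤k) ⟩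
      12 + 4 * k
        ≡⟨ eq k ⟩
      4 * suc k + 8
        ∎
      where
      open ≤-Reasoning
      ≤2 : ∀ x → weight x ≤ 2
      ≤2 x = +-mono-≤ (𝟙≤1 (A? x)) (𝟙≤1 (B? x))
      eq : ∀ k → 12 + 4 * k ≡ 4 * suc k + 8
      eq = solve-∀

    -- A gap that is mixed in some way has room because `ℓ ≥ 2`. Otherwise both ends have weight at
    -- most 1, and one vertex in between suffices: `6 ≤ 8`.
    close : ∀ x y k → A x ⊎ B x → A y ⊎ B y → Separated A B x y k → 3 * weight x + 3 * weight y ≤ 4 * suc k
    close x y k mx my (separated ab ba aa bb) with (A? x ×-dec B? y) ⊎-dec (B? x ×-dec A? y)
    ... | yes m = ≤-from 0 (+-mono-≤ (close-mixed x y k (far m)) (*-monoʳ-≤ 4 2≤ℓ)) (eq (3 * weight x + 3 * weight y) ℓ k)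
      where
      far : A x × B y ⊎ B x × A y → ℓ ≤ k
      far (inj₁ (a , b)) = ab a b
      far (inj₂ (b , a)) = ba b a
      eq : ∀ u ℓ k → u + (4 * suc k + 8 + 4 * ℓ) + 0 ≡ 4 * suc k + (u + 4 * ℓ + 8)
      eq = solve-∀
    ... | no ¬m = begin
      3 * weight x + 3 * weight y ≤⟨ +-mono-≤ (*-monoʳ-≤ 3 (proj₁ bounds)) (*-monoʳ-≤ 3 (proj₁ (proj₂ bounds))) ⟩
      6                           ≤⟨ m≤n+m 6 2 ⟩
      8                           ≤⟨ *-monoʳ-≤ 4 (s≤s (proj₂ (proj₂ bounds))) ⟩
      4 * suc k                   ∎
      where
      open ≤-Reasoning
      onlyA : ∀ x → ¬ B x → weight x ≤ 1
      onlyA x ¬b rewrite 𝟙-no (B? x) ¬b | +-identityʳ (𝟙 (A? x)) = 𝟙≤1 (A? x)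
      onlyB : ∀ x → ¬ A x → weight x ≤ 1
      onlyB x ¬a rewrite 𝟙-no (A? x) ¬a = 𝟙≤1 (B? x)
      unmixed : A x ⊎ B x → A y ⊎ B y → weight x ≤ 1 × weight y ≤ 1 × 1 ≤ k
      unmixed (inj₁ a) (inj₁ a′) = onlyA x (λ b → ¬m (inj₂ (b , a′))) , onlyA y (λ b → ¬m (inj₁ (a , b))) , aa a a′
      unmixed (inj₂ b) (inj₂ b′) = onlyB x (λ a → ¬m (inj₁ (a , b′))) , onlyB y (λ a → ¬m (inj₂ (b , a))) , bb b b′
      unmixed (inj₁ a) (inj₂ b) = ⊥-elim (¬m (inj₁ (a , b)))
      unmixed (inj₂ b) (inj₁ a) = ⊥-elim (¬m (inj₂ (b , a)))
      bounds : weight x ≤ 1 × weight y ≤ 1 × 1 ≤ k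
      bounds = unmixed mx my

    AllSeparated : List X → Set
    AllSeparated L = ∀ pre x U y post → L ≡ pre ++ x ∷ U ++ y ∷ post → Separated A B x y (length U)

    -- k vertices have been passed since the last marked vertex x.
    After : X → ℕ → List X → Set
    After x k L = ∀ U y post → L ≡ U ++ y ∷ post → Separated A B x y (k + length U)

    after-∷ : ∀ {x k z L} → After x k (z ∷ L) → After x (suc k) L
    after-∷ {x} {k} {z} h U y post eq =
      subst (Separated A B x y) (+-suc k (length U)) (h (z ∷ U) y post (cong (z ∷_) eq))

    all-∷ : ∀ {z L} → AllSeparated (z ∷ L) → AllSeparated L
    all-∷ {z} h pre x U y post eq = h (z ∷ pre) x U y post (cong (z ∷_) eq)

    combine : ∀ r a x z e s k n → 3 * x + 3 * z + r ≤ 4 * suc k + a →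
              ∀ r′ a′ → 3 * z + 3 * e + 6 * s + r′ ≤ 4 * suc n + a′ →
              3 * x + 3 * e + 6 * (z + s) + (r + r′) ≤ 4 * suc (k + suc n) + (a + a′)
    combine r a x z e s k n p r′ a′ q = ≤-from 0 (+-mono-≤ p q) (eq r a x z e s k n r′ a′)
      where
      eq : ∀ r a x z e s k n r′ a′ → 3 * x + 3 * e + 6 * (z + s) + (r + r′)
             + (4 * suc k + a + (4 * suc n + a′)) + 0
           ≡ 4 * suc (k + suc n) + (a + a′) + (3 * x + 3 * z + r + (3 * z + 3 * e + 6 * s + r′))
      eq = solve-∀

    add-+0 : ∀ {m n} → m ≤ n → m + 0 ≤ n + 0
    add-+0 {m} {n} rewrite +-identityʳ m | +-identityʳ n = λ p → p

    -- The sum of `close` over all gaps. A mark inside the arc borders two gaps and counts 6, the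
    -- ends of the arc count 3. The summands 0 fit the shape of `combine`.
    arc-weight : ∀ zs x k e → A x ⊎ B x → A e ⊎ B e → After x k (zs ++ [ e ]) → AllSeparated (zs ++ [ e ]) →
                 3 * weight x + 3 * weight e + 6 * ∑ weight zs + 0 ≤ 4 * suc (k + length zs) + 0
    arc-weight [] x k e mx me af al
      rewrite +-identityʳ (3 * weight x + 3 * weight e) | +-identityʳ k =
      add-+0 (close x e k mx me (subst (Separated A B x e) (+-identityʳ k) (af [] e [] refl)))
    arc-weight (z ∷ zs) x k e mx me af al with A? z ⊎-dec B? z
    ... | yes mz = combine 0 0 (weight x) (weight z) (weight e) (∑ weight zs) k (length zs)
      (add-+0 (close x z k mx mz (subst (Separated A B x z) (+-identityʳ k) (af [] z _ refl))))
      0 0 (arc-weight zs z 0 e mz me (λ U y post eq → al [] z U y post (cong (z ∷_) eq)) (all-∷ al))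
    ... | no nm
      rewrite 𝟙-no (A? z) (λ a → nm (inj₁ a)) | 𝟙-no (B? z) (λ b → nm (inj₂ b)) | +-suc k (length zs) =
      arc-weight zs x (suc k) e mx me (after-∷ af) (all-∷ al)

    -- Between an end in `A` and an end in `B` the type changes somewhere. The scan maintains `A x`;
    -- the first later vertex in `B` closes a mixed gap, whose surplus `4ℓ - 8` is gained once.
    arc-weight-mixed : ∀ zs x k e → A x → B e → After x k (zs ++ [ e ]) → AllSeparated (zs ++ [ e ]) →
                       3 * weight x + 3 * weight e + 6 * ∑ weight zs + 4 * ℓ ≤ 4 * suc (k + length zs) + 8
    arc-weight-mixed [] x k e ax be af al
      rewrite +-identityʳ (3 * weight x + 3 * weight e) | +-identityʳ k =
      close-mixed x e k (subst (ℓ ≤_) (+-identityʳ k) (Separated.ab (af [] e [] refl) ax be))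
    arc-weight-mixed (z ∷ zs) x k e ax be af al = decide (B? z) (A? z)
      where
      rest : AllSeparated (zs ++ [ e ])
      rest = all-∷ al
      fresh : After z 0 (zs ++ [ e ])
      fresh U y post eq = al [] z U y post (cong (z ∷_) eq)
      here-gap : Separated A B x z k
      here-gap = subst (Separated A B x z) (+-identityʳ k) (af [] z _ refl)
      decide : Dec (B z) → Dec (A z) →
               3 * weight x + 3 * weight e + 6 * (weight z + ∑ weight zs) + 4 * ℓ ≤ 4 * suc (k + suc (length zs)) + 8
      decide (yes bz) _ =
        subst (λ r → 3 * weight x + 3 * weight e + 6 * (weight z + ∑ weight zs) + r ≤ 4 * suc (k + suc (length zs)) + 8)
          (+-identityʳ (4 * ℓ))
          (combine (4 * ℓ) 8 (weight x) (weight z) (weight e) (∑ weight zs) k (length zs)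
            (close-mixed x z k (Separated.ab here-gap ax bz))
            0 0 (arc-weight zs z 0 e (inj₂ bz) (inj₂ be) fresh rest))
      decide (no _) (yes az) =
        combine 0 0 (weight x) (weight z) (weight e) (∑ weight zs) k (length zs)
          (add-+0 (close x z k (inj₁ ax) (inj₁ az) here-gap))
          (4 * ℓ) 8 (arc-weight-mixed zs z 0 e az be fresh rest)
      decide (no ¬bz) (no ¬az) rewrite 𝟙-no (A? z) ¬az | 𝟙-no (B? z) ¬bz | +-suc k (length zs) =
        arc-weight-mixed zs x (suc k) e ax be (after-∷ af) rest

module Ears {n : ℕ} (G : Graph n) where
  open Graph G
  open Cycles G public
  open DecMembership (Fin._≟_ {n}) using (_∈?_)

  record IsPath (R P : List (Fin n)) : Set where
    constructor path
    field
      linked : Linked Adj P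
      unique : Unique P
      within : ∀ {v} → v ∈ P → v ∈ R

  record LongestPath (R P : List (Fin n)) : Set where
    constructor longestPath
    field
      isPath  : IsPath R P
      maximum : ∀ {P′} → IsPath R P′ → length P′ ≤ length P
    open IsPath isPath public

  -- Otherwise `x` would prolong the path.
  endpoint : ∀ {R u P x} → LongestPath R (u ∷ P) → x ∈ R → Adj u x → x ∈ P
  endpoint {R} {u} {P} {x} (longestPath (path l un sub) mx) x∈R ux with x ∈? u ∷ P
  ... | yes (here refl) = ⊥-elim (irrefl ux)
  ... | yes (there m) = m
  ... | no x∉ = ⊥-elim (n≮n _ (mx (path (symm ux ∷ l) (∉⇒Unique x∉ un) λ { (here refl) → x∈R ; (there m) → sub m })))

  reversePath : ∀ {R P} → LongestPath R P → LongestPath R (reverse P)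
  reversePath {R} {P} (longestPath (path l un sub) mx) = longestPath
    (path (Linked-reverse symm l) (Unique-↭ (↭-sym (↭-reverse P)) un) (λ m → sub (∈-resp-↭ (↭-reverse P) m)))
    (λ p → ≤-trans (mx p) (≤-reflexive (sym (List.length-reverse P))))

  reverse-ends : ∀ (u : Fin n) mid v → reverse (u ∷ mid ++ [ v ]) ≡ v ∷ reverse mid ++ [ u ]
  reverse-ends u mid v = ≡.trans (unfold-reverse u (mid ++ [ v ])) (cong (_++ [ u ]) (reverse-++ mid [ v ]))

  Linked-∷ʳ : ∀ xs {v b} → Linked Adj (xs ++ [ v ]) → Adj v b → Linked Adj ((xs ++ [ v ]) ++ [ b ])
  Linked-∷ʳ xs {v} {b} l vb = subst (Linked Adj) (sym (++-assoc xs [ v ] [ b ])) (Linked-join xs l (vb ∷ [-]))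

  record Ear (S : List (Fin n)) : Set where
    field
      a b u v       : Fin n
      M₁ M₂ mid R   : List (Fin n)
      isLongest     : Longest S a (M₁ ++ b ∷ M₂) R
      isLongestPath : LongestPath R (u ∷ mid ++ [ v ])
      ua            : Adj u a
      vb            : Adj v b

    C P : List (Fin n)
    C = a ∷ M₁ ++ b ∷ M₂
    P = u ∷ mid ++ [ v ]

    ℓ : ℕ
    ℓ = 2 + length mid

    length-P : length P ≡ ℓ
    length-P = cong suc (≡.trans (length-++ mid) (+-comm (length mid) 1))

  module _ {S : List (Fin n)} (uS : Unique S) where

    -- Interchanges the two arcs, so that what holds on the arc from `a` to `b` also holds on the
    -- way back.
    flip : Ear S → Ear S
    flip E = record
      { a = b ; b = a ; u = v ; v = u ; M₁ = M₂ ; M₂ = M₁ ; mid = reverse mid ; R = R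
      ; isLongest = Longest-↭ isLongest (rotate M₁ (Longest.cycle isLongest)) (rotate-↭ a M₁ b M₂)
      ; isLongestPath = subst (LongestPath R) (reverse-ends u mid v) (reversePath isLongestPath)
      ; ua = vb ; vb = ua }
      where open Ear E

    module EarArc (E : Ear S) where
      open Ear E
      open Separation {X = Fin n} ℓ (s≤s (s≤s z≤n))
      open LongestPath isLongestPath

      crossing : ∀ {p q} → Adj u p → Adj v q → Linked Adj (p ∷ P ++ [ q ])
      crossing up vq = symm up ∷ Linked-∷ʳ (u ∷ mid) linked vq

      -- Each field is `gap` for one detour: the whole path in one of its directions, or one of its
      -- ends alone.
      separate : ∀ pre p U q post → C ++ [ a ] ≡ pre ++ p ∷ U ++ q ∷ post → p ≢ q →
                 Separated (Adj u) (Adj v) p q (length U)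
      separate pre p U q post eq p≢q = separated
        (λ up vq → subst (_≤ length U) length-P
          (through P (s≤s z≤n) unique within (crossing up vq)))
        (λ vp uq → subst (_≤ length U) (≡.trans (List.length-reverse P) length-P)
          (through (reverse P) (subst (1 ≤_) (sym (List.length-reverse P)) (s≤s z≤n))
            (Unique-↭ (↭-sym (↭-reverse P)) unique) (λ m → within (∈-resp-↭ (↭-reverse P) m))
            (backwards vp uq)))
        (λ up uq → through [ u ] (s≤s z≤n) ([] ∷ []) (λ { (here refl) → within (here refl) }) (symm up ∷ uq ∷ [-]))
        (λ vp vq → through [ v ] (s≤s z≤n) ([] ∷ []) (λ { (here refl) → within (there (∈-++⁺ʳ mid (here refl))) })
          (symm vp ∷ vq ∷ [-]))
        where
        through : ∀ Q → 1 ≤ length Q → Unique Q → (∀ {x} → x ∈ Q → x ∈ R) →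
                  Linked Adj (p ∷ Q ++ [ q ]) → length Q ≤ length U
        through Q 1≤ un sub l = gap uS isLongest Q 1≤ un sub pre U post eq p≢q l
        backwards : Adj v p → Adj u q → Linked Adj (p ∷ reverse P ++ [ q ])
        backwards vp uq = subst (λ t → Linked Adj (p ∷ t ++ [ q ])) (sym (reverse-ends u mid v))
          (symm vp ∷ Linked-∷ʳ (v ∷ reverse mid)
            (subst (Linked Adj) (reverse-ends u mid v) (Linked-reverse symm linked)) uq)

      close-up : ∀ xs → M₁ ++ [ b ] ≡ xs → C ++ [ a ] ≡ a ∷ xs ++ M₂ ++ [ a ]
      close-up xs eq = cong (a ∷_) (begin
        (M₁ ++ b ∷ M₂) ++ [ a ]       ≡⟨ cong (_++ [ a ]) (++-assoc M₁ [ b ] M₂) ⟨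
        ((M₁ ++ [ b ]) ++ M₂) ++ [ a ] ≡⟨ ++-assoc (M₁ ++ [ b ]) M₂ [ a ] ⟩
        (M₁ ++ [ b ]) ++ M₂ ++ [ a ]   ≡⟨ cong (_++ M₂ ++ [ a ]) eq ⟩
        xs ++ M₂ ++ [ a ]              ∎)
        where open ≡-Reasoning

      arcUnique : Unique (a ∷ M₁ ++ [ b ])
      arcUnique = Unique-++ˡ (a ∷ M₁ ++ [ b ])
        (subst Unique (cong (a ∷_) (sym (++-assoc M₁ [ b ] M₂))) (Cyc.unique (Longest.cycle isLongest)))

      after : After (adj? u) (adj? v) a 0 (M₁ ++ [ b ])
      after U y post eq = separate [] a U y (post ++ M₂ ++ [ a ])
        (≡.trans (close-up _ eq) (cong (a ∷_) (++-assoc U (y ∷ post) (M₂ ++ [ a ]))))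
        λ { refl → Unique-head arcUnique (subst (a ∈_) (sym eq) (∈-++⁺ʳ U (here refl))) }

      allSeparated : AllSeparated (adj? u) (adj? v) (M₁ ++ [ b ])
      allSeparated pre x U y post eq = separate (a ∷ pre) x U y (post ++ M₂ ++ [ a ])
        (≡.trans (close-up _ eq) (cong (a ∷_) (≡.trans (++-assoc pre (x ∷ U ++ y ∷ post) (M₂ ++ [ a ]))
          (cong (λ t → pre ++ x ∷ t) (++-assoc U (y ∷ post) (M₂ ++ [ a ]))))))
        λ { refl → Unique-head (Unique-++ʳ (a ∷ pre) (subst Unique (cong (a ∷_) eq) arcUnique)) (∈-++⁺ʳ U (here refl)) }

      ℓ≤arc : ℓ ≤ length M₁
      ℓ≤arc = Separated.ab (after M₁ b [] refl) ua vb

      arc-bound : 3 * (𝟙 (adj? u a) + 𝟙 (adj? v a)) + 3 * (𝟙 (adj? u b) + 𝟙 (adj? v b))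
                  + 6 * (deg u M₁ + deg v M₁) + 4 * ℓ ≤ 4 * suc (length M₁) + 8
      arc-bound = subst (λ s → 3 * (𝟙 (adj? u a) + 𝟙 (adj? v a)) + 3 * (𝟙 (adj? u b) + 𝟙 (adj? v b))
                  + 6 * s + 4 * ℓ ≤ 4 * suc (length M₁) + 8)
        (∑-+ (λ x → 𝟙 (adj? u x)) (λ x → 𝟙 (adj? v x)) M₁)
        (arc-weight-mixed (adj? u) (adj? v) M₁ a 0 b ua vb after allSeparated)

    module EarBounds (E : Ear S) where
      open Ear E
      open LongestPath isLongestPath
      private
        module Forth = EarArc E
        module Back  = EarArc (flip E)

      ℓ≤M₁ : ℓ ≤ length M₁
      ℓ≤M₁ = Forth.ℓ≤arc

      ℓ≤M₂ : ℓ ≤ length M₂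
      ℓ≤M₂ = subst (λ l → 2 + l ≤ length M₂) (List.length-reverse mid) Back.ℓ≤arc

      -- The two arcs together give `a` and `b` their full share of 6. Both arcs change type, so the
      -- surplus is gained twice before the sum is halved.
      attachments : 3 * (deg u C + deg v C) + 4 * ℓ ≤ 2 * length C + 8
      attachments rewrite deg-++ u M₁ (b ∷ M₂) | deg-++ v M₁ (b ∷ M₂) | length-++ M₁ {b ∷ M₂} =
        *-cancelˡ-≤ 2 (≤-from 0 (+-mono-≤ Forth.arc-bound
          (subst (λ l → 3 * (𝟙 (adj? v b) + 𝟙 (adj? u b)) + 3 * (𝟙 (adj? v a) + 𝟙 (adj? u a))
                  + 6 * (deg v M₂ + deg u M₂) + 4 * (2 + l) ≤ 4 * suc (length M₂) + 8) (List.length-reverse mid) Back.arc-bound))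
          (eq (𝟙 (adj? u a)) (𝟙 (adj? v a)) (𝟙 (adj? u b)) (𝟙 (adj? v b)) (deg u M₁) (deg v M₁) (deg u M₂) (deg v M₂)
            ℓ (length M₁) (length M₂)))
        where
        eq : ∀ ua va ub vb u₁ v₁ u₂ v₂ l m₁ m₂ →
          2 * (3 * (ua + (u₁ + (ub + u₂)) + (va + (v₁ + (vb + v₂)))) + 4 * l)
            + (4 * suc m₁ + 8 + (4 * suc m₂ + 8)) + 0
          ≡ 2 * (2 * suc (m₁ + suc m₂) + 8)
            + (3 * (ua + va) + 3 * (ub + vb) + 6 * (u₁ + v₁) + 4 * l
              + (3 * (vb + ub) + 3 * (va + ua) + 6 * (v₂ + u₂) + 4 * l))
        eq = solve-∀

      u≢v : u ≢ v
      u≢v refl = Unique-head unique (∈-++⁺ʳ mid (here refl))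

      ends⊆S : ∀ {x} → x ∈ u ∷ v ∷ [] → x ∈ S
      ends⊆S (here refl) = offCycle⇒∈ isLongest (within (here refl))
      ends⊆S (there (here refl)) = offCycle⇒∈ isLongest (within (there (∈-++⁺ʳ mid (here refl))))

      rest : ∃[ S′ ] S ↭ u ∷ v ∷ S′
      rest = complement (u ∷ v ∷ []) (∉⇒Unique (λ { (here e) → u≢v e }) ([] ∷ [])) ends⊆S

      deg-end : ∀ w mid′ w′ → LongestPath R (w ∷ mid′ ++ [ w′ ]) → length mid′ ≡ length mid →
                deg w S ≤ deg w C + (length mid + 𝟙 (adj? w w′))
      deg-end w mid′ w′ lp eq = begin
        deg w S                                    ≡⟨ deg-↭ w (Longest.split isLongest) ⟩
        deg w (C ++ R)                             ≡⟨ deg-++ w C R ⟩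
        deg w C + deg w R                          ≤⟨ +-monoʳ-≤ (deg w C) (deg-⊆ w (offUnique uS isLongest) (endpoint lp)) ⟩
        deg w C + deg w (mid′ ++ [ w′ ])           ≡⟨ cong (deg w C +_) (deg-++ w mid′ [ w′ ]) ⟩
        deg w C + (deg w mid′ + (𝟙 (adj? w w′) + 0)) ≤⟨ +-monoʳ-≤ (deg w C) (+-mono-≤ (deg≤length w mid′) (≤-reflexive (+-identityʳ _))) ⟩
        deg w C + (length mid′ + 𝟙 (adj? w w′))    ≡⟨ cong (λ l → deg w C + (l + 𝟙 (adj? w w′))) eq ⟩
        deg w C + (length mid + 𝟙 (adj? w w′))     ∎
        where open ≤-Reasoning

      lengths : length C + ℓ ≤ length S
      lengths = begin
        length C + ℓ         ≡⟨ cong (length C +_) length-P ⟨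
        length C + length P  ≤⟨ +-monoʳ-≤ (length C) (⊆⇒length≤ unique within) ⟩
        length C + length R  ≡⟨ length-++ C ⟨
        length (C ++ R)      ≡⟨ ↭-length (Longest.split isLongest) ⟨
        length S             ∎
        where open ≤-Reasoning

      -- The number of edges lost with `u` and `v`; an edge between the two is counted at `u` only.
      removed : ℕ
      removed = deg u S + deg v (v ∷ proj₁ rest)

      e₂-removed : e₂ S ≡ e₂ (proj₁ rest) + 2 * removed
      e₂-removed with rest
      ... | S′ , p = begin
        e₂ S                                                           ≡⟨ e₂-↭ p ⟩
        e₂ (u ∷ v ∷ S′)                                                ≡⟨ e₂-∷ u (v ∷ S′) ⟩
        2 * deg u (u ∷ v ∷ S′) + e₂ (v ∷ S′)                           ≡⟨ cong₂ (λ x y → 2 * x + y) (deg-↭ u (↭-sym p)) (e₂-∷ v S′) ⟩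
        2 * deg u S + (2 * deg v (v ∷ S′) + e₂ S′)                     ≡⟨ eq (deg u S) (deg v (v ∷ S′)) (e₂ S′) ⟩
        e₂ S′ + 2 * (deg u S + deg v (v ∷ S′))                         ∎
        where
        open ≡-Reasoning
        eq : ∀ a b c → 2 * a + (2 * b + c) ≡ c + 2 * (a + b)
        eq = solve-∀

      -- Within `R` each end sees at most `mid` and the other end. With `c` the length of the cycle,
      -- `3 * removed` is at most `(2c + 8 - 4ℓ) + 6(ℓ - 2) + 3 = 2(c + ℓ) - 1`, where the 3
      -- accounts for a possible edge `uv`, and `c + ℓ` is at most the size of `S`.
      removed-bound : 3 * removed + 1 ≤ 2 * length S
      removed-bound = ≤-from 0 (+-mono-≤ (+-mono-≤ (+-mono-≤ (*-monoʳ-≤ 3 degrees) attachments) (*-monoʳ-≤ 2 lengths))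
          (*-monoʳ-≤ 3 (𝟙≤1 (adj? u v))))
        (eq removed (𝟙 (adj? u v)) (deg u C) (deg v C) (length mid) (length C) (length S))
        where
        degrees : removed + 𝟙 (adj? u v) ≤ deg u C + (length mid + 𝟙 (adj? u v)) + (deg v C + (length mid + 𝟙 (adj? u v)))
        degrees = begin
          deg u S + deg v (v ∷ proj₁ rest) + 𝟙 (adj? u v)
            ≡⟨ +-assoc (deg u S) _ _ ⟩
          deg u S + (deg v (v ∷ proj₁ rest) + 𝟙 (adj? u v))
            ≡⟨ cong (deg u S +_) (≡.trans (+-comm _ (𝟙 (adj? u v))) (cong (_+ deg v (v ∷ proj₁ rest)) (adj-sym u v))) ⟩
          deg u S + deg v (u ∷ v ∷ proj₁ rest)
            ≡⟨ cong (deg u S +_) (deg-↭ v (↭-sym (proj₂ rest))) ⟩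
          deg u S + deg v S
            ≤⟨ +-mono-≤ (deg-end u mid v isLongestPath refl)
                 (deg-end v (reverse mid) u (Ear.isLongestPath (flip E)) (List.length-reverse mid)) ⟩
          deg u C + (length mid + 𝟙 (adj? u v)) + (deg v C + (length mid + 𝟙 (adj? v u)))
            ≡⟨ cong (λ t → deg u C + (length mid + 𝟙 (adj? u v)) + (deg v C + (length mid + t))) (adj-sym v u) ⟩
          deg u C + (length mid + 𝟙 (adj? u v)) + (deg v C + (length mid + 𝟙 (adj? u v)))
            ∎
          where open ≤-Reasoning
        eq : ∀ r t x y m c s → 3 * r + 1
               + (3 * (x + (m + t) + (y + (m + t))) + (2 * c + 8) + 2 * s + 3 * 1) + 0
             ≡ 2 * s + (3 * (r + t) + (3 * (x + y) + 4 * (2 + m)) + 2 * (c + (2 + m)) + 3 * t)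
        eq = solve-∀

-- Rotations of paths off a longest cycle

module _ {A : Set} {M : A → Set} (M? : ∀ x → Dec (M x)) where

  headOr : List A → A → A
  headOr [] e = e
  headOr (z ∷ _) _ = z

  -- preds zs e lists the entries of zs whose successor in zs ++ [ e ] is marked.
  preds others : List A → A → List A
  preds [] e = []
  preds (z ∷ zs) e with M? (headOr zs e)
  ... | yes _ = z ∷ preds zs e
  ... | no _  = preds zs e
  others [] e = []
  others (z ∷ zs) e with M? (headOr zs e)
  ... | yes _ = others zs e
  ... | no _  = z ∷ others zs e

  preds-others : ∀ zs e → zs ↭ preds zs e ++ others zs e
  preds-others [] e = ↭-refl
  preds-others (z ∷ zs) e with M? (headOr zs e)
  ... | yes _ = ↭-prep z (preds-others zs e)
  ... | no _  = ↭-trans (↭-prep z (preds-others zs e)) (↭-sym (shift z (preds zs e) (others zs e)))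

  length-preds : ∀ z zs e → length (preds (z ∷ zs) e) ≡ ∑ (λ x → 𝟙 (M? x)) (zs ++ [ e ])
  length-preds z [] e with M? e
  ... | yes _ = refl
  ... | no _  = refl
  length-preds z (z′ ∷ zs) e with M? z′
  ... | yes _ = cong suc (length-preds z′ zs e)
  ... | no _  = length-preds z′ zs e

  ∈-preds : ∀ {y} zs e → y ∈ preds zs e → ∃[ F₁ ] ∃[ F₂ ] zs ≡ F₁ ++ y ∷ F₂ × M (headOr F₂ e)
  ∈-preds (z ∷ zs) e m with M? (headOr zs e)
  ∈-preds (z ∷ zs) e (here refl) | yes p = [] , zs , refl , p
  ∈-preds (z ∷ zs) e (there m) | yes _ with ∈-preds zs e m
  ... | F₁ , F₂ , eq , p = z ∷ F₁ , F₂ , cong (z ∷_) eq , p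
  ∈-preds (z ∷ zs) e m | no _ with ∈-preds zs e m
  ... | F₁ , F₂ , eq , p = z ∷ F₁ , F₂ , cong (z ∷_) eq , p

-- A suffix with at most one entry cannot reach beyond the nonempty list `t ∷ T`.
split-suffix : ∀ {A : Set} (Z : List A) → length Z ≤ 1 → ∀ F {t T} P → F ++ t ∷ T ≡ P ++ Z →
               ∃[ T₁ ] t ∷ T ≡ T₁ ++ Z × P ≡ F ++ T₁
split-suffix Z Z≤1 [] P eq = P , eq , refl
split-suffix Z Z≤1 (f ∷ F) {t} {T} [] refl with Z≤1
... | s≤s le with subst (_≤ 0) (length-++ F) le
...   | le′ with m+n≤o⇒n≤o (length F) le′
...     | ()
split-suffix Z Z≤1 (f ∷ F) (p ∷ P) eq with ∷-injective eq
... | refl , eq′ with split-suffix Z Z≤1 F P eq′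
...   | T₁ , a , b = T₁ , a , cong (p ∷_) b

module Blocks {n : ℕ} (G : Graph n) where
  open Graph G
  open Ears G public

  module _ {S : List (Fin n)} (uS : Unique S) {x ys R} (L : Longest S x ys R)
           (noEar : ¬ Ear S) (noIsolated : ∀ {v} → v ∈ S → 1 ≤ deg v S)
           (block : ∀ X S′ j → S ↭ X ++ S′ → 1 ≤ length X → length X < j → 2 * j ≤ suc (length S) →
                    e₂ S ≤ e₂ S′ + length X * j → ⊥)
    where

    private
      C : List (Fin n)
      C = x ∷ ys

    -- Two different attachments would split the cycle into the two arcs of an ear.
    sameAttachment : ∀ {u mid v a b} → LongestPath R (u ∷ mid ++ [ v ]) → a ∈ C → b ∈ C → Adj u a → Adj v b → a ≡ b
    sameAttachment {u} {mid} {v} {a} {b} lp a∈ b∈ ua vb with a Fin.≟ b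
    ... | yes eq = eq
    ... | no a≢b with rotateTo (Longest.cycle L) a∈
    ...   | zs , c , p with ∈-resp-↭ p b∈
    ...     | here eq = sym eq
    ...     | there m with ∈-∃++ m
    ...       | M₁ , M₂ , refl = ⊥-elim (noEar record
                { a = a ; b = b ; u = u ; v = v ; M₁ = M₁ ; M₂ = M₂ ; mid = mid ; R = R
                ; isLongest = Longest-↭ L c p ; isLongestPath = lp ; ua = ua ; vb = vb })

    -- Z is empty or a single vertex of C at which all the paths under consideration continue.
    module Rotation (Z : List (Fin n)) (Z≤1 : length Z ≤ 1) (Z⊆C : ∀ {z} → z ∈ Z → z ∈ C)
                    (reach : ∀ {h Π a} → LongestPath R (h ∷ Π) → Linked Adj (h ∷ Π ++ Z) →
                             2 ≤ length (h ∷ Π) → a ∈ C → Adj h a → a ∈ Z)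
                    {u w rest} (start : LongestPath R (u ∷ w ∷ rest)) (start-Z : Linked Adj (u ∷ w ∷ rest ++ Z))
      where

      -- A longest path of `R` with a fixed tail: `T₁` is the part of the tail inside `R`, and `T`
      -- is `T₁` followed by `Z`. Rotations rearrange only `h ∷ F`.
      Front : List (Fin n) → List (Fin n) → Fin n → List (Fin n) → Set
      Front T₁ T h F = LongestPath R (h ∷ F ++ T₁) × Linked Adj (h ∷ F ++ T)

      Z-unique : Unique Z
      Z-unique = go Z Z≤1
        where
        go : ∀ Y → length Y ≤ 1 → Unique Y
        go [] _ = []
        go (_ ∷ []) _ = [] ∷ []
        go (_ ∷ _ ∷ _) (s≤s ())

      C∌R : ∀ {v} → v ∈ C → ¬ v ∈ R
      C∌R = Unique-disjoint C (splitUnique uS L)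

      append : ∀ (F : List (Fin n)) {T T₁} → T ≡ T₁ ++ Z → F ++ T ≡ (F ++ T₁) ++ Z
      append F {T₁ = T₁} refl = sym (++-assoc F T₁ Z)

      front-unique : ∀ {T T₁ h F} → T ≡ T₁ ++ Z → Front T₁ T h F → Unique (h ∷ F ++ T)
      front-unique {h = h} {F} eq (lp , _) = subst Unique (sym (append (h ∷ F) eq))
        (Unique.++⁺ (LongestPath.unique lp) Z-unique (λ { (a , b) → C∌R (Z⊆C b) (LongestPath.within lp a) }))

      front-within : ∀ {T T₁ h F} → T ≡ T₁ ++ Z → Front T₁ T h F → ∀ {v} → v ∈ h ∷ F ++ T → v ∈ S
      front-within {h = h} {F} eq (lp , _) {v} m
        with ∈-++⁻ (h ∷ F ++ _) (subst (v ∈_) (append (h ∷ F) eq) m)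
      ... | inj₁ a = offCycle⇒∈ L (LongestPath.within lp a)
      ... | inj₂ b = onCycle⇒∈ L (Z⊆C b)

      neighbours : ∀ {T T₁ h F} → T ≡ T₁ ++ Z → Front T₁ T h F → ∀ {y} → y ∈ S → Adj h y → y ∈ F ++ T
      neighbours {T} {T₁} {h} {F} eq (lp , l) {y} y∈S hy = subst (y ∈_) (sym (append F eq)) found
        where
        found : y ∈ (F ++ T₁) ++ Z
        found with ∈-++⁻ C (∈-resp-↭ (Longest.split L) y∈S)
        ... | inj₁ y∈C = ∈-++⁺ʳ (F ++ T₁) (reach lp (subst (Linked Adj) (append (h ∷ F) eq) l)
          (≤-trans (s≤s (s≤s z≤n)) (LongestPath.maximum lp (LongestPath.isPath start))) y∈C hy)
        ... | inj₂ y∈R = ∈-++⁺ˡ (endpoint lp y∈R hy)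

      -- The block will be `h ∷ F ++ [ t ]` for a closing edge `ht` that spans as much of its path
      -- as possible.
      Closing : Fin n × List (Fin n) × Fin n × List (Fin n) × List (Fin n) → Set
      Closing (h , F , t , T , T₁) = t ∷ T ≡ T₁ ++ Z × Front T₁ (t ∷ T) h F × Adj h t

      closing-bound : ∀ a → Closing a → length (proj₁ (proj₂ a)) ≤ length R
      closing-bound (h , F , t , T , T₁) (_ , (lp , _) , _) = begin
        length F                   ≤⟨ m≤n+m _ 1 ⟩
        length (h ∷ F)             ≤⟨ m≤m+n _ _ ⟩
        length (h ∷ F) + length T₁ ≡⟨ length-++ (h ∷ F) ⟨
        length (h ∷ F ++ T₁)       ≤⟨ ⊆⇒length≤ (LongestPath.unique lp) (LongestPath.within lp) ⟩
        length R                   ∎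
        where open ≤-Reasoning

      module Furthest {h₀ F₀ t T T₁} (closing₀ : Closing (h₀ , F₀ , t , T , T₁))
                      (furthest : ∀ a → Closing a → length (proj₁ (proj₂ a)) ≤ length F₀) where

        T-eq : t ∷ T ≡ T₁ ++ Z
        T-eq = proj₁ closing₀

        Candidate : Fin n × List (Fin n) → Set
        Candidate (h , F) = length F ≡ length F₀ × Front T₁ (t ∷ T) h F

        candidate₀ : Candidate (h₀ , F₀)
        candidate₀ = refl , proj₁ (proj₂ closing₀)

        -- A neighbour beyond `t` would give a closing edge with a larger span. As `furthest`
        -- compares with all paths, this applies to every rotated path and not only to the one that
        -- was chosen.
        within-block : ∀ {h F} → Candidate (h , F) → ∀ {y} → y ∈ S → Adj h y → y ∈ F ++ [ t ]
        within-block {h} {F} (len , front@(lp , l)) {y} y∈S hy with ∈-++⁻ F (neighbours T-eq front y∈S hy)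
        ... | inj₁ y∈F = ∈-++⁺ˡ y∈F
        ... | inj₂ (here eq) = ∈-++⁺ʳ F (here eq)
        ... | inj₂ (there y∈T) with ∈-∃++ y∈T
        ...   | T₂ , T₃ , refl with split-suffix Z Z≤1 (h ∷ F ++ t ∷ T₂) (h ∷ F ++ T₁)
                  (≡.trans (cong (h ∷_) (++-assoc F (t ∷ T₂) (y ∷ T₃))) (append (h ∷ F) T-eq))
        ...     | T₁′ , eq₁ , eq₂ = ⊥-elim (n≮n (length F₀) (begin-strict
                    length F₀                      ≡⟨ len ⟨
                    length F                       <⟨ m<m+n (length F) (s≤s z≤n) ⟩
                    length F + length (t ∷ T₂)     ≡⟨ length-++ F ⟨
                    length (F ++ t ∷ T₂)           ≤⟨ furthest (h , F ++ t ∷ T₂ , y , T₃ , T₁′)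
                       (eq₁ , (subst (LongestPath R) eq₂ lp ,
                               subst (Linked Adj) (cong (h ∷_) (sym (++-assoc F (t ∷ T₂) (y ∷ T₃)))) l) , hy) ⟩
                    length F₀                      ∎))
          where open ≤-Reasoning

        -- A Pósa rotation: the edge from `h` to the successor of `y` replaces the edge from `y` to
        -- it, and `y` becomes the first vertex. The front keeps its vertex set, and the tail is
        -- unchanged.
        rotated : ∀ {h F} F₁ y F₂ → h ∷ F ≡ F₁ ++ y ∷ F₂ → Adj h (headOr (adj? h) F₂ t) →
                  Candidate (h , F) → Candidate (y , reverse F₁ ++ F₂)
        rotated [] y F₂ refl hs c = c
        rotated {h} (_ ∷ F₁) y F₂ refl hs (len , (longestPath (path _ un wi) mx) , l) =
          ≡.trans (suc-injective (↭-length perm)) len ,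
          longestPath
            (path (Linked-++ˡ (y ∷ F′ ++ T₁) (subst (Linked Adj) (append (y ∷ F′) T-eq) linked))
                  (Unique-↭ (↭-sym (++⁺ʳ T₁ perm)) un)
                  (λ m → wi (∈-resp-↭ (++⁺ʳ T₁ perm) m)))
            (λ p → ≤-trans (mx p) (≤-reflexive (sym (↭-length (++⁺ʳ T₁ perm))))) ,
          linked
          where
          F′ = reverse (h ∷ F₁) ++ F₂
          perm : y ∷ F′ ↭ h ∷ F₁ ++ y ∷ F₂
          perm = ↭-trans (↭-prep y (++⁺ʳ F₂ (↭-reverse (h ∷ F₁)))) (↭-sym (shift y (h ∷ F₁) F₂))
          whole : Linked Adj ((h ∷ F₁) ++ y ∷ F₂ ++ t ∷ T)
          whole = subst (Linked Adj) (cong (h ∷_) (++-assoc F₁ (y ∷ F₂) (t ∷ T))) l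
          jump : ∀ F₂ → Adj h (headOr (adj? h) F₂ t) → Linked Adj (F₂ ++ t ∷ T) → Linked Adj (h ∷ F₂ ++ t ∷ T)
          jump [] hs l = hs ∷ l
          jump (_ ∷ _) hs l = hs ∷ l
          linked : Linked Adj (y ∷ F′ ++ t ∷ T)
          linked = subst (Linked Adj) (begin
              (y ∷ reverse F₁) ++ h ∷ F₂ ++ t ∷ T           ≡⟨ ++-assoc (y ∷ reverse F₁) [ h ] (F₂ ++ t ∷ T) ⟨
              (y ∷ reverse F₁ ++ [ h ]) ++ F₂ ++ t ∷ T      ≡⟨ cong (λ r → y ∷ r ++ F₂ ++ t ∷ T) (unfold-reverse h F₁) ⟨
              (y ∷ reverse (h ∷ F₁)) ++ F₂ ++ t ∷ T         ≡⟨ ++-assoc (y ∷ reverse (h ∷ F₁)) F₂ (t ∷ T) ⟨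
              y ∷ F′ ++ t ∷ T                               ∎)
            (Linked-join (y ∷ reverse F₁)
              (subst (Linked Adj) (reverse-ends h F₁ y) (Linked-reverse symm (Linked-upto (h ∷ F₁) whole)))
              (jump F₂ hs (Linked.tail (Linked-++ʳ (h ∷ F₁) whole))))
            where open ≡-Reasoning

        block-unique : ∀ {h F} → Candidate (h , F) → Unique (h ∷ F ++ [ t ])
        block-unique {h} {F} (_ , front) = Unique-++ˡ (h ∷ F ++ [ t ])
          (subst Unique (cong (h ∷_) (sym (++-assoc F [ t ] T))) (front-unique T-eq front))

        block-within : ∀ {h F} → Candidate (h , F) → ∀ {v} → v ∈ h ∷ F ++ [ t ] → v ∈ S
        block-within {h} {F} (_ , front) {v} m = front-within T-eq front
          (subst (v ∈_) (cong (h ∷_) (++-assoc F [ t ] T)) (∈-++⁺ˡ m))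

        -- The closing edge turns the block into a cycle, unless it has only two vertices; then any
        -- cycle is longer.
        block≤circumference : 2 + length F₀ ≤ length C
        block≤circumference with 2 ≤? length (h₀ ∷ F₀)
        ... | no small = ≤-trans (≰⇒> small) (m≤n⇒m≤1+n (Cyc.long (Longest.cycle L)))
        ... | yes 2≤ = s≤s (Longest.maximum L
            (cyc (symm (proj₂ (proj₂ closing₀)) ∷ Linked-upto (h₀ ∷ F₀) (proj₂ (proj₂ candidate₀)))
                 (Unique-↭ perm (block-unique candidate₀)) 2≤)
            (λ m → block-within candidate₀ (∈-resp-↭ (↭-sym perm) m)))
          where
          perm : h₀ ∷ F₀ ++ [ t ] ↭ t ∷ h₀ ∷ F₀
          perm = ++-comm (h₀ ∷ F₀) [ t ]

        -- All vertices of the block except possibly `t` lie in `R`, so a block of `j` vertices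
        -- satisfies both `j ≤ c` and `j - 1 ≤ r`, where `c` and `r` are the sizes of `C` and `R`.
        2*block : 2 * (2 + length F₀) ≤ suc (length S)
        2*block = begin
          2 * (2 + length F₀)                       ≡⟨ eq (length F₀) ⟩
          2 + length F₀ + suc (length (h₀ ∷ F₀))    ≤⟨ +-mono-≤ block≤circumference (s≤s front≤R) ⟩
          length C + suc (length R)                 ≡⟨ +-suc (length C) (length R) ⟩
          suc (length C + length R)                 ≡⟨ cong suc (length-++ C) ⟨
          suc (length (C ++ R))                     ≡⟨ cong suc (↭-length (Longest.split L)) ⟨
          suc (length S)                            ∎
          where
          open ≤-Reasoning
          lp = proj₁ (proj₂ candidate₀)
          front≤R : length (h₀ ∷ F₀) ≤ length R
          front≤R = ≤-trans (m≤m+n _ (length T₁)) (≤-trans (≤-reflexive (sym (length-++ (h₀ ∷ F₀))))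
            (⊆⇒length≤ (LongestPath.unique lp) (LongestPath.within lp)))
          eq : ∀ f → 2 * (2 + f) ≡ 2 + f + suc (suc f)
          eq = solve-∀

        -- `X` consists of the vertices that one rotation brings to the front. Each has all its
        -- neighbours in the block and, by the choice of `h`, degree at most that of `h`, hence at
        -- most the size `m` of `X`. The degrees in `X` add up to at most `m * m`, and at most `m`
        -- times the size of `W` edges lead from `X` to `W`; together this bounds twice the number
        -- of edges that meet `X` by `m * j`.
        remove : ∀ {h F} → Candidate (h , F) → (∀ c → Candidate c → deg (proj₁ c) S ≤ deg h S) → ⊥
        remove {h} {F} cand most = block X (W ++ U) (2 + length F₀) S↭ 1≤X X<j 2*block count-edges
          where
          X W₀ W U : List (Fin n)
          X = preds (adj? h) (h ∷ F) t
          W₀ = others (adj? h) (h ∷ F) t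
          W = W₀ ++ [ t ]
          comp = complement (h ∷ F ++ [ t ]) (block-unique cand) (block-within cand)
          U = proj₁ comp
          split : h ∷ F ↭ X ++ W₀
          split = preds-others (adj? h) (h ∷ F) t
          split-t : h ∷ F ++ [ t ] ↭ X ++ W
          split-t = ↭-trans (++⁺ʳ [ t ] split) (↭-reflexive (++-assoc X W₀ [ t ]))
          S↭ : S ↭ X ++ W ++ U
          S↭ = ↭-trans (proj₂ comp) (↭-trans (++⁺ʳ U split-t) (↭-reflexive (++-assoc X W U)))
          lengths : length X + length W ≡ 2 + length F₀
          lengths = begin
            length X + length W      ≡⟨ length-++ X ⟨
            length (X ++ W)          ≡⟨ ↭-length split-t ⟨
            suc (length (F ++ [ t ])) ≡⟨ cong suc (length-++ F) ⟩
            suc (length F + 1)       ≡⟨ cong suc (+-comm (length F) 1) ⟩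
            2 + length F             ≡⟨ cong (2 +_) (proj₁ cand) ⟩
            2 + length F₀            ∎
            where open ≡-Reasoning
          X<j : length X < 2 + length F₀
          X<j = subst (length X <_) lengths (m<m+n (length X) (subst (0 <_) (sym (length-++ W₀)) (m≤n+m 1 (length W₀))))
          deg-h≤X : deg h S ≤ length X
          deg-h≤X = ≤-trans (deg-⊆ h uS (within-block cand)) (≤-reflexive (sym (length-preds (adj? h) h F t)))
          1≤X : 1 ≤ length X
          1≤X = ≤-trans (noIsolated (block-within cand (here refl))) deg-h≤X
          candidate : ∀ {y} → y ∈ X → ∃[ F′ ] Candidate (y , F′) × h ∷ F ↭ y ∷ F′
          candidate {y} m with ∈-preds (adj? h) (h ∷ F) t m
          ... | F₁ , F₂ , eq , hs = reverse F₁ ++ F₂ , rotated F₁ y F₂ eq hs cand ,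
            ↭-trans (↭-reflexive eq) (↭-trans (shift y F₁ F₂) (↭-prep y (++⁺ʳ F₂ (↭-sym (↭-reverse F₁)))))
          deg-X : ∀ {y} → y ∈ X → deg y S ≤ length X
          deg-X m with candidate m
          ... | F′ , c , _ = ≤-trans (most _ c) deg-h≤X
          no-edge : ∀ {y z} → y ∈ X → z ∈ U → ¬ Adj y z
          no-edge {y} {z} y∈X z∈U yz with candidate y∈X
          ... | F′ , c , p = Unique-disjoint (h ∷ F ++ [ t ]) (Unique-↭ (proj₂ comp) uS)
            (∈-resp-↭ (++⁺ʳ [ t ] (↭-sym p)) (there (within-block c (∈-resp-↭ (↭-sym (proj₂ comp)) (∈-++⁺ʳ (h ∷ F ++ [ t ]) z∈U)) yz)))
            z∈U
          count-edges : e₂ S ≤ e₂ (W ++ U) + length X * (2 + length F₀)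
          count-edges = begin
            e₂ S                                              ≡⟨ e₂-↭ S↭ ⟩
            e₂ (X ++ W ++ U)                                  ≡⟨ e₂-++ X (W ++ U) ⟩
            e₂ X + 2 * cross X (W ++ U) + e₂ (W ++ U)         ≡⟨ regroup (e₂ X) (cross X (W ++ U)) (e₂ (W ++ U)) ⟩
            e₂ (W ++ U) + (e₂ X + cross X (W ++ U) + cross X (W ++ U))
              ≤⟨ +-monoʳ-≤ (e₂ (W ++ U)) (+-mono-≤ inside outside) ⟩
            e₂ (W ++ U) + (length X * length X + length X * length W)
              ≡⟨ cong (e₂ (W ++ U) +_) (*-distribˡ-+ (length X) (length X) (length W)) ⟨
            e₂ (W ++ U) + length X * (length X + length W)    ≡⟨ cong (λ j → e₂ (W ++ U) + length X * j) lengths ⟩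
            e₂ (W ++ U) + length X * (2 + length F₀)          ∎
            where
            open ≤-Reasoning
            regroup : ∀ a b c → a + 2 * b + c ≡ c + (a + b + b)
            regroup = solve-∀
            inside : e₂ X + cross X (W ++ U) ≤ length X * length X
            inside = begin
              e₂ X + cross X (W ++ U)  ≡⟨ cross-++ʳ X X (W ++ U) ⟨
              cross X (X ++ W ++ U)    ≡⟨ cross-↭ʳ X S↭ ⟨
              cross X S                ≤⟨ cross-≤* X S deg-X ⟩
              length X * length X      ∎
            outside : cross X (W ++ U) ≤ length X * length W
            outside = begin
              cross X (W ++ U)         ≡⟨ cross-++ʳ X W U ⟩
              cross X W + cross X U    ≡⟨ cong (cross X W +_) (cross-zero X U no-edge) ⟩
              cross X W + 0            ≡⟨ +-identityʳ _ ⟩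
              cross X W                ≤⟨ cross-≤* X W (λ {y} _ → deg≤length y W) ⟩
              length X * length W      ∎

      contradictory : ⊥
      contradictory = maximal Closing (λ a → length (proj₁ (proj₂ a))) (length R) closing-bound
        -- The first edge of the path serves as a closing edge of smallest span.
        (u , [] , w , rest ++ Z , w ∷ rest) (refl , (start , start-Z) , Linked.head (LongestPath.linked start))
        λ a closing furthest → let open Furthest closing furthest in
          maximal Candidate (λ c → deg (proj₁ c) S) (length S) (λ c _ → deg≤length (proj₁ c) S)
            _ candidate₀ (λ c cand most → remove cand most)

    -- If some longest path has an end adjacent to `z` on `C`, rotations keep this end, and by
    -- `sameAttachment` all opposite ends see nothing of `C` except `z`: take `Z = [ z ]`. If there
    -- is no such path, the empty `Z` works.
    edge-off-cycle : ∀ {u w rest} → LongestPath R (u ∷ w ∷ rest) → ⊥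
    edge-off-cycle {u} {w} {rest} start = unattached attached
      where
      Attached : Set
      Attached = ∃[ h ] ∃[ Π ] ∃[ v ] ∃[ z ] LongestPath R (h ∷ Π ++ [ v ]) × z ∈ C × Adj v z

      lastOf : ∀ h Π → 2 ≤ length (h ∷ Π) → ∃[ mid ] ∃[ v ] h ∷ Π ≡ h ∷ mid ++ [ v ]
      lastOf h Π (s≤s le) with initLast Π
      lastOf h .[] (s≤s ()) | []
      lastOf h .(mid ∷ʳ v) _ | mid ∷ʳ′ v = mid , v , refl

      attached : ¬ Attached
      attached (h , Π , v , z , lp , z∈C , vz) with second Π
        where
        second : ∀ Π → ∃[ w ] ∃[ rest ] Π ++ [ v ] ≡ w ∷ rest
        second [] = v , [] , refl
        second (p ∷ Π) = p , Π ++ [ v ] , refl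
      ... | _ , _ , eq = Rotation.contradictory [ z ] (s≤s z≤n) (λ { (here refl) → z∈C }) reach
        (subst (λ Q → LongestPath R (h ∷ Q)) eq lp)
        (subst (λ Q → Linked Adj (h ∷ Q ++ [ z ])) eq (Linked-∷ʳ (h ∷ Π) (LongestPath.linked lp) vz))
        where
        reach : ∀ {h Π a} → LongestPath R (h ∷ Π) → Linked Adj (h ∷ Π ++ [ z ]) →
                2 ≤ length (h ∷ Π) → a ∈ C → Adj h a → a ∈ [ z ]
        reach {h} {Π} lp l le a∈ ha with lastOf h Π le
        ... | mid , v , refl = here (sameAttachment {mid = mid} lp a∈ z∈C ha
          (Linked-∷ʳ-last (h ∷ mid) (subst (Linked Adj) (cong (h ∷_) (++-assoc mid [ v ] [ z ])) l)))

      unattached : ¬ Attached → ⊥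
      unattached none = Rotation.contradictory [] z≤n (λ ()) reach start
        (subst (Linked Adj) (sym (++-identityʳ _)) (LongestPath.linked start))
        where
        reach : ∀ {h Π a} → LongestPath R (h ∷ Π) → Linked Adj (h ∷ Π ++ []) →
                2 ≤ length (h ∷ Π) → a ∈ C → Adj h a → a ∈ []
        reach {h} {Π} {a} lp _ le a∈ ha with lastOf h Π le
        ... | mid , v , refl = ⊥-elim (none (v , reverse mid , h , a ,
          subst (LongestPath R) (reverse-ends h mid v) (reversePath lp) , a∈ , ha))

-- Numerical estimates

≤⇒∃ : ∀ {m n} → m ≤ n → ∃[ d ] n ≡ m + d
≤⇒∃ {m} {n} m≤n = n ∸ m , sym (m+[n∸m]≡n m≤n)

twice-product : ∀ x y → 2 * (x * y) ≤ x * x + y * y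
twice-product x y with ≤-total x y
... | inj₁ x≤y with ≤⇒∃ x≤y
...   | d , refl = ≤-from (d * d) (≤-refl {0}) (eq x d)
  where
  eq : ∀ x d → 2 * (x * (x + d)) + 0 + d * d ≡ x * x + (x + d) * (x + d) + 0
  eq = solve-∀
twice-product x y | inj₂ y≤x with ≤⇒∃ y≤x
...   | d , refl = ≤-from (d * d) (≤-refl {0}) (eq y d)
  where
  eq : ∀ y d → 2 * ((y + d) * y) + 0 + d * d ≡ (y + d) * (y + d) + y * y + 0
  eq = solve-∀

product-of-differences : ∀ {a b c d} → a ≤ b → c ≤ d → a * d + b * c ≤ a * c + b * d
product-of-differences {a} {b} {c} {d} a≤b c≤d with ≤⇒∃ a≤b | ≤⇒∃ c≤d
... | u , refl | v , refl = ≤-from (u * v) (≤-refl {0}) (eq a u c v)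
  where
  eq : ∀ a u c v → a * (c + v) + (a + u) * c + 0 + u * v ≡ a * c + (a + u) * (c + v) + 0
  eq = solve-∀

4*-cancel : ∀ a b → 4 * a ≤ 4 * b + 3 → a ≤ b
4*-cancel a b h = ≮⇒≥ λ b<a → n≮n (4 * b + 3) (begin-strict
  4 * b + 3 <⟨ ≤-reflexive (eq b) ⟩ 4 * suc b ≤⟨ *-monoʳ-≤ 4 b<a ⟩ 4 * a ≤⟨ h ⟩ 4 * b + 3 ∎)
  where
  open ≤-Reasoning
  eq : ∀ b → suc (4 * b + 3) ≡ 4 * suc b
  eq = solve-∀

record Admissible (K N κ q : ℕ) : Set where
  field
    1≤K    : 1 ≤ K
    6≤κ    : 6 ≤ κ
    5K     : 5 * K ≡ 2 * N + q
    q≤4    : q ≤ 4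
    target : 6 * (K * N) + 5 ≤ κ + N * N + N + 6 * (K * K)
    κ-low  : 11 * (K * K) + 12 ≤ 4 * κ + 18 * K
    κ-sq   : 9 * (K * K) ≤ 4 * κ + 6 * K + 2

module Estimates {K N κ q : ℕ} (adm : Admissible K N κ q) where
  open Admissible adm

  -- The inequality of the means for `2n + 1` and `3K` bounds `12nK` by `(2n + 1)² + 9K² - 6K`.
  hamiltonian : ∀ n e → e ≤ n * K → 3 * e ≤ κ + n * n + n
  hamiltonian n e e≤ = 4*-cancel _ _ (≤-from 0
    (+-mono-≤ (+-mono-≤ (*-monoʳ-≤ 12 e≤) (twice-product (2 * n + 1) (3 * K))) κ-sq) (eq n K κ e))
    where
    eq : ∀ n K κ e → 4 * (3 * e) + (12 * (n * K) + ((2 * n + 1) * (2 * n + 1) + 3 * K * (3 * K)) + (4 * κ + 6 * K + 2)) + 0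
      ≡ 4 * (κ + n * n + n) + 3 + (12 * e + 2 * ((2 * n + 1) * (3 * K)) + 9 * (K * K))
    eq = solve-∀

  -- With `n = c + r`, the hypotheses give `3e ≤ 6Kn - 6K²`. At `n = N` this is `target`. For
  -- `n = N - m` the left side is smaller by `6Km` and the right one only by `m(2n + m + 1)`; this
  -- is `short`.
  longCycle : ∀ c r D e → c + r ≤ N → 2 * K ≤ c → D ≤ K → e ≤ c * K + 2 * (r * D) →
              3 * e ≤ κ + (c + r) * (c + r) + (c + r)
  longCycle c r D e n≤N 2K≤c D≤K e≤ with ≤⇒∃ n≤N
  ... | m , refl = ≤-from 5 (+-mono-≤ (+-mono-≤ (+-mono-≤ (*-monoʳ-≤ 3 e≤)
        (*-monoʳ-≤ 6 (*-monoʳ-≤ r D≤K))) (*-monoʳ-≤ (3 * K) 2K≤c)) (+-mono-≤ target (*-monoʳ-≤ m short)))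
        (eq c r m K D κ e)
    where
    short : 2 * (c + r) + m + 1 ≤ 6 * K
    short = begin
      2 * (c + r) + m + 1      ≤⟨ m≤m+n _ m ⟩
      2 * (c + r) + m + 1 + m  ≡⟨ eq₁ (c + r) m ⟩
      2 * (c + r + m) + 1      ≤⟨ +-mono-≤ (≤-trans (m≤m+n _ q) (≤-reflexive (sym 5K))) 1≤K ⟩
      5 * K + K                ≡⟨ eq₂ K ⟩
      6 * K                    ∎
      where
      open ≤-Reasoning
      eq₁ : ∀ n m → 2 * n + m + 1 + m ≡ 2 * (n + m) + 1
      eq₁ = solve-∀
      eq₂ : ∀ K → 5 * K + K ≡ 6 * K
      eq₂ = solve-∀
    eq : ∀ c r m K D κ e →
      3 * e + (3 * (c * K + 2 * (r * D)) + 6 * (r * K) + 3 * K * c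
         + (κ + (c + r + m) * (c + r + m) + (c + r + m) + 6 * (K * K) + m * (6 * K))) + 5
      ≡ κ + (c + r) * (c + r) + (c + r)
        + (3 * e + 6 * (r * D) + 3 * K * (2 * K) + (6 * (K * (c + r + m)) + 5 + m * (2 * (c + r) + m + 1)))
    eq = solve-∀

  module Short {D t p n s : ℕ} (D≡ : D ≡ t + p) (3D≡ : 3 * D ≡ n + 1 + s) where

    -- Four times the claim for a cycle of length `c = 2D + t` and `r = n - c`, after the bounds on
    -- `e` and `E` have been inserted. The 3 is allowed since `4*-cancel` rounds it away.
    Bound : Set
    Bound = 12 * (K * D) + 24 * (K * t) + 24 * (n * D)
              ≤ 4 * κ + 4 * (n * n) + 4 * n + 36 * (D * D) + 30 * (t * D) + 6 * (t * t) + 3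

    -- The assumption on `D` absorbs all terms with `t`, and the inequality of the means for `6D`
    -- and `2n + K` absorbs those with `D`. At `n = N` there remains `(5K - 2N)² ≤ 16`, the point
    -- where the threshold is decisive; smaller `n` only helps as `1 ≤ K`.
    large-D : ∀ m → n + m ≡ N → 4 * K ≤ 5 * D + t → Bound
    large-D m refl 4K≤ = ≤-from 7 (+-mono-≤ (+-mono-≤ (+-mono-≤ (twice-product (6 * D) (2 * n + K)) (*-monoʳ-≤ (6 * t) 4K≤))
        (*-monoʳ-≤ 4 target)) (+-mono-≤ square (*-monoʳ-≤ (4 * m) 1≤K))) (eq D t n m K κ)
      where
      square : 25 * (K * K) + 4 * ((n + m) * (n + m)) ≤ 20 * (K * (n + m)) + 16
      square = begin
        25 * (K * K) + 4 * ((n + m) * (n + m))          ≡⟨ eq₁ K (n + m) ⟩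
        5 * K * (5 * K) + 4 * ((n + m) * (n + m))       ≡⟨ cong (λ x → x * x + 4 * ((n + m) * (n + m))) 5K ⟩
        (2 * (n + m) + q) * (2 * (n + m) + q) + 4 * ((n + m) * (n + m)) ≡⟨ eq₂ (n + m) q ⟩
        4 * ((2 * (n + m) + q) * (n + m)) + q * q       ≡⟨ cong (λ x → 4 * (x * (n + m)) + q * q) 5K ⟨
        4 * (5 * K * (n + m)) + q * q                   ≡⟨ cong (_+ q * q) (eq₃ K (n + m)) ⟩
        20 * (K * (n + m)) + q * q                      ≤⟨ +-monoʳ-≤ _ (*-mono-≤ q≤4 q≤4) ⟩
        20 * (K * (n + m)) + 16                         ∎
        where
        open ≤-Reasoning
        eq₁ : ∀ K N → 25 * (K * K) + 4 * (N * N) ≡ 5 * K * (5 * K) + 4 * (N * N)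
        eq₁ = solve-∀
        eq₂ : ∀ N q → (2 * N + q) * (2 * N + q) + 4 * (N * N) ≡ 4 * ((2 * N + q) * N) + q * q
        eq₂ = solve-∀
        eq₃ : ∀ K N → 4 * (5 * K * N) ≡ 20 * (K * N)
        eq₃ = solve-∀
      eq : ∀ D t n m K κ →
        12 * (K * D) + 24 * (K * t) + 24 * (n * D)
          + (6 * D * (6 * D) + (2 * n + K) * (2 * n + K) + 6 * t * (5 * D + t)
             + 4 * (κ + (n + m) * (n + m) + (n + m) + 6 * (K * K))
             + (20 * (K * (n + m)) + 16 + 4 * m * K)) + 7
        ≡ 4 * κ + 4 * (n * n) + 4 * n + 36 * (D * D) + 30 * (t * D) + 6 * (t * t) + 3
          + (2 * (6 * D * (2 * n + K)) + 6 * t * (4 * K) + 4 * (6 * (K * (n + m)) + 5)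
             + (25 * (K * K) + 4 * ((n + m) * (n + m)) + 4 * m * 1))
      eq = solve-∀

    -- Eliminates `n`: by `n + 1 = 3D - s`, the expression `4n² + 4n + 36D² - 24nD` equals
    -- `12D + 4s + 4s²`, and the terms with `s` are dropped.
    reduce : 12 * (K * D) + 24 * (K * t) ≤ 4 * κ + 12 * D + 30 * (t * D) + 6 * (t * t) + 3 → Bound
    reduce h = ≤-from (4 * s + 4 * (s * s)) (+-mono-≤ h (≤-reflexive square)) (eq D t n s K κ)
      where
      square : 24 * (n * D) + 12 * D + 4 * s + 4 * (s * s) ≡ 4 * (n * n) + 4 * n + 36 * (D * D)
      square = begin
        24 * (n * D) + 12 * D + 4 * s + 4 * (s * s)            ≡⟨ eq₁ n D s ⟩
        8 * (n * (3 * D)) + 4 * (3 * D) + 4 * s + 4 * (s * s)  ≡⟨ cong (λ x → 8 * (n * x) + 4 * x + 4 * s + 4 * (s * s)) 3D≡ ⟩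
        8 * (n * (n + 1 + s)) + 4 * (n + 1 + s) + 4 * s + 4 * (s * s) ≡⟨ eq₂ n s ⟩
        4 * (n * n) + 4 * n + 4 * ((n + 1 + s) * (n + 1 + s))  ≡⟨ cong (λ x → 4 * (n * n) + 4 * n + 4 * (x * x)) 3D≡ ⟨
        4 * (n * n) + 4 * n + 4 * (3 * D * (3 * D))            ≡⟨ eq₃ n D ⟩
        4 * (n * n) + 4 * n + 36 * (D * D)                     ∎
        where
        open ≡-Reasoning
        eq₁ : ∀ n D s → 24 * (n * D) + 12 * D + 4 * s + 4 * (s * s) ≡ 8 * (n * (3 * D)) + 4 * (3 * D) + 4 * s + 4 * (s * s)
        eq₁ = solve-∀
        eq₂ : ∀ n s → 8 * (n * (n + 1 + s)) + 4 * (n + 1 + s) + 4 * s + 4 * (s * s)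
                      ≡ 4 * (n * n) + 4 * n + 4 * ((n + 1 + s) * (n + 1 + s))
        eq₂ = solve-∀
        eq₃ : ∀ n D → 4 * (n * n) + 4 * n + 4 * (3 * D * (3 * D)) ≡ 4 * (n * n) + 4 * n + 36 * (D * D)
        eq₃ = solve-∀
      eq : ∀ D t n s K κ →
        12 * (K * D) + 24 * (K * t) + 24 * (n * D)
          + (4 * κ + 12 * D + 30 * (t * D) + 6 * (t * t) + 3 + (4 * (n * n) + 4 * n + 36 * (D * D)))
          + (4 * s + 4 * (s * s))
        ≡ 4 * κ + 4 * (n * n) + 4 * n + 36 * (D * D) + 30 * (t * D) + 6 * (t * t) + 3
          + (12 * (K * D) + 24 * (K * t) + (24 * (n * D) + 12 * D + 4 * s + 4 * (s * s)))
      eq = solve-∀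

    -- For fixed `t` the inequality is linear in `p`, the right side gaining `30t + 12 - 12K` per
    -- unit. If this is nonnegative, `p = 0` is the worst case and `κ-sq` suffices. Otherwise large
    -- `p` is worst; `5t + 5p < 4K` limits it, and `product-of-differences` inserts this limit.
    small-D : 5 * D + t < 4 * K → Bound
    small-D 5D+t<4K = reduce (subst (λ D → 12 * (K * D) + 24 * (K * t) ≤ 4 * κ + 12 * D + 30 * (t * D) + 6 * (t * t) + 3)
                       (sym D≡) core)
      where
      core : 12 * (K * (t + p)) + 24 * (K * t) ≤ 4 * κ + 12 * (t + p) + 30 * (t * (t + p)) + 6 * (t * t) + 3
      core with 12 * K ≤? 30 * t + 12
      ... | yes big-t = ≤-from 0 (+-mono-≤ (+-mono-≤ (*-monoʳ-≤ p big-t) (twice-product (6 * t + 1) (3 * K))) κ-sq)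
          (eq t p K κ)
        where
        eq : ∀ t p K κ → 12 * (K * (t + p)) + 24 * (K * t)
               + (p * (30 * t + 12) + ((6 * t + 1) * (6 * t + 1) + 3 * K * (3 * K)) + (4 * κ + 6 * K + 2)) + 0
             ≡ 4 * κ + 12 * (t + p) + 30 * (t * (t + p)) + 6 * (t * t) + 3
               + (p * (12 * K) + 2 * ((6 * t + 1) * (3 * K)) + 9 * (K * K))
        eq = solve-∀
      ... | no small-t = *-cancelˡ-≤ 5 (≤-from 15
          (+-mono-≤ (+-mono-≤ (product-of-differences (≰⇒≥ small-t) 5t+5p<4K) (*-monoʳ-≤ 5 κ-low))
                    (+-mono-≤ 30K≤ (*-monoʳ-≤ 30 (t≤t² t))))
          (eq t p K κ))
        where
        5t+5p<4K : 5 * t + 5 * p + 1 ≤ 4 * K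
        5t+5p<4K = begin
          5 * t + 5 * p + 1  ≡⟨ cong (_+ 1) (≡.trans (sym (*-distribˡ-+ 5 t p)) (cong (5 *_) (sym D≡))) ⟩
          5 * D + 1          ≤⟨ +-monoˡ-≤ 1 (m≤m+n (5 * D) t) ⟩
          5 * D + t + 1      ≡⟨ +-comm _ 1 ⟩
          suc (5 * D + t)    ≤⟨ 5D+t<4K ⟩
          4 * K              ∎
          where open ≤-Reasoning
        t≤t² : ∀ t → t ≤ t * t
        t≤t² zero = z≤n
        t≤t² (suc t) = m≤m+n (suc t) (t * suc t)
        30K≤ : 30 * K ≤ 7 * (K * K) + 48
        30K≤ = *-cancelˡ-≤ 7 (≤-from 111 (twice-product (7 * K) 15) (eq′ K))
          where
          eq′ : ∀ K → 7 * (30 * K) + (7 * K * (7 * K) + 15 * 15) + 111 ≡ 7 * (7 * (K * K) + 48) + 2 * (7 * K * 15)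
          eq′ = solve-∀
        eq : ∀ t p K κ → 5 * (12 * (K * (t + p)) + 24 * (K * t))
             + ((30 * t + 12) * (5 * t + 5 * p + 1) + 12 * K * (4 * K) + 5 * (4 * κ + 18 * K)
                + (7 * (K * K) + 48 + 30 * (t * t))) + 15
           ≡ 5 * (4 * κ + 12 * (t + p) + 30 * (t * (t + p)) + 6 * (t * t) + 3)
             + ((30 * t + 12) * (4 * K) + 12 * K * (5 * t + 5 * p + 1) + 5 * (11 * (K * K) + 12)
                + (30 * K + 30 * t))
        eq = solve-∀

  dominating-estimate : ∀ c r D E e → c + r ≤ N → 2 * D ≤ c → c + r < 3 * D → D ≤ K → E ≤ c * K →
    (c ≤ 2 * K → 2 * E + 6 * (K * D) + c * c ≤ 4 * (K * c) + 3 * (c * D)) → e ≤ E + 2 * (r * D) →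
    3 * e ≤ κ + (c + r) * (c + r) + (c + r)
  dominating-estimate c r D E e n≤N 2D≤c n<3D D≤K E≤cK cycle e≤ with ≤-total (2 * K) c
  ... | inj₁ 2K≤c = longCycle c r D e n≤N 2K≤c D≤K (≤-trans e≤ (+-monoˡ-≤ _ E≤cK))
  ... | inj₂ c≤2K with ≤⇒∃ 2D≤c | ≤⇒∃ n≤N | ≤⇒∃ n<3D
  ...   | t , refl | m , N≡ | s , 3D≡ with ≤⇒∃ t≤D
    where
    t≤D : t ≤ D
    t≤D = +-cancelˡ-≤ (2 * D) t D (begin
      2 * D + t      ≤⟨ m≤m+n _ r ⟩
      2 * D + t + r  ≤⟨ <⇒≤ n<3D ⟩
      3 * D          ≡⟨ eq D ⟩
      2 * D + D      ∎)
      where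
      open ≤-Reasoning
      eq : ∀ D → 3 * D ≡ 2 * D + D
      eq = solve-∀
  ...     | p , D≡ = 4*-cancel _ _ (≤-from 0
      (+-mono-≤ (+-mono-≤ (*-monoʳ-≤ 12 e≤) (*-monoʳ-≤ 6 (cycle c≤2K))) bound)
      (eq D t r K κ E e))
    where
    open Short {D} {t} {p} {2 * D + t + r} {s} D≡ (≡.trans 3D≡ (cong (_+ s) (+-comm 1 (2 * D + t + r))))
    bound : Bound
    bound with 4 * K ≤? 5 * D + t
    ... | yes large = large-D m (sym N≡) large
    ... | no small = small-D (≰⇒> small)
    eq : ∀ D t r K κ E e →
      4 * (3 * e)
        + (12 * (E + 2 * (r * D)) + 6 * (4 * (K * (2 * D + t)) + 3 * ((2 * D + t) * D))
           + (4 * κ + 4 * ((2 * D + t + r) * (2 * D + t + r)) + 4 * (2 * D + t + r)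
              + 36 * (D * D) + 30 * (t * D) + 6 * (t * t) + 3)) + 0
      ≡ 4 * (κ + (2 * D + t + r) * (2 * D + t + r) + (2 * D + t + r)) + 3
        + (12 * e + 6 * (2 * E + 6 * (K * D) + (2 * D + t) * (2 * D + t))
           + (12 * (K * D) + 24 * (K * t) + 24 * ((2 * D + t + r) * D)))
    eq = solve-∀

-- The upper bound

module Extremal {v : ℕ} (G : Graph v) (K : ℕ)
                (sparse : ∀ v zs → Linked (Graph.Adj G) zs → Unique (v ∷ zs) → Degrees.deg G v zs ≤ K) where
  open Graph G
  open Blocks G public
  open Sparse G K sparse using (module OnSet)
  open DecMembership (Fin._≟_ {v}) using (_∈?_)

  longestPath-exists : ∀ {R u} → u ∈ R → (∀ {h P} → LongestPath R (h ∷ P) → ⊥) → ⊥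
  longestPath-exists {R} {u} u∈R k = maximal (IsPath R) length (length R)
    (λ P p → ⊆⇒length≤ (IsPath.unique p) (IsPath.within p))
    [ u ] single λ where
      [] _ mx → n≮n 0 (mx [ u ] single)
      (h ∷ P) p mx → k (longestPath p (λ {P′} p′ → mx P′ p′))
    where
    single : IsPath R [ u ]
    single = path [-] ([] ∷ []) (λ { (here refl) → u∈R })

  -- An end of a longest path has a neighbour on the path besides its successor, and this closes a
  -- cycle.
  longestCycle-exists : ∀ {S u} → Unique S → u ∈ S → (∀ {v} → v ∈ S → 2 ≤ deg v S) →
                        (∀ {x ys R} → Longest S x ys R → ⊥) → ⊥
  longestCycle-exists {S} uS u∈S 2≤deg k = longestPath-exists u∈S cycle
    where
    IsCyc : Fin v × List (Fin v) → Set
    IsCyc (x , ys) = Cyc x ys × (∀ {z} → z ∈ x ∷ ys → z ∈ S)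
    from : ∀ x ys → IsCyc (x , ys) → ⊥
    from x ys c = maximal IsCyc (λ (_ , ys) → length ys) (length S)
      (λ (x , ys) (c , sub) → ≤-trans (m≤n+m (length ys) 1) (⊆⇒length≤ (Cyc.unique c) sub))
      (x , ys) c λ (x , ys) (c , sub) mx → let R , S↭ = complement (x ∷ ys) (Cyc.unique c) sub in
        k (longest c S↭ (λ {x′} {ys′} c′ sub′ → mx (x′ , ys′) (c′ , sub′)))
    cycle : ∀ {h P} → LongestPath S (h ∷ P) → ⊥
    cycle {h} {[]} lp = n≮n 0 (≤-trans (≤-trans (n≤1+n 1) (2≤deg (LongestPath.within lp (here refl)))) (deg-⊆ h uS (endpoint lp)))
    cycle {h} {p ∷ P} lp with OnSet.neighbour uS h P nz
      where
      nz : deg h P ≢ 0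
      nz eq = n≮n 1 (begin
        2                    ≤⟨ 2≤deg (LongestPath.within lp (here refl)) ⟩
        deg h S              ≤⟨ deg-⊆ h uS (endpoint lp) ⟩
        𝟙 (adj? h p) + deg h P ≤⟨ +-mono-≤ (𝟙≤1 (adj? h p)) (≤-reflexive eq) ⟩
        1                    ∎)
        where open ≤-Reasoning
    ... | y , y∈P , hy with ∈-∃++ y∈P
    ...   | P₁ , P₂ , refl = from h (p ∷ P₁ ++ [ y ])
      ( cyc (Linked-∷ʳ (h ∷ p ∷ P₁) (Linked-upto (h ∷ p ∷ P₁) (LongestPath.linked lp)) (symm hy))
            (Unique-++ˡ (h ∷ p ∷ P₁ ++ [ y ]) (subst Unique reassoc (LongestPath.unique lp)))
            (s≤s (subst (1 ≤_) (sym (length-++ P₁)) (m≤n+m 1 (length P₁))))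
      , λ {z} m → LongestPath.within lp (subst (z ∈_) (sym reassoc) (∈-++⁺ˡ m)))
      where
      reassoc : h ∷ p ∷ P₁ ++ y ∷ P₂ ≡ (h ∷ p ∷ P₁ ++ [ y ]) ++ P₂
      reassoc = cong (λ t → h ∷ p ∷ t) (sym (++-assoc P₁ [ y ] P₂))

  remove-vertex : ∀ {S u} → u ∈ S → ∃[ S′ ] S ↭ u ∷ S′ × e₂ S ≡ 2 * deg u S + e₂ S′
  remove-vertex {u = u} u∈S with ∈-∃++ u∈S
  ... | ps , qs , refl = ps ++ qs , shift u ps qs ,
    ≡.trans (e₂-↭ (shift u ps qs)) (≡.trans (e₂-∷ u (ps ++ qs))
      (cong (λ d → 2 * d + e₂ (ps ++ qs)) (deg-↭ u (↭-sym (shift u ps qs)))))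

  module _ {S : List (Fin v)} (uS : Unique S) where
    open OnSet uS

    -- The case distinction with one continuation per outcome. It is separate from the induction
    -- because the case `K = 4` at `n = 8` concludes from it with other numbers.
    analyse : 3 ≤ length S →
      (∀ {u} → u ∈ S → 3 * deg u S ≤ length S → ⊥) →
      (Ear S → ⊥) →
      (∀ X S′ j → S ↭ X ++ S′ → 1 ≤ length X → length X < j → 2 * j ≤ suc (length S) →
        e₂ S ≤ e₂ S′ + length X * j → ⊥) →
      (e₂ S ≤ length S * K → ⊥) →
      (∀ c r D E → length S ≡ c + r → 1 ≤ r → 2 * D ≤ c → length S < 3 * D → D ≤ K → E ≤ c * K →
        (c ≤ 2 * K → 2 * E + 6 * (K * D) + c * c ≤ 4 * (K * c) + 3 * (c * D)) →
        e₂ S ≤ E + 2 * (r * D) → ⊥) →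
      ⊥
    analyse 3≤S low ear block ham dom = longestCycle-exists uS (proj₂ (inhabited S 3≤S)) (λ m → 2≤ (high m)) main
      where
      inhabited : ∀ xs → 3 ≤ length xs → ∃[ x ] x ∈ xs
      inhabited (x ∷ xs) _ = x , here refl
      high : ∀ {u} → u ∈ S → length S < 3 * deg u S
      high m = ≰⇒> (low m)
      2≤ : ∀ {d} → length S < 3 * d → 2 ≤ d
      2≤ {d} h = ≮⇒≥ λ d<2 → n≮n 3 (≤-trans (≤-trans (s≤s 3≤S) h) (*-monoʳ-≤ 3 (≤-pred d<2)))
      main : ∀ {x ys R} → Longest S x ys R → ⊥
      main {x} {ys} {[]} L = ham (begin
        e₂ S                    ≡⟨ e₂-↭ S↭ ⟩
        e₂ (x ∷ ys)             ≤⟨ e₂-cycle≤ (Longest.cycle L) ⟩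
        length (x ∷ ys) * K     ≡⟨ cong (_* K) (↭-length S↭) ⟨
        length S * K            ∎)
        where
        open ≤-Reasoning
        S↭ : S ↭ x ∷ ys
        S↭ = subst (S ↭_) (++-identityʳ (x ∷ ys)) (Longest.split L)
      main {x} {ys} {R@(r ∷ _)} L = longestPath-exists {R} (here refl) off
        where
        C = x ∷ ys
        off : ∀ {h P} → LongestPath R (h ∷ P) → ⊥
        off {P = _ ∷ _} lp = edge-off-cycle uS L ear (λ m → ≤-trans (n≤1+n 1) (2≤ (high m))) block lp
        off {h} {[]} lp = maximal (_∈ R) (λ w → deg w C) (length C) (λ w _ → deg≤length w C) h
          (LongestPath.within lp (here refl)) λ w w∈R mx →
            dom (length C) (length R) (deg w C) (e₂ C)
              (≡.trans (↭-length (Longest.split L)) (length-++ C)) (s≤s z≤n)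
              (deg-offCycle L w∈R)
              (subst (λ d → length S < 3 * d) (deg-on-C w∈R) (high (offCycle⇒∈ L w∈R)))
              (sparse w C (Linked-++ˡ C (Cyc.closed (Longest.cycle L)))
                (∉⇒Unique (λ m → Unique-disjoint C (splitUnique uS L) m w∈R) (Cyc.unique (Longest.cycle L))))
              (e₂-cycle≤ (Longest.cycle L))
              (e₂-cycle L w∈R (≤-trans (≤-trans (n≤1+n 1) (2≤ (high (offCycle⇒∈ L w∈R)))) (≤-reflexive (deg-on-C w∈R))))
              (dominating L independent w∈R (λ {u} m → mx u m))
          where
          independent : ∀ {u w} → u ∈ R → w ∈ R → ¬ Adj u w
          independent {u} {w} u∈ w∈ uw = n≮n 1 (LongestPath.maximum lp
            (path (uw ∷ [-]) (∉⇒Unique (λ { (here refl) → irrefl uw }) ([] ∷ []))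
                  (λ { (here refl) → u∈ ; (there (here refl)) → w∈ })))
          deg-on-C : ∀ {w} → w ∈ R → deg w S ≡ deg w C
          deg-on-C {w} w∈ = begin
            deg w S           ≡⟨ deg-↭ w (Longest.split L) ⟩
            deg w (C ++ R)    ≡⟨ deg-++ w C R ⟩
            deg w C + deg w R ≡⟨ cong (deg w C +_) (deg-zero w R (independent w∈)) ⟩
            deg w C + 0       ≡⟨ +-identityʳ _ ⟩
            deg w C           ∎
            where open ≡-Reasoning

  module _ {N κ q : ℕ} (adm : Admissible K N κ q) where
    open Admissible adm
    open Estimates adm

    Φ : ℕ → ℕ
    Φ n = κ + n * n + n

    small : ∀ {e} n → n ≤ 2 → e ≤ n * n → 3 * e ≤ Φ n
    small {e} n n≤2 e≤ = begin
      3 * e         ≤⟨ *-monoʳ-≤ 3 e≤ ⟩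
      3 * (n * n)   ≤⟨ cases n n≤2 ⟩
      6 + n * n + n ≤⟨ +-monoˡ-≤ n (+-monoˡ-≤ (n * n) 6≤κ) ⟩
      Φ n           ∎
      where
      open ≤-Reasoning
      cases : ∀ n → n ≤ 2 → 3 * (n * n) ≤ 6 + n * n + n
      cases 0 _ = z≤n
      cases 1 _ = ≤ᵇ⇒≤ 3 8 _
      cases 2 _ = ≤ᵇ⇒≤ 12 12 _
      cases (suc (suc (suc n))) (s≤s (s≤s ()))

    -- `Φ n` exceeds `Φ (n - 1)` by `2n`, which is three times the loss `2d` for `d = n/3`. This
    -- step and the next two have no surplus, and they fix the form of `Φ`.
    step-vertex : ∀ {n′ e e′} d → 3 * d ≤ suc n′ → e ≤ 2 * d + e′ → 3 * e′ ≤ Φ n′ → 3 * e ≤ Φ (suc n′)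
    step-vertex {n′} {e} {e′} d 3d≤ e≤ ih =
      ≤-from 0 (+-mono-≤ (+-mono-≤ (*-monoʳ-≤ 2 3d≤) (*-monoʳ-≤ 3 e≤)) ih) (eq n′ e e′ d κ)
      where
      eq : ∀ n e e′ d κ → 3 * e + (2 * suc n + 3 * (2 * d + e′) + (κ + n * n + n)) + 0
         ≡ κ + suc n * suc n + suc n + (2 * (3 * d) + 3 * e + 3 * e′)
      eq = solve-∀

    step-ear : ∀ {n′ e e′} r → 3 * r + 1 ≤ 2 * (2 + n′) → e ≤ e′ + 2 * r → 3 * e′ ≤ Φ n′ → 3 * e ≤ Φ (2 + n′)
    step-ear {n′} {e} {e′} r 3r≤ e≤ ih =
      ≤-from 0 (+-mono-≤ (+-mono-≤ (*-monoʳ-≤ 2 3r≤) (*-monoʳ-≤ 3 e≤)) ih) (eq n′ e e′ r κ)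
      where
      eq : ∀ n e e′ r κ → 3 * e + (2 * (2 * (2 + n)) + 3 * (e′ + 2 * r) + (κ + n * n + n)) + 0
         ≡ κ + (2 + n) * (2 + n) + (2 + n) + (2 * (3 * r + 1) + 3 * e + 3 * e′)
      eq = solve-∀

    step-block : ∀ {n′ e e′} x j → x < j → 2 * j ≤ suc (x + n′) → e ≤ e′ + x * j → 3 * e′ ≤ Φ n′ → 3 * e ≤ Φ (x + n′)
    step-block {n′} {e} {e′} x j x<j 2j≤ e≤ ih =
      ≤-from 0 (+-mono-≤ (+-mono-≤ (*-monoʳ-≤ x 3j≤) (*-monoʳ-≤ 3 e≤)) ih) (eq x j n′ e e′ κ)
      where
      -- Twice the bound on `2 * j`, minus `suc x ≤ j`.
      3j≤ : 3 * j ≤ suc (x + 2 * n′)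
      3j≤ = ≤-from 0 (+-mono-≤ (*-monoʳ-≤ 2 2j≤) x<j) (eq′ x j n′)
        where
        eq′ : ∀ x j n → 3 * j + (2 * suc (x + n) + j) + 0 ≡ suc (x + 2 * n) + (2 * (2 * j) + suc x)
        eq′ = solve-∀
      eq : ∀ x j n e e′ κ → 3 * e + (x * suc (x + 2 * n) + 3 * (e′ + x * j) + (κ + n * n + n)) + 0
         ≡ κ + (x + n) * (x + n) + (x + n) + (x * (3 * j) + 3 * e + 3 * e′)
      eq = solve-∀

    bound : ∀ m S → Unique S → length S ≤ m → length S ≤ N → 3 * e₂ S ≤ Φ (length S)
    bound m S uS S≤m S≤N with length S ≤? 2
    ... | yes S≤2 = small (length S) S≤2 (cross-≤* S S (λ {x} _ → deg≤length x S))
    bound zero S uS S≤m S≤N | no S>2 = ⊥-elim (S>2 (≤-trans S≤m z≤n))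
    bound (suc m) S uS S≤m S≤N | no S>2 = ≮⇒≥ λ bad → analyse uS (≰⇒> S>2)
      (λ {u} u∈S 3d≤ → let S′ , S↭ , e≡ = remove-vertex u∈S in <⇒≱ bad
        (subst (λ l → 3 * e₂ S ≤ Φ l) (sym (↭-length S↭))
          (step-vertex {e = e₂ S} {e₂ S′} (deg u S) (subst (3 * deg u S ≤_) (↭-length S↭) 3d≤) (≤-reflexive e≡)
            (induct [ u ] S′ S↭ (s≤s z≤n)))))
      (λ E → let open EarBounds uS E ; S′ , S↭ = rest in <⇒≱ bad
        (subst (λ l → 3 * e₂ S ≤ Φ l) (sym (↭-length S↭))
          (step-ear {e = e₂ S} {e₂ S′} removed (subst (λ l → 3 * removed + 1 ≤ 2 * l) (↭-length S↭) removed-bound) (≤-reflexive e₂-removed)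
            (induct (Ear.u E ∷ Ear.v E ∷ []) S′ S↭ (s≤s z≤n)))))
      (λ X S′ j S↭ 1≤X X<j 2j≤ e≤ → let len = ≡.trans (↭-length S↭) (length-++ X) in <⇒≱ bad
        (subst (λ l → 3 * e₂ S ≤ Φ l) (sym len)
          (step-block {e = e₂ S} {e₂ S′} (length X) j X<j (subst (λ l → 2 * j ≤ suc l) len 2j≤) e≤ (induct X S′ S↭ 1≤X))))
      (λ e≤ → <⇒≱ bad (hamiltonian (length S) (e₂ S) e≤))
      (λ c r D E len 1≤r 2D≤c n<3D D≤K E≤ cycle e≤ → <⇒≱ bad
        (subst (λ l → 3 * e₂ S ≤ Φ l) (sym len)
          (dominating-estimate c r D E (e₂ S) (subst (_≤ N) len S≤N) 2D≤c (subst (_< 3 * D) len n<3D)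
            D≤K E≤ cycle e≤)))
      where
      induct : ∀ X S′ → S ↭ X ++ S′ → 1 ≤ length X → 3 * e₂ S′ ≤ Φ (length S′)
      induct X S′ S↭ 1≤X = bound m S′ (Unique-++ʳ X (Unique-↭ S↭ uS))
        (≤-pred (≤-trans (s≤s (≤-refl {length S′})) (≤-trans shorter S≤m)))
        (≤-trans (n≤1+n _) (≤-trans shorter S≤N))
        where
        shorter : suc (length S′) ≤ length S
        shorter = begin
          1 + length S′          ≤⟨ +-monoˡ-≤ (length S′) 1≤X ⟩
          length X + length S′   ≡⟨ length-++ X ⟨
          length (X ++ S′)       ≡⟨ ↭-length S↭ ⟨
          length S               ∎
          where open ≤-Reasoning

-- Reduction to the threshold

module Peeling {v : ℕ} (G : Graph v) (K : ℕ)
               (sparse : ∀ v zs → Linked (Graph.Adj G) zs → Unique (v ∷ zs) → Degrees.deg G v zs ≤ K) where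
  open Extremal G K sparse

  e₂-even : ∀ S → ∃[ h ] e₂ S ≡ 2 * h
  e₂-even [] = 0 , refl
  e₂-even (x ∷ S) with e₂-even S
  ... | h , eq = deg x (x ∷ S) + h ,
    ≡.trans (e₂-∷ x S) (≡.trans (cong (2 * deg x (x ∷ S) +_) eq) (sym (*-distribˡ-+ 2 (deg x (x ∷ S)) h)))

  peel : ∀ {N M} → (∀ S → Unique S → length S ≡ N → e₂ S ≤ 2 * (K * M)) →
         ∀ d S → Unique S → length S ≡ d + N → e₂ S ≤ 2 * (K * (d + M))
  peel base zero S uS len = base S uS len
  peel {N} {M} base (suc d) (u ∷ S) uS len = ≮⇒≥ λ bad → longestPath-exists {u ∷ S} (here refl)
    λ {h} {P} lp → let S′ , S↭ , e≡ = remove-vertex (LongestPath.within lp (here refl)) in <⇒≱ bad (begin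
      e₂ (u ∷ S)                           ≡⟨ e≡ ⟩
      2 * deg h (u ∷ S) + e₂ S′            ≤⟨ +-mono-≤ (*-monoʳ-≤ 2 (≤-trans (deg-⊆ h uS (endpoint lp))
                                                (sparse h P (Linked.tail (LongestPath.linked lp)) (LongestPath.unique lp))))
                                              (peel base d S′ (Unique-++ʳ [ h ] (Unique-↭ S↭ uS))
                                                (suc-injective (≡.trans (sym (↭-length S↭)) len))) ⟩
      2 * K + 2 * (K * (d + M))            ≡⟨ eq K (d + M) ⟩
      2 * (K * (suc d + M))                ∎)
    where
    open ≤-Reasoning
    eq : ∀ K x → 2 * K + 2 * (K * x) ≡ 2 * (K * suc x)
    eq = solve-∀

  -- As `e₂` is even, the left side of the bound is a multiple of 6, and the 5 in the hypothesis
  -- disappears by rounding.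
  from-bound : ∀ {N M κ q} → Admissible K N κ q → κ + N * N + N ≡ 6 * (K * M) + 5 →
               ∀ S → Unique S → length S ≡ N → e₂ S ≤ 2 * (K * M)
  from-bound {N} {M} {κ} adm tight S uS refl with e₂-even S | bound adm N S uS ≤-refl ≤-refl
  ... | h , eq | b rewrite eq = *-monoʳ-≤ 2 {h} {K * M} (≮⇒≥ λ KM<h → n≮n (6 * (K * M) + 5) (begin-strict
      6 * (K * M) + 5          <⟨ ≤-reflexive (arith (K * M)) ⟩
      6 * suc (K * M)          ≤⟨ *-monoʳ-≤ 6 KM<h ⟩
      6 * h                    ≡⟨ *-assoc 3 2 h ⟩
      3 * (2 * h)              ≤⟨ b ⟩
      κ + N * N + N            ≡⟨ tight ⟩
      6 * (K * M) + 5          ∎))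
    where
    open ≤-Reasoning
    arith : ∀ x → suc (6 * x + 5) ≡ 6 * suc x
    arith = solve-∀

-- The constants for odd and for even `K`

-- The parity is that of `K = k + 1`. Here and for even `K`, `κ` is the number for which `target` is
-- an equality.
admissible-odd : ∀ b → Admissible (3 + 2 * b) (6 + 5 * b) (11 * (b * b) + 25 * b + 17) 3
admissible-odd b = record
  { 1≤K = s≤s z≤n
  ; 6≤κ = ≤-trans (m≤n+m 6 11) (m≤n+m 17 (11 * (b * b) + 25 * b))
  ; 5K = eq₁ b
  ; q≤4 = n≤1+n 3
  ; target = ≤-from 0 (≤-refl {0}) (eq₂ b)
  ; κ-low = ≤-from (4 * b + 11) (≤-refl {0}) (eq₃ b)
  ; κ-sq = ≤-from (8 * (b * b) + 4 * b + 7) (≤-refl {0}) (eq₄ b)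
  }
  where
  eq₁ : ∀ b → 5 * (3 + 2 * b) ≡ 2 * (6 + 5 * b) + 3
  eq₁ = solve-∀
  eq₂ : ∀ b → 6 * ((3 + 2 * b) * (6 + 5 * b)) + 5 + 0 + 0
    ≡ 11 * (b * b) + 25 * b + 17 + (6 + 5 * b) * (6 + 5 * b) + (6 + 5 * b) + 6 * ((3 + 2 * b) * (3 + 2 * b)) + 0
  eq₂ = solve-∀
  eq₃ : ∀ b → 11 * ((3 + 2 * b) * (3 + 2 * b)) + 12 + 0 + (4 * b + 11)
    ≡ 4 * (11 * (b * b) + 25 * b + 17) + 18 * (3 + 2 * b) + 0
  eq₃ = solve-∀
  eq₄ : ∀ b → 9 * ((3 + 2 * b) * (3 + 2 * b)) + 0 + (8 * (b * b) + 4 * b + 7)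
    ≡ 4 * (11 * (b * b) + 25 * b + 17) + 6 * (3 + 2 * b) + 2 + 0
  eq₄ = solve-∀

-- Starts at `K = 6`: for `K = 4` the formula gives `κ = 29`, which violates `κ-sq`. For even `K`
-- the condition `κ-low` is an equality.
admissible-even : ∀ c → let b = suc c in Admissible (4 + 2 * b) (8 + 5 * b) (11 * (b * b) + 35 * b + 29) 4
admissible-even c = record
  { 1≤K = s≤s z≤n
  ; 6≤κ = ≤-trans (m≤n+m 6 23) (m≤n+m 29 (11 * (suc c * suc c) + 35 * suc c))
  ; 5K = eq₁ (suc c)
  ; q≤4 = ≤-refl
  ; target = ≤-from 0 (≤-refl {0}) (eq₂ (suc c))
  ; κ-low = ≤-from 0 (≤-refl {0}) (eq₃ (suc c))
  ; κ-sq = ≤-from (8 * (c * c) + 24 * c + 14) (≤-refl {0}) (eq₄ c)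
  }
  where
  eq₁ : ∀ b → 5 * (4 + 2 * b) ≡ 2 * (8 + 5 * b) + 4
  eq₁ = solve-∀
  eq₂ : ∀ b → 6 * ((4 + 2 * b) * (8 + 5 * b)) + 5 + 0 + 0
    ≡ 11 * (b * b) + 35 * b + 29 + (8 + 5 * b) * (8 + 5 * b) + (8 + 5 * b) + 6 * ((4 + 2 * b) * (4 + 2 * b)) + 0
  eq₂ = solve-∀
  eq₃ : ∀ b → 11 * ((4 + 2 * b) * (4 + 2 * b)) + 12 + 0 + 0
    ≡ 4 * (11 * (b * b) + 35 * b + 29) + 18 * (4 + 2 * b) + 0
  eq₃ = solve-∀
  eq₄ : ∀ c → 9 * ((4 + 2 * suc c) * (4 + 2 * suc c)) + 0 + (8 * (c * c) + 24 * c + 14)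
    ≡ 4 * (11 * (suc c * suc c) + 35 * suc c + 29) + 6 * (4 + 2 * suc c) + 2 + 0
  eq₄ = solve-∀

-- With the tight constant 29 the bound fails for the clique on five vertices; module Four
-- removes the resulting excess of one edge at N = 8.
admissible-four : Admissible 4 8 30 4
admissible-four = record
  { 1≤K = s≤s z≤n ; 6≤κ = ≤ᵇ⇒≤ 6 30 _ ; 5K = refl ; q≤4 = ≤-refl
  ; target = ≤ᵇ⇒≤ 197 198 _ ; κ-low = ≤ᵇ⇒≤ 188 192 _ ; κ-sq = ≤ᵇ⇒≤ 144 146 _ }

divide : ∀ d {x y b} → d * x ≤ b → b < d * suc y → x ≤ y
divide d {x} {y} h b< = ≤-pred (*-cancelˡ-< d x (suc y) (≤-<-trans h b<))

-- The case `K = 4` at `N = 8`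

module Four {order : ℕ} (G : Graph order)
            (sparse : ∀ v zs → Linked (Graph.Adj G) zs → Unique (v ∷ zs) → Degrees.deg G v zs ≤ 4) where
  open Graph G
  open Extremal G 4 sparse
  open Peeling G 4 sparse using (e₂-even)
  open Sparse G 4 sparse using (module OnSet)

  module _ {S : List (Fin order)} (uS : Unique S) (len : length S ≡ 8) where
    open OnSet uS

    smaller : ∀ X S′ b → S ↭ X ++ S′ → 30 + (8 ∸ length X) * (8 ∸ length X) + (8 ∸ length X) < 3 * suc b → e₂ S′ ≤ b
    smaller X S′ b S↭ lt = divide 3 (bound admissible-four (length S′) S′ (Unique-++ʳ X (Unique-↭ S↭ uS)) ≤-refl (≤-trans (m≤n+m (length S′) (length X)) (≤-reflexive total)))
      (subst (λ l → 30 + l * l + l < 3 * suc b) (≡.trans (cong (_∸ length X) (sym total)) (m+n∸m≡n (length X) (length S′))) lt)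
      where
      total : length X + length S′ ≡ 8
      total = ≡.trans (sym (length-++ X)) (≡.trans (sym (↭-length S↭)) len)

    two : ∀ (xs : List (Fin order)) → 2 ≤ length xs → length xs ≤ 2 → ∃[ p ] ∃[ q ] xs ≡ p ∷ q ∷ []
    two (p ∷ q ∷ []) _ _ = p , q , refl
    two (_ ∷ []) (s≤s ()) _
    two (_ ∷ _ ∷ _ ∷ _) _ (s≤s (s≤s ()))

    -- Exchanging p₁, p₂ for u, w gives another longest cycle.
    crossless : ∀ {a b u w p₁ p₂ p₄ p₅ R} → Longest S a (p₁ ∷ p₂ ∷ b ∷ p₄ ∷ p₅ ∷ []) R →
                LongestPath R (u ∷ w ∷ []) → Adj u a → Adj w b → ¬ Adj p₁ p₄ × ¬ Adj p₁ p₅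
    crossless {a} {b} {u} {w} {p₁} {p₂} {p₄} {p₅} L lp ua wb
      with swapArc uS {mid = p₁ ∷ p₂ ∷ []} L (u ∷ w ∷ []) refl (s≤s z≤n)
             (symm ua ∷ Linked.head (LongestPath.linked lp) ∷ wb ∷ [-]) (LongestPath.unique lp) (LongestPath.within lp)
    ... | R₁ , L′ with Cyc.closed (Longest.cycle L)
    ...   | ap₁ ∷ p₁p₂ ∷ p₂b ∷ bp₄ ∷ p₄p₅ ∷ p₅a ∷ [-] =
      -- Now `p₂`, `p₁` would fit between the consecutive vertices `b` and `p₄`.
      (λ adj → n≮0 (gap uS L′ (p₂ ∷ p₁ ∷ []) (s≤s z≤n)
        (∉⇒Unique (λ { (here refl) → irrefl p₁p₂ }) ([] ∷ []))
        (λ { (here refl) → there (here refl) ; (there (here refl)) → here refl })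
        (a ∷ u ∷ w ∷ []) [] (p₅ ∷ a ∷ []) refl (Adj⇒≢ bp₄)
        (symm p₂b ∷ symm p₁p₂ ∷ adj ∷ [-]))) ,
      (λ adj → noTwo L′ (here refl) (a ∷ u ∷ w ∷ b ∷ p₄ ∷ []) p₅ a [] refl adj (symm ap₁))

    crossless-deg : ∀ {a b u w p₁ p₂ p₄ p₅ R} → Longest S a (p₁ ∷ p₂ ∷ b ∷ p₄ ∷ p₅ ∷ []) R →
                    LongestPath R (u ∷ w ∷ []) → Adj u a → Adj w b →
                    deg p₁ (a ∷ p₁ ∷ p₂ ∷ b ∷ p₄ ∷ p₅ ∷ []) ≤ 3
    crossless-deg {a} {b} {u} {w} {p₁} {p₂} {p₄} {p₅} L lp ua wb with crossless L lp ua wb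
    ... | p₁≁p₄ , p₁≁p₅
      rewrite 𝟙-no (adj? p₁ p₁) irrefl | 𝟙-no (adj? p₁ p₄) p₁≁p₄ | 𝟙-no (adj? p₁ p₅) p₁≁p₅ =
      +-mono-≤ (𝟙≤1 (adj? p₁ a)) (+-mono-≤ (𝟙≤1 (adj? p₁ p₂)) (+-mono-≤ (𝟙≤1 (adj? p₁ b)) z≤n))

    Tight : Ear S → Set
    Tight E = ∃[ p₁ ] ∃[ p₂ ] ∃[ p₄ ] ∃[ p₅ ] M₁ ≡ p₁ ∷ p₂ ∷ [] × M₂ ≡ p₄ ∷ p₅ ∷ [] × mid ≡ []
      where open Ear E

    -- Both arcs have at least `ℓ ≥ 2` vertices, and with `a`, `b` and the path they fill at most 8
    -- places.
    tight : ∀ E → Tight E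
    tight E = collect (two M₁ (≤-trans (m≤m+n 2 _) ℓ≤M₁) M₁≤2) (two M₂ (≤-trans (m≤m+n 2 _) ℓ≤M₂) M₂≤2) (none mid mid≤0)
      where
      open EarBounds uS E
      open Ear E
      collect : ∃[ p₁ ] ∃[ p₂ ] M₁ ≡ p₁ ∷ p₂ ∷ [] → ∃[ p₄ ] ∃[ p₅ ] M₂ ≡ p₄ ∷ p₅ ∷ [] → mid ≡ [] → _
      collect (p₁ , p₂ , e₁) (p₄ , p₅ , e₂′) e₃ = p₁ , p₂ , p₄ , p₅ , e₁ , e₂′ , e₃
      none : ∀ (xs : List (Fin order)) → length xs ≤ 0 → xs ≡ []
      none [] _ = refl
      total : suc (length M₁ + suc (length M₂)) + (2 + length mid) ≤ 8
      total = subst (_≤ 8) (cong (λ l → suc l + (2 + length mid)) (length-++ M₁)) (≤-trans lengths (≤-reflexive len))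
      M₁≤2 : length M₁ ≤ 2
      M₁≤2 = ≤-from (2 * length mid) (+-mono-≤ total ℓ≤M₂) (eq (length M₁) (length M₂) (length mid))
        where
        eq : ∀ x y z → x + (8 + y) + 2 * z ≡ 2 + (suc (x + suc y) + (2 + z) + (2 + z))
        eq = solve-∀
      M₂≤2 : length M₂ ≤ 2
      M₂≤2 = ≤-from (2 * length mid) (+-mono-≤ total ℓ≤M₁) (eq (length M₁) (length M₂) (length mid))
        where
        eq : ∀ x y z → y + (8 + x) + 2 * z ≡ 2 + (suc (x + suc y) + (2 + z) + (2 + z))
        eq = solve-∀
      mid≤0 : length mid ≤ 0
      mid≤0 = ≤-from (2 * length mid) (+-mono-≤ total (+-mono-≤ ℓ≤M₁ ℓ≤M₂)) (eq (length M₁) (length M₂) (length mid))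
        where
        eq : ∀ x y z → z + (8 + (x + y)) + 2 * z ≡ suc (x + suc y) + (2 + z) + ((2 + z) + (2 + z))
        eq = solve-∀

    -- At most 5 edges meet `u` or `w`. On the cycle each of the six degrees is at most 4 and that
    -- of `p₁` at most 3, so twice the number of its edges is at most 23.
    tight-ear : ∀ E → Tight E → e₂ S ≤ 33
    tight-ear E@record { a = a ; b = b ; u = u ; v = w ; R = R ; isLongest = L ; isLongestPath = lp ; ua = ua ; vb = wb }
      (p₁ , p₂ , p₄ , p₅ , refl , refl , refl) = begin
        e₂ S                        ≡⟨ e₂-removed ⟩
        e₂ S′ + 2 * removed         ≡⟨ cong (_+ 2 * removed) (e₂-↭ S′↭C) ⟩
        e₂ C + 2 * removed          ≤⟨ +-mono-≤ e₂C≤23 (*-monoʳ-≤ 2 removed≤5) ⟩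
        33                          ∎
      where
      open ≤-Reasoning
      open EarBounds uS E
      C = a ∷ p₁ ∷ p₂ ∷ b ∷ p₄ ∷ p₅ ∷ []
      S′ = proj₁ rest
      removed≤5 : removed ≤ 5
      removed≤5 = divide 3 {removed} {5} (≤-pred (subst₂ _≤_ (+-comm _ 1) (cong (2 *_) len) removed-bound)) (≤ᵇ⇒≤ 16 18 _)
      C⊆S′ : ∀ {x} → x ∈ C → x ∈ S′
      C⊆S′ m with ∈-resp-↭ (proj₂ rest) (onCycle⇒∈ L m)
      ... | here refl = ⊥-elim (Unique-disjoint C (splitUnique uS L) m (LongestPath.within lp (here refl)))
      ... | there (here refl) = ⊥-elim (Unique-disjoint C (splitUnique uS L) m (LongestPath.within lp (there (here refl))))
      ... | there (there m′) = m′
      S′↭C : S′ ↭ C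
      S′↭C with complement C (Cyc.unique (Longest.cycle L)) C⊆S′
      ... | [] , p = subst (S′ ↭_) (++-identityʳ C) p
      ... | _ ∷ Q , p = ⊥-elim (n≮n 8 (begin-strict
        8                     <⟨ m≤m+n 9 (length Q) ⟩
        9 + length Q          ≡⟨ cong (2 +_) (↭-length p) ⟨
        2 + length S′         ≡⟨ ↭-length (proj₂ rest) ⟨
        length S              ≡⟨ len ⟩
        8                     ∎))
      e₂C≤23 : e₂ C ≤ 23
      e₂C≤23 = +-mono-≤ (deg-onCycle (Longest.cycle L) (here refl))
        (+-mono-≤ (crossless-deg L lp ua wb)
          (∑-≤* (λ x → deg x C) (p₂ ∷ b ∷ p₄ ∷ p₅ ∷ []) (λ m → deg-onCycle (Longest.cycle L) (there (there m)))))

    -- 33 suffices in place of 32, as `e₂` is even.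
    eight : e₂ S ≤ 33
    eight = ≮⇒≥ λ bad → analyse uS (subst (3 ≤_) (sym len) (≤ᵇ⇒≤ 3 8 _))
      (λ {u} u∈S 3d≤ → let S′ , S↭ , e≡ = remove-vertex u∈S in <⇒≱ bad (begin
        e₂ S                  ≡⟨ e≡ ⟩
        2 * deg u S + e₂ S′   ≤⟨ +-mono-≤ (*-monoʳ-≤ 2 (divide 3 {deg u S} {2} (subst (3 * deg u S ≤_) len 3d≤) (≤ᵇ⇒≤ 9 9 _)))
                                  (smaller [ u ] S′ 28 S↭ (≤ᵇ⇒≤ 87 87 _)) ⟩
        32                    ≤⟨ n≤1+n 32 ⟩
        33                    ∎))
      (λ E → <⇒≱ bad (tight-ear E (tight E)))
      (λ X S′ j S↭ 1≤X X<j 2j≤ e≤ → <⇒≱ bad (≤-trans e≤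
        (block-eight X S′ j S↭ 1≤X X<j (divide 2 {j} {4} (subst (λ l → 2 * j ≤ suc l) len 2j≤) (≤ᵇ⇒≤ 10 10 _)))))
      (λ e≤ → <⇒≱ bad (≤-trans e≤ (≤-trans (≤-reflexive (cong (_* 4) len)) (n≤1+n 32))))
      (λ c r D E l 1≤r 2D≤c n<3D _ E≤ cycle e≤ → <⇒≱ bad (≤-trans e≤
        (dom-eight c r D E (≡.trans (sym l) len) 1≤r 2D≤c (subst (_< 3 * D) len n<3D) cycle)))
      where
      open ≤-Reasoning
      block-eight : ∀ X S′ j → S ↭ X ++ S′ → 1 ≤ length X → length X < j → j ≤ 4 → e₂ S′ + length X * j ≤ 33
      block-eight X S′ j S↭ 1≤X X<j j≤4 = go (length X) refl 1≤X X<j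
        where
        go : ∀ x → length X ≡ x → 1 ≤ x → x < j → e₂ S′ + x * j ≤ 33
        go 1 eq _ _ = ≤-trans (+-mono-≤ (smaller X S′ 28 S↭ (subst (λ x → 30 + (8 ∸ x) * (8 ∸ x) + (8 ∸ x) < 87) (sym eq) (≤ᵇ⇒≤ 87 87 _))) (*-monoʳ-≤ 1 j≤4)) (n≤1+n 32)
        go 2 eq _ _ = ≤-trans (+-mono-≤ (smaller X S′ 24 S↭ (subst (λ x → 30 + (8 ∸ x) * (8 ∸ x) + (8 ∸ x) < 75) (sym eq) (≤ᵇ⇒≤ 73 75 _)))
          (*-monoʳ-≤ 2 j≤4)) (n≤1+n 32)
        go 3 eq _ _ = ≤-trans (+-mono-≤ (smaller X S′ 20 S↭ (subst (λ x → 30 + (8 ∸ x) * (8 ∸ x) + (8 ∸ x) < 63) (sym eq) (≤ᵇ⇒≤ 61 63 _)))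
          (*-monoʳ-≤ 3 j≤4)) (n≤1+n 32)
        go (suc (suc (suc (suc x)))) _ _ x<j = ⊥-elim (n≮n 4 (≤-trans (≤-trans (m≤m+n 5 x) x<j) j≤4))
      -- Only `D = 3` with `c = 7` or `c = 6` is possible. Then `E` is at most 27 or 21, and both
      -- cases end at exactly 33.
      dom-eight : ∀ c r D E → c + r ≡ 8 → 1 ≤ r → 2 * D ≤ c → 8 < 3 * D →
        (c ≤ 8 → 2 * E + 6 * (4 * D) + c * c ≤ 4 * (4 * c) + 3 * (c * D)) → E + 2 * (r * D) ≤ 33
      dom-eight c r D E eq 1≤r 2D≤c 8<3D cycle with D≡3
        where
        c≤7 : c ≤ 7
        c≤7 = ≤-pred (subst (suc c ≤_) eq (≤-trans (≤-reflexive (+-comm 1 c)) (+-monoʳ-≤ c 1≤r)))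
        D≡3 : D ≡ 3
        D≡3 = ≤-antisym (divide 2 {D} {3} (≤-trans 2D≤c c≤7) ≤-refl)
          (≮⇒≥ λ D<3 → n≮n 8 (≤-trans 8<3D (≤-trans (*-monoʳ-≤ 3 (≤-pred D<3)) (≤ᵇ⇒≤ 6 8 _))))
      dom-eight c 1 _ E eq _ _ _ cycle | refl with +-cancelʳ-≡ 1 c 7 eq
      ... | refl = +-monoˡ-≤ 6 (divide 2 {E} {27} (+-cancelʳ-≤ 121 _ 54 (≤-trans (≤-reflexive (sym (+-assoc (2 * E) 72 49))) (cycle (n≤1+n 7)))) (≤ᵇ⇒≤ 55 56 _))
      dom-eight c 2 _ E eq _ _ _ cycle | refl with +-cancelʳ-≡ 2 c 6 eq
      ... | refl = +-monoˡ-≤ 12 (divide 2 {E} {21} (+-cancelʳ-≤ 108 _ 42 (≤-trans (≤-reflexive (sym (+-assoc (2 * E) 72 36))) (cycle (m≤m+n 6 2)))) (≤ᵇ⇒≤ 43 44 _))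
      dom-eight c (suc (suc (suc r))) _ E eq _ 6≤c _ cycle | refl =
        ⊥-elim (n≮n 8 (≤-trans (+-mono-≤ 6≤c (m≤m+n 3 r)) (≤-reflexive eq)))

-- Cycles as lists and as records

module _ {A : Set} where

  length-filter-∑ : {P : A → Set} (P? : U.Decidable P) (xs : List A) → length (filter P? xs) ≡ ∑ (λ x → 𝟙 (P? x)) xs
  length-filter-∑ P? [] = refl
  length-filter-∑ P? (x ∷ xs) with P? x
  ... | yes _ = cong suc (length-filter-∑ P? xs)
  ... | no _  = length-filter-∑ P? xs

  ∑-⊆ : ∀ (f : A → ℕ) {xs ys} → Unique xs → (∀ {x} → x ∈ xs → x ∈ ys) → ∑ f xs ≤ ∑ f ys
  ∑-⊆ f {xs} {ys} u sub with complement xs u sub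
  ... | R , p = begin
    ∑ f xs           ≤⟨ m≤m+n _ _ ⟩
    ∑ f xs + ∑ f R   ≡⟨ ∑-++ f xs R ⟨
    ∑ f (xs ++ R)    ≡⟨ ∑-↭ f p ⟨
    ∑ f ys           ∎
    where open ≤-Reasoning

  module _ {P : A → Set} (P? : ∀ x → Dec (P x)) where

    ∑-atMostOne : ∀ {xs} → Unique xs → (∀ {x y} → P x → P y → x ≡ y) → ∑ (λ x → 𝟙 (P? x)) xs ≤ 1
    ∑-atMostOne {[]} _ _ = z≤n
    ∑-atMostOne {x ∷ xs} u h with P? x
    ... | no _ = ∑-atMostOne (Unique-++ʳ [ x ] u) h
    ... | yes px = ≤-reflexive (cong suc (∑-zero _ xs (λ {y} m → 𝟙-no (P? y) λ py →
      Unique-head u (subst (_∈ xs) (h py px) m))))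

    ∑-≥length : ∀ {xs ys} → Unique xs → (∀ {x} → x ∈ xs → x ∈ ys × P x) → length xs ≤ ∑ (λ x → 𝟙 (P? x)) ys
    ∑-≥length {xs} {ys} u sub = begin
      length xs                    ≡⟨ *-identityʳ _ ⟨
      length xs * 1                ≡⟨ ∑-const xs ⟨
      ∑ (λ _ → 1) xs               ≡⟨ ∑-cong xs (λ {x} m → 𝟙-yes (P? x) (proj₂ (sub m))) ⟨
      ∑ (λ x → 𝟙 (P? x)) xs        ≤⟨ ∑-⊆ _ u (λ m → proj₁ (sub m)) ⟩
      ∑ (λ x → 𝟙 (P? x)) ys        ∎
      where
      open ≤-Reasoning
      ∑-const : ∀ xs → ∑ (λ (_ : A) → 1) xs ≡ length xs * 1
      ∑-const [] = refl
      ∑-const (_ ∷ xs) = cong suc (∑-const xs)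

∑-map : ∀ {A B : Set} (f : B → ℕ) (g : A → B) xs → ∑ f (map g xs) ≡ ∑ (λ x → f (g x)) xs
∑-map f g [] = refl
∑-map f g (x ∷ xs) = cong (f (g x) +_) (∑-map f g xs)

∑-lookup : ∀ {A : Set} (f : A → ℕ) xs → ∑ (λ i → f (lookup xs i)) (allFin (length xs)) ≡ ∑ f xs
∑-lookup f xs = begin
  ∑ (λ i → f (lookup xs i)) (allFin (length xs))  ≡⟨ ∑-map f (lookup xs) (allFin (length xs)) ⟨
  ∑ f (map (lookup xs) (allFin (length xs)))      ≡⟨ cong (∑ f) (List.map-tabulate (λ i → i) (lookup xs)) ⟩
  ∑ f (tabulate (lookup xs))                      ≡⟨ cong (∑ f) (List.tabulate-lookup xs) ⟩
  ∑ f xs                                          ∎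
  where open ≡-Reasoning

∑-cartesianProduct : ∀ {A B : Set} (f : A × B → ℕ) xs ys →
                     ∑ f (cartesianProduct xs ys) ≡ ∑ (λ x → ∑ (λ y → f (x , y)) ys) xs
∑-cartesianProduct f [] ys = refl
∑-cartesianProduct f (x ∷ xs) ys = ≡.trans (∑-++ f (map (x ,_) ys) (cartesianProduct xs ys))
  (cong₂ _+_ (∑-map f (x ,_) ys) (∑-cartesianProduct f xs ys))

lookup-injective : ∀ {A : Set} {xs : List A} → Unique xs → ∀ {i j} → lookup xs i ≡ lookup xs j → i ≡ j
lookup-injective {xs = x ∷ xs} u {Fin.zero} {Fin.zero} _ = refl
lookup-injective {xs = x ∷ xs} u {Fin.zero} {Fin.suc j} eq = contradiction (subst (_∈ xs) (sym eq) (∈-lookup j)) (Unique-head u)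
lookup-injective {xs = x ∷ xs} u {Fin.suc i} {Fin.zero} eq = contradiction (subst (_∈ xs) eq (∈-lookup i)) (Unique-head u)
lookup-injective {xs = x ∷ xs} u {Fin.suc i} {Fin.suc j} eq = cong Fin.suc (lookup-injective (Unique-++ʳ [ x ] u) eq)

next-% : ∀ {m} (i : Fin (suc m)) → toℕ (next i) ≡ suc (toℕ i) % suc m
next-% i = Fin.toℕ-fromℕ< _

next-step : ∀ {m} (i : Fin (suc m)) → suc (toℕ i) < suc m → toℕ (next i) ≡ suc (toℕ i)
next-step i lt = ≡.trans (next-% i) (m<n⇒m%n≡m lt)

next-last : ∀ {m} (i : Fin (suc m)) → toℕ i ≡ m → toℕ (next i) ≡ 0
next-last {m} i eq = ≡.trans (next-% i) (≡.trans (cong (λ x → suc x % suc m) eq) (n%n≡0 (suc m)))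

next-cases : ∀ {m} (i : Fin (suc m)) → (toℕ i < m × toℕ (next i) ≡ suc (toℕ i)) ⊎ (toℕ i ≡ m × toℕ (next i) ≡ 0)
next-cases {m} i with m≤n⇒m<n∨m≡n (≤-pred (Fin.toℕ<n i))
... | inj₁ lt = inj₁ (lt , next-step i (s≤s lt))
... | inj₂ eq = inj₂ (eq , next-last i eq)

next-injective : ∀ {m} {i j : Fin (suc m)} → next i ≡ next j → i ≡ j
next-injective {i = i} {j} eq with next-cases i | next-cases j
... | inj₁ (_ , a) | inj₁ (_ , b) = Fin.toℕ-injective (suc-injective (≡.trans (sym a) (≡.trans (cong toℕ eq) b)))
... | inj₂ (a , _) | inj₂ (b , _) = Fin.toℕ-injective (≡.trans a (sym b))
... | inj₁ (_ , a) | inj₂ (_ , b) = contradiction (≡.trans (sym a) (≡.trans (cong toℕ eq) b)) λ ()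
... | inj₂ (_ , a) | inj₁ (_ , b) = contradiction (≡.trans (sym b) (≡.trans (cong toℕ (sym eq)) a)) λ ()

prev : ∀ {m} → Fin (suc m) → Fin (suc m)
prev {m} Fin.zero = fromℕ m
prev (Fin.suc j) = inject₁ j

next-prev : ∀ {m} (i : Fin (suc m)) → next (prev i) ≡ i
next-prev {m} Fin.zero = Fin.toℕ-injective (next-last (fromℕ m) (Fin.toℕ-fromℕ m))
next-prev {suc m} (Fin.suc j) = Fin.toℕ-injective (≡.trans
  (next-step (inject₁ j) (s≤s (subst (_< suc m) (sym (Fin.toℕ-inject₁ j)) (Fin.toℕ<n j))))
  (cong suc (Fin.toℕ-inject₁ j)))

next-next≢ : ∀ {m} (i : Fin (3 + m)) → next (next i) ≢ i
next-next≢ {m} i eq with next-cases i | next-cases (next i)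
... | inj₁ (_ , a) | inj₁ (_ , b) = m≢1+n+m (toℕ i) {1}
  (≡.trans (sym (cong toℕ eq)) (≡.trans b (cong suc a)))
... | inj₁ (_ , a) | inj₂ (b , c) = contradiction (≡.trans (sym b) (≡.trans a (cong suc (≡.trans (sym (cong toℕ eq)) c)))) λ ()
... | inj₂ (a , b) | inj₁ (_ , c) = contradiction (≡.trans (sym a) (≡.trans (sym (cong toℕ eq)) (≡.trans c (cong suc b)))) λ ()
... | inj₂ (_ , b) | inj₂ (c , _) = contradiction (≡.trans (sym c) b) λ ()

module _ {n : ℕ} {G : Graph n} (C : Cycle G) where
  open Graph G
  open Cycle C

  private
    positions : List (Fin (3 + m))
    positions = allFin (3 + m)

  neighboursAt : Fin (3 + m) → ℕ
  neighboursAt i = ∑ (λ j → 𝟙 (adj? (vertex i) (vertex j))) positions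

  consecutiveAt : Fin (3 + m) → ℕ
  consecutiveAt i = ∑ (λ j → 𝟙 (consecutive? i j)) positions

  chordsAt-∑ : ∀ i → chordsAt C i ≡ ∑ (λ j → 𝟙 (chord? C i j)) positions
  chordsAt-∑ i = length-filter-∑ (chord? C i) positions

  consecutive≤2 : ∀ i → consecutiveAt i ≤ 2
  consecutive≤2 i = begin
    consecutiveAt i ≤⟨ ∑-mono positions (λ {j} _ → split j) ⟩
    ∑ (λ j → 𝟙 (j Fin.≟ next i) + 𝟙 (i Fin.≟ next j)) positions ≡⟨ ∑-+ (λ j → 𝟙 (j Fin.≟ next i)) (λ j → 𝟙 (i Fin.≟ next j)) positions ⟩
    ∑ (λ j → 𝟙 (j Fin.≟ next i)) positions + ∑ (λ j → 𝟙 (i Fin.≟ next j)) positions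
      ≤⟨ +-mono-≤ (∑-atMostOne (λ j → j Fin.≟ next i) (Unique.allFin⁺ _) (λ p q → ≡.trans p (sym q)))
                  (∑-atMostOne (λ j → i Fin.≟ next j) (Unique.allFin⁺ _) (λ p q → next-injective (≡.trans (sym p) q))) ⟩
    2 ∎
    where
    open ≤-Reasoning
    split : ∀ j → 𝟙 (consecutive? i j) ≤ 𝟙 (j Fin.≟ next i) + 𝟙 (i Fin.≟ next j)
    split j with j Fin.≟ next i | i Fin.≟ next j
    ... | yes _ | _     = s≤s z≤n
    ... | no _  | yes _ = s≤s z≤n
    ... | no _  | no _  = z≤n

  -- Neighbours on the cycle are chords plus two. This half produces chords for the upper bound; the
  -- converse limits them in the examples.
  neighbours≤chords : ∀ i → neighboursAt i ≤ chordsAt C i + 2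
  neighbours≤chords i = begin
    neighboursAt i                   ≤⟨ ∑-mono positions (λ {j} _ → split j) ⟩
    ∑ (λ j → 𝟙 (chord? C i j) + 𝟙 (consecutive? i j)) positions ≡⟨ ∑-+ (λ j → 𝟙 (chord? C i j)) (λ j → 𝟙 (consecutive? i j)) positions ⟩
    ∑ (λ j → 𝟙 (chord? C i j)) positions + consecutiveAt i ≤⟨ +-mono-≤ (≤-reflexive (sym (chordsAt-∑ i))) (consecutive≤2 i) ⟩
    chordsAt C i + 2                 ∎
    where
    open ≤-Reasoning
    split : ∀ j → 𝟙 (adj? (vertex i) (vertex j)) ≤ 𝟙 (chord? C i j) + 𝟙 (consecutive? i j)
    split j with adj? (vertex i) (vertex j) | consecutive? i j
    ... | no _  | _     = z≤n
    ... | yes _ | yes _ = s≤s z≤n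
    ... | yes _ | no _  = s≤s z≤n

  chords≤neighbours : ∀ i → chordsAt C i + 2 ≤ neighboursAt i
  chords≤neighbours i = begin
    chordsAt C i + 2                                         ≤⟨ +-mono-≤ (≤-reflexive (chordsAt-∑ i)) two ⟩
    ∑ (λ j → 𝟙 (chord? C i j)) positions + consecutiveAt i   ≡⟨ ∑-+ (λ j → 𝟙 (chord? C i j)) (λ j → 𝟙 (consecutive? i j)) positions ⟨
    ∑ (λ j → 𝟙 (chord? C i j) + 𝟙 (consecutive? i j)) positions ≤⟨ ∑-mono positions (λ {j} _ → split j) ⟩
    neighboursAt i                                           ∎
    where
    open ≤-Reasoning
    two : 2 ≤ consecutiveAt i
    two = ∑-≥length (consecutive? i) {next i ∷ prev i ∷ []}
      (∉⇒Unique (λ { (here eq) → next-next≢ (prev i) (≡.trans (cong next (next-prev i)) eq) }) ([] ∷ []))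
      (λ { (here refl) → ∈-allFin _ , inj₁ refl ; (there (here refl)) → ∈-allFin _ , inj₂ (sym (next-prev i)) })
    consecutive⇒adj : ∀ {j} → Consecutive i j → Adj (vertex i) (vertex j)
    consecutive⇒adj (inj₁ refl) = adjacent i
    consecutive⇒adj {j} (inj₂ refl) = symm (adjacent j)
    split : ∀ j → 𝟙 (chord? C i j) + 𝟙 (consecutive? i j) ≤ 𝟙 (adj? (vertex i) (vertex j))
    split j with consecutive? i j | adj? (vertex i) (vertex j)
    ... | yes c | yes _ = s≤s z≤n
    ... | yes c | no ¬a = contradiction (consecutive⇒adj c) ¬a
    ... | no _  | yes _ = s≤s z≤n
    ... | no _  | no _  = z≤n

module FromLists {n : ℕ} (G : Graph n) where
  open Graph G
  open Cycles G

  Linked-lookup : ∀ xs {e} → Linked Adj (xs ++ [ e ]) → ∀ i j → toℕ j ≡ suc (toℕ i) → Adj (lookup xs i) (lookup xs j)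
  Linked-lookup (x ∷ y ∷ xs) (r ∷ l) Fin.zero (Fin.suc Fin.zero) _ = r
  Linked-lookup (x ∷ y ∷ xs) (r ∷ l) (Fin.suc i) (Fin.suc j) eq = Linked-lookup (y ∷ xs) l i j (suc-injective eq)
  Linked-lookup (x ∷ y ∷ xs) (r ∷ l) Fin.zero (Fin.suc (Fin.suc j)) ()
  Linked-lookup (x ∷ []) _ Fin.zero Fin.zero ()

  Linked-lookup-last : ∀ xs {e} → Linked Adj (xs ++ [ e ]) → ∀ i → suc (toℕ i) ≡ length xs → Adj (lookup xs i) e
  Linked-lookup-last (x ∷ []) (r ∷ _) Fin.zero _ = r
  Linked-lookup-last (x ∷ y ∷ xs) (r ∷ l) (Fin.suc i) eq = Linked-lookup-last (y ∷ xs) l i (suc-injective eq)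
  Linked-lookup-last (x ∷ y ∷ xs) (r ∷ l) Fin.zero ()

  fromCyc : ∀ {x ys k} → Cyc x ys → 2 + k ≤ deg x ys → HasCycleWithChords k G
  fromCyc {ys = []} (cyc _ _ ()) _
  fromCyc {ys = _ ∷ []} (cyc _ _ (s≤s ())) _
  fromCyc {x} {ys@(y ∷ z ∷ zs)} {k} (cyc l u _) many = C , Fin.zero ,
    +-cancelʳ-≤ 2 k _ (begin
      k + 2                    ≡⟨ +-comm k 2 ⟩
      2 + k                    ≤⟨ many ⟩
      deg x ys                 ≡⟨ deg-self x ys ⟨
      deg x (x ∷ ys)           ≡⟨ ∑-lookup (λ w → 𝟙 (adj? x w)) (x ∷ ys) ⟨
      neighboursAt C Fin.zero  ≤⟨ neighbours≤chords C Fin.zero ⟩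
      chordsAt C Fin.zero + 2  ∎)
    where
    open ≤-Reasoning
    adjacent′ : ∀ i → Adj (lookup (x ∷ ys) i) (lookup (x ∷ ys) (next i))
    adjacent′ i with next-cases i
    ... | inj₁ (_ , eq) = Linked-lookup (x ∷ ys) l i (next i) eq
    ... | inj₂ (eq , eq₀) = subst (λ j → Adj (lookup (x ∷ ys) i) (lookup (x ∷ ys) j)) (sym (Fin.toℕ-injective eq₀))
      (Linked-lookup-last (x ∷ ys) l i (cong suc eq))
    C : Cycle G
    C = record { m = length zs ; vertex = lookup (x ∷ ys) ; injective = lookup-injective u ; adjacent = adjacent′ }

  firstNeighbour : ∀ v xs → 1 ≤ deg v xs → ∃[ pre ] ∃[ p ] ∃[ rest ] xs ≡ pre ++ p ∷ rest × Adj v p × deg v xs ≡ suc (deg v rest)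
  firstNeighbour v (x ∷ xs) h with adj? v x
  ... | yes a = [] , x , xs , refl , a , refl
  ... | no _ with firstNeighbour v xs h
  ...   | pre , p , rest , eq , a , d = x ∷ pre , p , rest , cong (x ∷_) eq , a , d

  lastNeighbour : ∀ v xs → 1 ≤ deg v xs → ∃[ ys ] ∃[ q ] ∃[ post ] xs ≡ ys ++ q ∷ post × Adj v q × deg v xs ≡ deg v (ys ++ [ q ])
  lastNeighbour v (x ∷ xs) h with deg v xs Data.Nat.≟ 0
  ... | no nz with lastNeighbour v xs (n≢0⇒n>0 nz)
  ...   | ys , q , post , eq , a , d = x ∷ ys , q , post , cong (x ∷_) eq , a , cong (𝟙 (adj? v x) +_) d
  lastNeighbour v (x ∷ xs) h | yes z with adj? v x in eqx
  ... | yes a = [] , x , xs , refl , a , ≡.trans (cong suc z) (cong (λ d → 𝟙 d + 0) (sym eqx))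
  ... | no _ = contradiction (subst (1 ≤_) z h) λ ()

  -- The stretch from the first to the last neighbour of `v`, closed through `v`, contains all these
  -- neighbours. If there were `k + 2` of them, two would be joined to `v` by edges of the cycle and
  -- the others by chords.
  sparse : ∀ {k} → ¬ HasCycleWithChords k G → ∀ v zs → Linked Adj zs → Unique (v ∷ zs) → deg v zs ≤ suc k
  sparse {k} none v zs l u = ≮⇒≥ λ many → absurd many
    where
    absurd : ¬ (suc k < deg v zs)
    absurd many with firstNeighbour v zs (≤-trans (s≤s z≤n) many)
    ... | pre , p , rest , refl , vp , d₁ with lastNeighbour v rest (≤-trans (s≤s z≤n) (≤-pred (subst (suc k <_) d₁ many)))
    ...   | ys , q , post , refl , vq , d₂ = none (fromCyc {v} {p ∷ ys ++ [ q ]}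
      (cyc (vp ∷ subst (Linked Adj) (cong (p ∷_) (sym (++-assoc ys [ q ] [ v ])))
             (Linked-join (p ∷ ys) (Linked-upto (p ∷ ys) (Linked-++ʳ pre l)) (symm vq ∷ [-])))
           (∉⇒Unique (λ m → Unique-head u (∈-++⁺ʳ pre (widen m)))
             (Unique-++ˡ (p ∷ ys ++ [ q ]) (subst Unique (cong (p ∷_) (sym (++-assoc ys [ q ] post)))
               (Unique-++ʳ pre (Unique-++ʳ [ v ] u)))))
           (s≤s (subst (1 ≤_) (sym (length-++ ys)) (m≤n+m 1 (length ys)))))
      (≤-trans many (≤-reflexive (≡.trans d₁ (≡.trans (cong suc d₂) (cong (_+ deg v (ys ++ [ q ])) (sym (𝟙-yes (adj? v p) vp))))))))
      where
      widen : ∀ {x} → x ∈ p ∷ ys ++ [ q ] → x ∈ p ∷ ys ++ q ∷ post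
      widen {x} m = subst (x ∈_) (cong (p ∷_) (++-assoc ys [ q ] post)) (∈-++⁺ˡ m)

  -- For each ordered pair of adjacent vertices exactly one orientation is counted by `edgeCount`,
  -- so the sum and its transpose together give all degrees.
  2*edgeCount : 2 * edgeCount G ≡ e₂ (allFin n)
  2*edgeCount = begin
    2 * edgeCount G       ≡⟨ cong (2 *_) (≡.trans (length-filter-∑ edge? (cartesianProduct (allFin n) (allFin n)))
                                                  (∑-cartesianProduct (𝟙 ∘ edge?) (allFin n) (allFin n))) ⟩
    2 * upper             ≡⟨ cong (upper +_) (+-identityʳ upper) ⟩
    upper + upper         ≡⟨ cong (upper +_) (∑-comm (λ x y → 𝟙 (edge? (x , y))) (allFin n) (allFin n)) ⟩
    upper + ∑ (λ x → ∑ (λ y → 𝟙 (edge? (y , x))) (allFin n)) (allFin n) ≡⟨ ∑-+ _ _ (allFin n) ⟨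
    ∑ (λ x → ∑ (λ y → 𝟙 (edge? (x , y))) (allFin n) + ∑ (λ y → 𝟙 (edge? (y , x))) (allFin n)) (allFin n)
      ≡⟨ ∑-cong (allFin n) (λ {x} _ → ≡.trans (sym (∑-+ _ _ (allFin n))) (∑-cong (allFin n) (λ {y} _ → oriented x y))) ⟩
    e₂ (allFin n)         ∎
    where
    open ≡-Reasoning
    edge? : (p : Fin n × Fin n) → Dec (proj₁ p Fin.< proj₂ p × Adj (proj₁ p) (proj₂ p))
    edge? p = (proj₁ p Fin.<? proj₂ p) ×-dec adj? (proj₁ p) (proj₂ p)
    upper = ∑ (λ x → ∑ (λ y → 𝟙 (edge? (x , y))) (allFin n)) (allFin n)
    oriented : ∀ x y → 𝟙 (edge? (x , y)) + 𝟙 (edge? (y , x)) ≡ 𝟙 (adj? x y)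
    oriented x y = decide (adj? x y)
      where
      decide : Dec (Adj x y) → 𝟙 (edge? (x , y)) + 𝟙 (edge? (y , x)) ≡ 𝟙 (adj? x y)
      decide (no ¬a) = ≡.trans
        (cong₂ _+_ (𝟙-no (edge? (x , y)) (λ (_ , a) → ¬a a)) (𝟙-no (edge? (y , x)) (λ (_ , a) → ¬a (symm a))))
        (sym (𝟙-no (adj? x y) ¬a))
      decide (yes a) with Fin.<-cmp x y
      ... | tri< lt _ ¬gt = ≡.trans
        (cong₂ _+_ (𝟙-yes (edge? (x , y)) (lt , a)) (𝟙-no (edge? (y , x)) (λ (gt , _) → ¬gt gt)))
        (sym (𝟙-yes (adj? x y) a))
      ... | tri≈ _ refl _ = contradiction a irrefl
      ... | tri> ¬lt _ gt = ≡.trans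
        (cong₂ _+_ (𝟙-no (edge? (x , y)) (λ (lt , _) → ¬lt lt)) (𝟙-yes (edge? (y , x)) (gt , symm a)))
        (sym (𝟙-yes (adj? x y) a))

module _ {A : Set} {P : A → Set} (P? : ∀ x → Dec (P x)) where

  ∑-unique : ∀ {xs a} → Unique xs → a ∈ xs → P a → (∀ {x} → P x → x ≡ a) → ∑ (λ x → 𝟙 (P? x)) xs ≡ 1
  ∑-unique {xs} {a} u a∈xs pa only = ≤-antisym
    (∑-atMostOne P? u (λ p q → ≡.trans (only p) (sym (only q))))
    (∑-≥length P? {[ a ]} ([] ∷ []) (λ { (here refl) → a∈xs , pa }))

-- Extremal graphs

-- Vertices u with toℕ u < s form the core; every core vertex is joined to every
-- vertex outside the core, these are independent, and M is the graph on the core.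
module CoreGraph (s r d : ℕ) (M : ℕ → ℕ → Set) (M? : ∀ u v → Dec (M u v))
                 (M-sym : ∀ {u v} → M u v → M v u) (M-irrefl : ∀ {u} → ¬ M u u)
                 (M-core : ∀ {u v} → M u v → u < s)
                 (M-degree : ∀ u (vs : List ℕ) → Unique vs → ∑ (λ v → 𝟙 (M? u v)) vs ≤ d)
  where

  Joined : ℕ → ℕ → Set
  Joined u v = (u < s × s ≤ v) ⊎ (s ≤ u × v < s) ⊎ M u v

  joined? : ∀ u v → Dec (Joined u v)
  joined? u v = (u <? s ×-dec s ≤? v) ⊎-dec ((s ≤? u ×-dec v <? s) ⊎-dec M? u v)

  Joined-sym : ∀ {u v} → Joined u v → Joined v u
  Joined-sym (inj₁ (p , q)) = inj₂ (inj₁ (q , p))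
  Joined-sym (inj₂ (inj₁ (p , q))) = inj₁ (q , p)
  Joined-sym (inj₂ (inj₂ m)) = inj₂ (inj₂ (M-sym m))

  graph : Graph (s + r)
  graph = record
    { Adj = λ u v → Joined (toℕ u) (toℕ v)
    ; adj? = λ u v → joined? (toℕ u) (toℕ v)
    ; symm = Joined-sym
    ; irrefl = λ { (inj₁ (p , q)) → <⇒≱ p q ; (inj₂ (inj₁ (p , q))) → <⇒≱ q p ; (inj₂ (inj₂ m)) → M-irrefl m }
    }

  module _ (C : Cycle graph) where
    open Cycle C

    private
      positions : List (Fin (3 + m))
      positions = allFin (3 + m)

      label : Fin (3 + m) → ℕ
      label j = toℕ (vertex j)

      label-injective : ∀ {i j} → label i ≡ label j → i ≡ j
      label-injective eq = injective (Fin.toℕ-injective eq)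

    core-positions : ∑ (λ j → 𝟙 (label j <? s)) positions ≤ s
    core-positions = begin
      ∑ (λ j → 𝟙 (label j <? s)) positions          ≡⟨ length-filter-∑ (λ j → label j <? s) positions ⟨
      length (filter (λ j → label j <? s) positions) ≡⟨ List.length-map label (filter (λ j → label j <? s) positions) ⟨
      length (map label (filter (λ j → label j <? s) positions))
        ≤⟨ ⊆⇒length≤ (Unique.map⁺ label-injective (Unique.filter⁺ (λ j → label j <? s) (Unique.allFin⁺ _))) below ⟩
      length (upTo s)                                ≡⟨ List.length-upTo s ⟩
      s                                              ∎
      where
      open ≤-Reasoning
      below : ∀ {v} → v ∈ map label (filter (λ j → label j <? s) positions) → v ∈ upTo s
      below m with ∈-map⁻ label m
      ... | j , j∈ , refl = ∈-upTo⁺ (proj₂ (∈-filter⁻ (λ j → label j <? s) {xs = positions} j∈))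

    -- Every position outside the core is followed by one in the core.
    outer-positions : ∑ (λ j → 𝟙 (s ≤? label j)) positions ≤ s
    outer-positions = begin
      ∑ (λ j → 𝟙 (s ≤? label j)) positions          ≤⟨ ∑-mono positions (λ {j} _ → 𝟙-mono (s ≤? label j) (label (next j) <? s) (followed j)) ⟩
      ∑ (λ j → 𝟙 (label (next j) <? s)) positions   ≡⟨ ∑-map (λ j → 𝟙 (label j <? s)) next positions ⟨
      ∑ (λ j → 𝟙 (label j <? s)) (map next positions)
        ≤⟨ ∑-⊆ (λ j → 𝟙 (label j <? s)) (Unique.map⁺ next-injective (Unique.allFin⁺ _)) (λ _ → ∈-allFin _) ⟩
      ∑ (λ j → 𝟙 (label j <? s)) positions          ≤⟨ core-positions ⟩
      s                                             ∎
      where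
      open ≤-Reasoning
      followed : ∀ j → s ≤ label j → label (next j) < s
      followed j s≤ with adjacent j
      ... | inj₁ (lt , _) = contradiction s≤ (<⇒≱ lt)
      ... | inj₂ (inj₁ (_ , lt)) = lt
      ... | inj₂ (inj₂ e) = contradiction s≤ (<⇒≱ (M-core e))

    -- An outer vertex sees only the core. A core vertex sees at most `d` of the core, and on the
    -- cycle there are no more than `s` outer vertices for it to see.
    neighboursAt≤ : ∀ i → neighboursAt C i ≤ s + d
    neighboursAt≤ i with <-≤-connex (label i) s
    ... | inj₂ outer = ≤-trans (∑-mono positions (λ {j} _ → 𝟙-mono (joined? (label i) (label j)) (label j <? s) toCore))
        (≤-trans core-positions (m≤m+n s d))
      where
      toCore : ∀ {v} → Joined (label i) v → v < s
      toCore (inj₁ (lt , _)) = contradiction outer (<⇒≱ lt)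
      toCore (inj₂ (inj₁ (_ , lt))) = lt
      toCore (inj₂ (inj₂ e)) = contradiction outer (<⇒≱ (M-core e))
    ... | inj₁ core = begin
        neighboursAt C i
          ≤⟨ ∑-mono positions (λ {j} _ → split (label j)) ⟩
        ∑ (λ j → 𝟙 (s ≤? label j) + 𝟙 (M? (label i) (label j))) positions
          ≡⟨ ∑-+ (λ j → 𝟙 (s ≤? label j)) (λ j → 𝟙 (M? (label i) (label j))) positions ⟩
        ∑ (λ j → 𝟙 (s ≤? label j)) positions + ∑ (λ j → 𝟙 (M? (label i) (label j))) positions
          ≡⟨ cong (∑ (λ j → 𝟙 (s ≤? label j)) positions +_) (∑-map (λ v → 𝟙 (M? (label i) v)) label positions) ⟨
        ∑ (λ j → 𝟙 (s ≤? label j)) positions + ∑ (λ v → 𝟙 (M? (label i) v)) (map label positions)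
          ≤⟨ +-mono-≤ outer-positions (M-degree (label i) (map label positions) (Unique.map⁺ label-injective (Unique.allFin⁺ _))) ⟩
        s + d
          ∎
      where
      open ≤-Reasoning
      split : ∀ v → 𝟙 (joined? (label i) v) ≤ 𝟙 (s ≤? v) + 𝟙 (M? (label i) v)
      split v = decide (s ≤? v) (M? (label i) v)
        where
        decide : (p : Dec (s ≤ v)) (q : Dec (M (label i) v)) → 𝟙 (joined? (label i) v) ≤ 𝟙 p + 𝟙 q
        decide (yes _) _ = ≤-trans (𝟙≤1 (joined? (label i) v)) (s≤s z≤n)
        decide (no _) (yes _) = 𝟙≤1 (joined? (label i) v)
        decide (no s≰v) (no ¬m) = ≤-reflexive (𝟙-no (joined? (label i) v) λ where
          (inj₁ (_ , s≤v)) → s≰v s≤v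
          (inj₂ (inj₁ (s≤i , _))) → <⇒≱ core s≤i
          (inj₂ (inj₂ e)) → ¬m e)

  noCycle : ∀ {k} → s + d ≡ suc k → ¬ HasCycleWithChords k graph
  noCycle {k} s+d≡ (C , i , k≤) = n≮n (suc k) (begin
    2 + k              ≡⟨ +-comm 2 k ⟩
    k + 2              ≤⟨ +-monoˡ-≤ 2 k≤ ⟩
    chordsAt C i + 2   ≤⟨ chords≤neighbours C i ⟩
    neighboursAt C i   ≤⟨ neighboursAt≤ C i ⟩
    s + d              ≡⟨ s+d≡ ⟩
    suc k              ∎)
    where open ≤-Reasoning

  open FromLists graph using (2*edgeCount)
  open Degrees graph

  core outer : List (Fin (s + r))
  core = map (_↑ˡ r) (allFin s)
  outer = map (s ↑ʳ_) (allFin r)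

  core< : ∀ {u} → u ∈ core → toℕ u < s
  core< m with ∈-map⁻ (_↑ˡ r) m
  ... | i , _ , refl = subst (_< s) (sym (Fin.toℕ-↑ˡ i r)) (Fin.toℕ<n i)

  outer≥ : ∀ {u} → u ∈ outer → s ≤ toℕ u
  outer≥ m with ∈-map⁻ (s ↑ʳ_) m
  ... | i , _ , refl = subst (s ≤_) (sym (Fin.toℕ-↑ʳ s i)) (m≤m+n s (toℕ i))

  length-allFin : ∀ n → length (allFin n) ≡ n
  length-allFin n = List.length-tabulate (λ i → i)

  core-length : length core ≡ s
  core-length = ≡.trans (List.length-map (_↑ˡ r) (allFin s)) (length-allFin s)

  outer-length : length outer ≡ r
  outer-length = ≡.trans (List.length-map (s ↑ʳ_) (allFin r)) (length-allFin r)

  core-unique : Unique core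
  core-unique = Unique.map⁺ (Fin.↑ˡ-injective r _ _) (Unique.allFin⁺ s)

  allFin↭ : allFin (s + r) ↭ core ++ outer
  allFin↭ with complement (core ++ outer) (Unique.++⁺ core-unique
      (Unique.map⁺ (Fin.↑ʳ-injective s _ _) (Unique.allFin⁺ r)) (λ (a , b) → <⇒≱ (core< a) (outer≥ b)))
      (λ _ → ∈-allFin {s + r} _)
  ... | [] , p = subst (allFin (s + r) ↭_) (++-identityʳ _) p
  ... | x ∷ R , p = contradiction (begin-strict
      s + r                                   ≡⟨ cong₂ _+_ core-length outer-length ⟨
      length core + length outer              ≡⟨ length-++ core ⟨
      length (core ++ outer)                  <⟨ m<m+n _ (s≤s z≤n) ⟩
      length (core ++ outer) + length (x ∷ R) ≡⟨ length-++ (core ++ outer) ⟨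
      length ((core ++ outer) ++ x ∷ R)       ≡⟨ ↭-length p ⟨
      length (allFin (s + r))                 ≡⟨ length-allFin (s + r) ⟩
      s + r                                   ∎) (n≮n (s + r))
    where open ≤-Reasoning

  deg-core-outer : ∀ {u} → u ∈ core → deg u outer ≡ r
  deg-core-outer {u} m = ≡.trans (≤-antisym (deg≤length u outer)
    (∑-≥length (λ v → joined? (toℕ u) (toℕ v)) (Unique.map⁺ (Fin.↑ʳ-injective s _ _) (Unique.allFin⁺ r))
      (λ m′ → m′ , inj₁ (core< m , outer≥ m′)))) outer-length

  2*edges : 2 * edgeCount graph ≡ e₂ core + 2 * (s * r)
  2*edges = begin
    2 * edgeCount graph                              ≡⟨ 2*edgeCount ⟩
    e₂ (allFin (s + r))                              ≡⟨ e₂-↭ allFin↭ ⟩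
    e₂ (core ++ outer)                               ≡⟨ e₂-++ core outer ⟩
    e₂ core + 2 * cross core outer + e₂ outer        ≡⟨ cong₂ (λ a b → e₂ core + 2 * a + b) joins independent ⟩
    e₂ core + 2 * (s * r) + 0                        ≡⟨ +-identityʳ _ ⟩
    e₂ core + 2 * (s * r)                            ∎
    where
    open ≡-Reasoning
    constant : ∀ (xs : List (Fin (s + r))) → (∀ {u} → u ∈ xs → deg u outer ≡ r) → cross xs outer ≡ length xs * r
    constant [] _ = refl
    constant (x ∷ xs) h = cong₂ _+_ (h (here refl)) (constant xs (λ m → h (there m)))
    joins : cross core outer ≡ s * r
    joins = ≡.trans (constant core deg-core-outer) (cong (_* r) core-length)
    independent : e₂ outer ≡ 0
    independent = cross-zero outer outer λ where
      a b (inj₁ (lt , _)) → <⇒≱ lt (outer≥ a)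
      a b (inj₂ (inj₁ (_ , lt))) → <⇒≱ lt (outer≥ b)
      a b (inj₂ (inj₂ e)) → <⇒≱ (M-core e) (outer≥ a)

module CompleteBipartite (s r : ℕ) where
  open CoreGraph s r 0 (λ _ _ → ⊥) (λ _ _ → no λ ()) (λ ()) (λ ()) (λ ())
    (λ _ vs _ → ≤-reflexive (∑-zero _ vs (λ _ → refl))) public

  edges : edgeCount graph ≡ s * r
  edges = *-cancelˡ-≡ _ _ 2 (≡.trans 2*edges (cong (_+ 2 * (s * r)) (Degrees.cross-zero graph core core λ where
    a b (inj₁ (_ , ge)) → <⇒≱ (core< b) ge
    a b (inj₂ (inj₁ (ge , _))) → <⇒≱ (core< a) ge)))

module MatchedCore (s r : ℕ) where

  -- Pairing `u` with `s - 1 - u` gives a maximum matching of the core. For odd `s` the middle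
  -- vertex would be its own partner and stays free.
  Matched : ℕ → ℕ → Set
  Matched u v = suc (u + v) ≡ s × u ≢ v

  matched? : ∀ u v → Dec (Matched u v)
  matched? u v = (suc (u + v) Data.Nat.≟ s) ×-dec ¬? (u Data.Nat.≟ v)

  partner-unique : ∀ {u v w} → suc (u + v) ≡ s → suc (u + w) ≡ s → v ≡ w
  partner-unique {u} p q = +-cancelˡ-≡ u _ _ (suc-injective (≡.trans p (sym q)))

  open CoreGraph s r 1 Matched matched?
    (λ {u} {v} (eq , ne) → ≡.trans (cong suc (+-comm v u)) eq , λ e → ne (sym e))
    (λ (_ , ne) → ne refl)
    (λ {u} {v} (eq , _) → subst (u <_) eq (s≤s (m≤m+n u v)))
    (λ u vs un → ∑-atMostOne (matched? u) un (λ (p , _) (q , _) → partner-unique p q)) public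
  open Degrees graph

  middle? : ∀ (u : Fin (s + r)) → Dec (suc (toℕ u + toℕ u) ≡ s)
  middle? u = suc (toℕ u + toℕ u) Data.Nat.≟ s

  core-joined : ∀ {u v} → u ∈ core → v ∈ core → Joined (toℕ u) (toℕ v) → Matched (toℕ u) (toℕ v)
  core-joined a b (inj₁ (_ , ge)) = contradiction ge (<⇒≱ (core< b))
  core-joined a b (inj₂ (inj₁ (ge , _))) = contradiction ge (<⇒≱ (core< a))
  core-joined a b (inj₂ (inj₂ e)) = e

  deg-core : ∀ {u} → u ∈ core → deg u core + 𝟙 (middle? u) ≡ 1
  deg-core {u} u∈ with middle? u
  ... | yes mid = cong (_+ 1) (deg-zero u core λ {v} v∈ e → let (eq , ne) = core-joined u∈ v∈ e in ne (partner-unique mid eq))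
  ... | no ¬mid with ≤⇒∃ (core< u∈)
  ...   | v , s≡ = ≡.trans (+-identityʳ _) (≤-antisym upper lower)
    where
    v<s : v < s
    v<s = subst (v <_) (sym s≡) (s≤s (m≤n+m v (toℕ u)))
    opposite : Fin (s + r)
    opposite = fromℕ< v<s ↑ˡ r
    toℕ-opposite : toℕ opposite ≡ v
    toℕ-opposite = ≡.trans (Fin.toℕ-↑ˡ (fromℕ< v<s) r) (Fin.toℕ-fromℕ< v<s)
    upper : deg u core ≤ 1
    upper = begin
      deg u core                                        ≤⟨ deg-mono core (λ m → m) ⟩
      ∑ (λ w → 𝟙 (matched? (toℕ u) (toℕ w))) core      ≤⟨ ∑-atMostOne (λ w → matched? (toℕ u) (toℕ w)) core-unique
                                                            (λ (p , _) (q , _) → Fin.toℕ-injective (partner-unique p q)) ⟩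
      1                                                 ∎
      where
      open ≤-Reasoning
      deg-mono : ∀ xs → (∀ {w} → w ∈ xs → w ∈ core) → deg u xs ≤ ∑ (λ w → 𝟙 (matched? (toℕ u) (toℕ w))) xs
      deg-mono xs sub = ∑-mono xs (λ {w} m → 𝟙-mono (joined? (toℕ u) (toℕ w)) (matched? (toℕ u) (toℕ w)) (core-joined u∈ (sub m)))
    lower : 1 ≤ deg u core
    lower = ∑-≥length (λ w → joined? (toℕ u) (toℕ w)) {[ opposite ]} ([] ∷ []) λ where
      (here refl) → ∈-map⁺ (_↑ˡ r) (∈-allFin (fromℕ< v<s)) , inj₂ (inj₂ (subst (Matched (toℕ u)) (sym toℕ-opposite)
        (sym s≡ , λ { refl → ¬mid (sym s≡) })))

  e₂-core : e₂ core + ∑ (λ u → 𝟙 (middle? u)) core ≡ s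
  e₂-core = begin
    e₂ core + ∑ (λ u → 𝟙 (middle? u)) core         ≡⟨ ∑-+ (λ u → deg u core) (λ u → 𝟙 (middle? u)) core ⟨
    ∑ (λ u → deg u core + 𝟙 (middle? u)) core      ≡⟨ ∑-cong core deg-core ⟩
    ∑ (λ _ → 1) core                               ≡⟨ ones core ⟩
    length core                                    ≡⟨ core-length ⟩
    s                                              ∎
    where
    open ≡-Reasoning
    ones : ∀ (xs : List (Fin (s + r))) → ∑ (λ _ → 1) xs ≡ length xs
    ones [] = refl
    ones (_ ∷ xs) = cong suc (ones xs)

  edges-even : ∀ h → s ≡ 2 * h → edgeCount graph ≡ h + s * r
  edges-even h s≡ = *-cancelˡ-≡ _ _ 2 (≡.trans 2*edges (≡.trans
    (cong (_+ 2 * (s * r)) (≡.trans (sym (+-identityʳ _)) (≡.trans (cong (e₂ core +_) (sym none)) (≡.trans e₂-core s≡))))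
    (sym (*-distribˡ-+ 2 h (s * r)))))
    where
    none : ∑ (λ u → 𝟙 (middle? u)) core ≡ 0
    none = ∑-zero _ core (λ {u} _ → 𝟙-no (middle? u) λ eq → even≢odd h (toℕ u)
      (≡.trans (sym s≡) (≡.trans (sym eq) (cong (λ x → suc (toℕ u + x)) (sym (+-identityʳ (toℕ u)))))))

  edges-odd : ∀ h → s ≡ suc (2 * h) → edgeCount graph ≡ h + s * r
  edges-odd h s≡ = *-cancelˡ-≡ _ _ 2 (≡.trans 2*edges (≡.trans
    (cong (_+ 2 * (s * r)) (suc-injective (begin
      suc (e₂ core)                            ≡⟨ +-comm 1 (e₂ core) ⟩
      e₂ core + 1                              ≡⟨ cong (e₂ core +_) one ⟨
      e₂ core + ∑ (λ u → 𝟙 (middle? u)) core   ≡⟨ e₂-core ⟩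
      s                                        ≡⟨ s≡ ⟩
      suc (2 * h)                              ∎)))
    (sym (*-distribˡ-+ 2 h (s * r)))))
    where
    open ≡-Reasoning
    h<s : h < s
    h<s = subst (h <_) (sym s≡) (s≤s (m≤m+n h (h + 0)))
    toℕ-mid : toℕ (fromℕ< h<s ↑ˡ r) ≡ h
    toℕ-mid = ≡.trans (Fin.toℕ-↑ˡ (fromℕ< h<s) r) (Fin.toℕ-fromℕ< h<s)
    s≡′ : suc (h + h) ≡ s
    s≡′ = ≡.trans (cong (λ x → suc (h + x)) (sym (+-identityʳ h))) (sym s≡)
    one : ∑ (λ u → 𝟙 (middle? u)) core ≡ 1
    one = ∑-unique middle? core-unique (∈-map⁺ (_↑ˡ r) (∈-allFin (fromℕ< h<s)))
      (subst (λ x → suc (x + x) ≡ s) (sym toℕ-mid) s≡′)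
      (λ {u} eq → Fin.toℕ-injective (≡.trans
        (*-cancelˡ-≡ (toℕ u) h 2 (suc-injective (≡.trans (cong (λ x → suc (toℕ u + x)) (+-identityʳ (toℕ u))) (≡.trans eq s≡))))
        (sym toℕ-mid)))

-- The threshold by parity of `k`, and assembly

≡2+2*∨≡3+2* : ∀ k → 2 ≤ k → ∃[ b ] (k ≡ 2 + 2 * b ⊎ k ≡ 3 + 2 * b)
≡2+2*∨≡3+2* 1 (s≤s ())
≡2+2*∨≡3+2* 2 _ = 0 , inj₁ refl
≡2+2*∨≡3+2* 3 _ = 0 , inj₂ refl
≡2+2*∨≡3+2* (suc (suc k@(suc (suc _)))) _ with ≡2+2*∨≡3+2* k (s≤s (s≤s z≤n))
... | b , inj₁ eq = suc b , inj₁ (≡.trans (cong (2 +_) eq) (lemma b))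
  where
  lemma : ∀ b → 2 + (2 + 2 * b) ≡ 2 + 2 * suc b
  lemma = solve-∀
... | b , inj₂ eq = suc b , inj₂ (≡.trans (cong (2 +_) eq) (lemma b))
  where
  lemma : ∀ b → 2 + (3 + 2 * b) ≡ 3 + 2 * suc b
  lemma = solve-∀

threshold-even : ∀ b → ⌈ 5 * (2 + 2 * b) + 1 /2⌉ ≡ 6 + 5 * b
threshold-even b = ≡.trans (cong ⌊_/2⌋ (eq b)) (sym (n≡⌊n+n/2⌋ (6 + 5 * b)))
  where
  eq : ∀ b → suc (5 * (2 + 2 * b) + 1) ≡ 6 + 5 * b + (6 + 5 * b)
  eq = solve-∀

threshold-odd : ∀ b → ⌈ 5 * (3 + 2 * b) + 1 /2⌉ ≡ 8 + 5 * b
threshold-odd b = ≡.trans (cong ⌈_/2⌉ (eq b)) (sym (n≡⌈n+n/2⌉ (8 + 5 * b)))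
  where
  eq : ∀ b → 5 * (3 + 2 * b) + 1 ≡ 8 + 5 * b + (8 + 5 * b)
  eq = solve-∀

module _ {n k : ℕ} (G : Graph n) (none : ¬ HasCycleWithChords k G) where
  open Degrees G using (e₂)
  open FromLists G using (2*edgeCount; sparse)
  open Peeling G (suc k) (sparse none)

  edgeCount≤ : ∀ {N M} → (∀ S → Unique S → length S ≡ N → e₂ S ≤ 2 * (suc k * M)) →
               ∀ d → n ≡ d + N → edgeCount G ≤ suc k * (d + M)
  edgeCount≤ {N} {M} base d n≡ = *-cancelˡ-≤ 2 (≤-trans (≤-reflexive 2*edgeCount)
    (peel {N} {M} base d (allFin n) (Unique.allFin⁺ n) (≡.trans (List.length-tabulate (λ i → i)) n≡)))

-- From here on the parity is that of `k`, so an even `k` uses the constants for odd `K`.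
base-even : ∀ b {n} (G : Graph n) → ¬ HasCycleWithChords (2 + 2 * b) G →
            ∀ S → Unique S → length S ≡ 6 + 5 * b → Degrees.e₂ G S ≤ 2 * ((3 + 2 * b) * (3 + 3 * b))
base-even b G none = Peeling.from-bound G (3 + 2 * b) (FromLists.sparse G none) {M = 3 + 3 * b} (admissible-odd b) (eq b)
  where
  eq : ∀ b → 11 * (b * b) + 25 * b + 17 + (6 + 5 * b) * (6 + 5 * b) + (6 + 5 * b) ≡ 6 * ((3 + 2 * b) * (3 + 3 * b)) + 5
  eq = solve-∀

base-odd : ∀ b {n} (G : Graph n) → ¬ HasCycleWithChords (3 + 2 * b) G →
           ∀ S → Unique S → length S ≡ 8 + 5 * b → Degrees.e₂ G S ≤ 2 * ((4 + 2 * b) * (4 + 3 * b))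
base-odd zero G none S uS len with Peeling.e₂-even G 4 (FromLists.sparse G none) S
... | h , eq = ≤-trans (≤-reflexive eq) (*-monoʳ-≤ 2 {h} {16} (divide 2 {h} {16}
  (≤-trans (≤-reflexive (sym eq)) (Four.eight G (FromLists.sparse G none) uS len)) ≤-refl))
base-odd (suc c) G none = Peeling.from-bound G (4 + 2 * suc c) (FromLists.sparse G none) {M = 4 + 3 * suc c} (admissible-even c) (eq (suc c))
  where
  eq : ∀ b → 11 * (b * b) + 35 * b + 29 + (8 + 5 * b) * (8 + 5 * b) + (8 + 5 * b) ≡ 6 * ((4 + 2 * b) * (4 + 3 * b)) + 5
  eq = solve-∀

∸-suc : ∀ k r → (suc k + r) ∸ k ∸ 1 ≡ r
∸-suc k r = ≡.trans (∸-+-assoc (suc k + r) k 1) (≡.trans (cong (suc k + r ∸_) (+-comm k 1)) (m+n∸m≡n (suc k) r))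

extremal-number : ∀ k N M → N ≡ suc k + M →
  (∀ {n} (G : Graph n) → ¬ HasCycleWithChords k G → ∀ S → Unique S → length S ≡ N → Degrees.e₂ G S ≤ 2 * (suc k * M)) →
  ∀ n → N ≤ n → g[ k , n ]≡ ((k + 1) * (n ∸ k ∸ 1))
extremal-number k N M refl base n N≤n with ≤⇒∃ N≤n
... | d , refl = subst (λ e → g[ k , suc k + M + d ]≡ e) (sym value)
  (subst (λ n → g[ k , n ]≡ (suc k * (d + M))) (sym n≡)
    ( (graph , noCycle (+-identityʳ (suc k)) , edges)
    , λ G none → edgeCount≤ G none {suc k + M} {M} (base G none) d (eq k M d)))
  where
  open CompleteBipartite (suc k) (d + M)
  n≡ : suc k + M + d ≡ suc k + (d + M)
  n≡ = ≡.trans (+-assoc (suc k) M d) (cong (suc k +_) (+-comm M d))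
  value : (k + 1) * (suc k + M + d ∸ k ∸ 1) ≡ suc k * (d + M)
  value = cong₂ _*_ (+-comm k 1) (≡.trans (cong (λ n → n ∸ k ∸ 1) n≡) (∸-suc k (d + M)))
  eq : ∀ k M d → suc k + (d + M) ≡ d + (suc k + M)
  eq = solve-∀

-- `r` stands for `n - k - 1` and `h` for the number of edges in the matching of the core. The last
-- equation amounts to `h + k = r + 1`.
sharpness : ∀ k r h n → n ≡ k + suc r → edgeCount (MatchedCore.graph k (suc r)) ≡ h + k * suc r → h + k * suc r ≡ suc k * r + 1 →
  ∃[ G ] (edgeCount {n} G ≡ (k + 1) * (n ∸ k ∸ 1) + 1 × ¬ HasCycleWithChords k G)
sharpness k r h .(k + suc r) refl count eq = graph , ≡.trans count (≡.trans eq (cong (_+ 1) (sym value))) , noCycle (+-comm k 1)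
  where
  open MatchedCore k (suc r)
  value : (k + 1) * (k + suc r ∸ k ∸ 1) ≡ suc k * r
  value = cong₂ _*_ (+-comm k 1) (cong (_∸ 1) (m+n∸m≡n k (suc r)))

mainTheorem2 : ∀ (k : ℕ) → 2 ≤ k →
    (∀ (n : ℕ) → ⌈ 5 * k + 1 /2⌉ ≤ n → g[ k , n ]≡ ((k + 1) * (n ∸ k ∸ 1)))
    ×
    (∀ (n : ℕ) → n ≡ ⌈ 5 * k + 1 /2⌉ ∸ 1 →
    ∃[ G ] (edgeCount {n} G ≡ (k + 1) * (n ∸ k ∸ 1) + 1
    × ¬ HasCycleWithChords k G))
mainTheorem2 k 2≤k with ≡2+2*∨≡3+2* k 2≤k
... | b , inj₁ refl =
  (λ n N≤n → extremal-number (2 + 2 * b) (6 + 5 * b) (3 + 3 * b) (eq₁ b) (base-even b) n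
    (subst (_≤ n) (threshold-even b) N≤n)) ,
  -- Here `n = 5 + 5b`, hence `n - k - 1 = 2 + 3b`, and the matching on `k` vertices has `1 + b`
  -- edges.
  λ n n≡ → sharpness (2 + 2 * b) (2 + 3 * b) (1 + b) n (≡.trans n≡ (≡.trans (cong (_∸ 1) (threshold-even b)) (eq₂ b)))
    (MatchedCore.edges-even (2 + 2 * b) (3 + 3 * b) (1 + b) (eq₃ b)) (eq₄ b)
  where
  eq₁ : ∀ b → 6 + 5 * b ≡ suc (2 + 2 * b) + (3 + 3 * b)
  eq₁ = solve-∀
  eq₂ : ∀ b → 5 + 5 * b ≡ 2 + 2 * b + suc (2 + 3 * b)
  eq₂ = solve-∀
  eq₃ : ∀ b → 2 + 2 * b ≡ 2 * (1 + b)
  eq₃ = solve-∀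
  eq₄ : ∀ b → 1 + b + (2 + 2 * b) * suc (2 + 3 * b) ≡ suc (2 + 2 * b) * (2 + 3 * b) + 1
  eq₄ = solve-∀
... | b , inj₂ refl =
  (λ n N≤n → extremal-number (3 + 2 * b) (8 + 5 * b) (4 + 3 * b) (eq₁ b) (base-odd b) n
    (subst (_≤ n) (threshold-odd b) N≤n)) ,
  λ n n≡ → sharpness (3 + 2 * b) (3 + 3 * b) (1 + b) n (≡.trans n≡ (≡.trans (cong (_∸ 1) (threshold-odd b)) (eq₂ b)))
    (MatchedCore.edges-odd (3 + 2 * b) (4 + 3 * b) (1 + b) (eq₃ b)) (eq₄ b)
  where
  eq₁ : ∀ b → 8 + 5 * b ≡ suc (3 + 2 * b) + (4 + 3 * b)
  eq₁ = solve-∀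
  eq₂ : ∀ b → 7 + 5 * b ≡ 3 + 2 * b + suc (3 + 3 * b)
  eq₂ = solve-∀
  eq₃ : ∀ b → 3 + 2 * b ≡ suc (2 * (1 + b))
  eq₃ = solve-∀
  eq₄ : ∀ b → 1 + b + (3 + 2 * b) * suc (3 + 3 * b) ≡ suc (3 + 2 * b) * (3 + 3 * b) + 1
  eq₄ = solve-∀
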